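{- The category whose objects are the limit cut complete MV-algebras and whose morphisms are all MV-algebra homomorphisms between them has coproducts (of arbitrary set-indexed families).
   Context: MV-algebras and their homomorphisms, maximal ideals and semisimplicity are standard. For an MV-algebra $A$ let $\operatorname{Max}A$ be its set of maximal ideals. For each $M\in\operatorname{Max}A$ the simple MV-algebra $A/M$ embeds in a unique way in the standard MV-algebra $[0,1]$, so one has a canonical homomorphism $A\to[0,1]^{\operatorname{Max}A}$, $a\mapsto\hat a$, where $\hat a(M)\in[0,1]$ is the image of $a/M$; it is injective iff $A$ is semisimple. Put $\hat A=\{\hat a\mid a\in A\}$. $A$ is limit cut complete (lcc) if it is semisimple and every $f\in[0,1]^{\operatorname{Max}A}$ which can be written both as $f=\bigvee X$ and as $f=\bigwedge Y$ with $X,Y\subseteq\hat A$ (joins and meets taken pointwise in $[0,1]^{\operatorname{Max}A}$) belongs to $\hat A$. Equivalently, lcc MV-algebras are, up to isomorphism, the algebras of clopens of Stone MV-spaces. -}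

module Defs where

open import Algebra.Core using (Op₁; Op₂)
open import Algebra.Definitions using (Involutive; RightZero)
open import Algebra.Structures using (IsCommutativeMonoid)
open import Data.Product using (Σ; ∃; ∃₂; _×_; _,_; proj₁; proj₂)
open import Data.Rational using (ℚ; 0ℚ; 1ℚ; ½; _<_; _+_; _*_; -_)
import Data.Rational.Properties as ℚₚ
import Data.Rational.Solver as ℚ-Solver
open import Data.Sum using (inj₁; inj₂)
open import Function using (_∘_; id)
open import Function.Bundles using (Func)
open import Function.Definitions using (Congruent; Injective)
open import Level using (Level; _⊔_; 0ℓ) renaming (suc to lsuc)
open import Relation.Binary using (Rel; Setoid; IsEquivalence; tri<; tri≈; tri>)
open import Relation.Binary.PropositionalEquality
  using (_≡_; refl; sym; trans; cong; subst; subst₂)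
open import Relation.Nullary using (¬_; contradiction)
open import Relation.Unary using (Pred; _∈_; _∉_; _⊆_; _≐_)
open import Relation.Unary.Properties using (≐-refl; ≐-sym; ≐-trans)

private variable
  i o h e p c ℓ c₁ ℓ₁ c₂ ℓ₂ : Level

record Category o h e : Set (lsuc (o ⊔ h ⊔ e)) where
  infix  4 _≈_
  infixr 9 _⊚_
  field
    Obj           : Set o
    _⇒_           : Obj → Obj → Set h
    _≈_           : ∀ {A B} → Rel (A ⇒ B) e
    idm           : ∀ {A} → A ⇒ A
    _⊚_           : ∀ {A B C} → B ⇒ C → A ⇒ B → A ⇒ C
    isEquivalence : ∀ {A B} → IsEquivalence (_≈_ {A} {B})
    ⊚-cong        : ∀ {A B C} {f f′ : B ⇒ C} {g g′ : A ⇒ B} →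
                    f ≈ f′ → g ≈ g′ → f ⊚ g ≈ f′ ⊚ g′
    assoc         : ∀ {A B C D} {f : C ⇒ D} {g : B ⇒ C} {k : A ⇒ B} →
                    (f ⊚ g) ⊚ k ≈ f ⊚ (g ⊚ k)
    identityˡ     : ∀ {A B} {f : A ⇒ B} → idm ⊚ f ≈ f
    identityʳ     : ∀ {A B} {f : A ⇒ B} → f ⊚ idm ≈ f

fullSubcategory : (C : Category o h e) → Pred (Category.Obj C) p →
                  Category (o ⊔ p) h e
fullSubcategory C P = record
  { Obj           = Σ C.Obj P
  ; _⇒_           = λ A B → proj₁ A C.⇒ proj₁ B
  ; _≈_           = C._≈_
  ; idm           = C.idm
  ; _⊚_           = C._⊚_
  ; isEquivalence = C.isEquivalence
  ; ⊚-cong        = C.⊚-cong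
  ; assoc         = C.assoc
  ; identityˡ     = C.identityˡ
  ; identityʳ     = C.identityʳ
  } where module C = Category C

module _ (C : Category o h e) where
  open Category C

  record Coproduct {I : Set i} (A : I → Obj) : Set (i ⊔ o ⊔ h ⊔ e) where
    field
      ∐       : Obj
      inj     : ∀ j → A j ⇒ ∐
      copair  : ∀ {B} → (∀ j → A j ⇒ B) → ∐ ⇒ B
      commute : ∀ {B} (f : ∀ j → A j ⇒ B) j → copair f ⊚ inj j ≈ f j
      unique  : ∀ {B} (f : ∀ j → A j ⇒ B) (k : ∐ ⇒ B) →
                (∀ j → k ⊚ inj j ≈ f j) → k ≈ copair f

HasCoproducts : ∀ i → Category o h e → Set (lsuc i ⊔ o ⊔ h ⊔ e)
HasCoproducts i C = {I : Set i} (A : I → Category.Obj C) → Coproduct C A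

module Cuts where
  open ℚ-Solver.+-*-Solver

  -- Dedekind cuts given by their lower half: q ∈ lower means q < x.
  -- Classically these are exactly the reals.
  record ℝ : Set₁ where
    field
      lower     : Pred ℚ 0ℓ
      inhabited : ∃ λ q → q ∈ lower
      bounded   : ∃ λ q → q ∉ lower
      downward  : ∀ {q r} → q < r → r ∈ lower → q ∈ lower
      rounded   : ∀ {q} → q ∈ lower → ∃ λ r → q < r × r ∈ lower

    ∈∉⇒< : ∀ {q r} → q ∈ lower → r ∉ lower → q < r
    ∈∉⇒< {q} {r} q∈ r∉ with ℚₚ.<-cmp q r
    ... | tri< q<r _ _    = q<r
    ... | tri≈ _ refl _   = contradiction q∈ r∉
    ... | tri> _ _ r<q    = contradiction (downward r<q q∈) r∉

  open ℝ public

  infix 4 _≤ᴿ_ _≈ᴿ_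
  _≤ᴿ_ _≈ᴿ_ : Rel ℝ 0ℓ
  x ≤ᴿ y = lower x ⊆ lower y
  x ≈ᴿ y = lower x ≐ lower y

  private
    half : ∀ q → ½ * q + ½ * q ≡ q
    half = solve 1 (λ q → con ½ :* q :+ con ½ :* q := q) refl

    neg-neg : ∀ q → - (- q) ≡ q
    neg-neg = solve 1 (λ q → :- (:- q) := q) refl

    shift : ∀ q r s → r + (q + - (r + s)) + s ≡ q
    shift = solve 3 (λ q r s → r :+ (q :+ :- (r :+ s)) :+ s := q) refl

    below : ∀ q → ∃ λ r → r < q
    below q = q + - 1ℚ ,
      subst (q + - 1ℚ <_) (ℚₚ.+-identityʳ q)
        (ℚₚ.+-monoʳ-< q (ℚₚ.negative⁻¹ (- 1ℚ)))

    neg-cancel-< : ∀ {q r} → - q < - r → r < q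
    neg-cancel-< {q} {r} lt =
      subst₂ _<_ (neg-neg r) (neg-neg q) (ℚₚ.neg-antimono-< lt)

    half-neg : ∀ {q} → q < 0ℚ → ½ * q < 0ℚ
    half-neg {q} q<0 = subst (½ * q <_) (ℚₚ.*-zeroʳ ½) (ℚₚ.*-monoʳ-<-pos ½ q<0)

  fromℚ : ℚ → ℝ
  fromℚ a = record
    { lower     = _< a
    ; inhabited = below a
    ; bounded   = a , ℚₚ.<-irrefl refl
    ; downward  = ℚₚ.<-trans
    ; rounded   = λ q<a → let r , q<r , r<a = ℚₚ.<-dense q<a in r , q<r , r<a
    }

  infixl 6 _+ᴿ_
  _+ᴿ_ : ℝ → ℝ → ℝ
  x +ᴿ y = record
    { lower     = λ q → ∃₂ λ r s → r ∈ lower x × s ∈ lower y × q ≡ r + s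
    ; inhabited = let r , r∈ = inhabited x ; s , s∈ = inhabited y
                  in r + s , r , s , r∈ , s∈ , refl
    ; bounded   = let a , a∉ = bounded x ; b , b∉ = bounded y
                  in a + b , λ (r , s , r∈ , s∈ , eq) →
                    ℚₚ.<-irrefl (sym eq) (ℚₚ.+-mono-< (∈∉⇒< x r∈ a∉) (∈∉⇒< y s∈ b∉))
    ; downward  = λ { {q} q<t (r , s , r∈ , s∈ , refl) →
                    r + (q + - (r + s)) , s
                    , downward x (less q<t) r∈ , s∈ , sym (shift q r s) }
    ; rounded   = λ { (r , s , r∈ , s∈ , refl) →
                    let r′ , r<r′ , r′∈ = rounded x r∈
                    in r′ + s , ℚₚ.+-monoˡ-< s r<r′ , r′ , s , r′∈ , s∈ , refl }
    }
    where
    less : ∀ {q r s} → q < r + s → r + (q + - (r + s)) < r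
    less {q} {r} {s} lt = subst (r + (q + - (r + s)) <_) (ℚₚ.+-identityʳ r)
      (ℚₚ.+-monoʳ-< r
        (subst (q + - (r + s) <_) (ℚₚ.+-inverseʳ (r + s))
          (ℚₚ.+-monoˡ-< (- (r + s)) lt)))

  infix 8 -ᴿ_
  -ᴿ_ : ℝ → ℝ
  -ᴿ x = record
    { lower     = λ q → ∃ λ r → r ∉ lower x × q < - r
    ; inhabited = let r , r∉ = bounded x ; q , q< = below (- r) in q , r , r∉ , q<
    ; bounded   = let a , a∈ = inhabited x
                  in - a , λ (r , r∉ , lt) →
                    r∉ (downward x (neg-cancel-< lt) a∈)
    ; downward  = λ q<s (r , r∉ , s<) → r , r∉ , ℚₚ.<-trans q<s s<
    ; rounded   = λ (r , r∉ , q<) →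
                    let s , q<s , s< = ℚₚ.<-dense q< in s , q<s , r , r∉ , s<
    }

  minᴿ : ℝ → ℝ → ℝ
  minᴿ x y = record
    { lower     = λ q → q ∈ lower x × q ∈ lower y
    ; inhabited = inh
    ; bounded   = let a , a∉ = bounded x in a , λ (a∈ , _) → a∉ a∈
    ; downward  = λ q<r (r∈x , r∈y) → downward x q<r r∈x , downward y q<r r∈y
    ; rounded   = λ (q∈x , q∈y) → rnd q∈x q∈y
    }
    where
    inh : ∃ λ q → q ∈ lower x × q ∈ lower y
    inh with inhabited x | inhabited y
    ... | a , a∈ | b , b∈ with ℚₚ.<-cmp a b
    ...   | tri< a<b _ _  = a , a∈ , downward y a<b b∈
    ...   | tri≈ _ refl _ = a , a∈ , b∈
    ...   | tri> _ _ b<a  = b , downward x b<a a∈ , b∈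

    rnd : ∀ {q} → q ∈ lower x → q ∈ lower y →
          ∃ λ r → q < r × r ∈ lower x × r ∈ lower y
    rnd q∈x q∈y with rounded x q∈x | rounded y q∈y
    ... | a , q<a , a∈ | b , q<b , b∈ with ℚₚ.<-cmp a b
    ...   | tri< a<b _ _  = a , q<a , a∈ , downward y a<b b∈
    ...   | tri≈ _ refl _ = a , q<a , a∈ , b∈
    ...   | tri> _ _ b<a  = b , q<b , downward x b<a a∈ , b∈

  0ᴿ 1ᴿ : ℝ
  0ᴿ = fromℚ 0ℚ
  1ᴿ = fromℚ 1ℚ

  record 𝕀 : Set₁ where
    constructor mk𝕀
    field
      val : ℝ
      0≤  : 0ᴿ ≤ᴿ val
      ≤1  : val ≤ᴿ 1ᴿ
  open 𝕀 public

  infix 4 _≤ᴵ_ _≈ᴵ_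
  _≤ᴵ_ _≈ᴵ_ : Rel 𝕀 0ℓ
  x ≤ᴵ y = val x ≤ᴿ val y
  x ≈ᴵ y = val x ≈ᴿ val y

  0ᴵ : 𝕀
  0ᴵ = mk𝕀 0ᴿ id (λ q<0 → ℚₚ.<-trans q<0 (ℚₚ.positive⁻¹ 1ℚ))

  infixl 6 _⊕ᴵ_
  _⊕ᴵ_ : 𝕀 → 𝕀 → 𝕀
  x ⊕ᴵ y = mk𝕀 (minᴿ 1ᴿ (val x +ᴿ val y))
    (λ {q} q<0 → ℚₚ.<-trans q<0 (ℚₚ.positive⁻¹ 1ℚ)
               , ½ * q , ½ * q , 0≤ x (half-neg q<0) , 0≤ y (half-neg q<0)
               , sym (half q))
    proj₁

  ~ᴵ_ : 𝕀 → 𝕀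
  ~ᴵ x = mk𝕀 (1ᴿ +ᴿ (-ᴿ val x)) lo hi
    where
    lo : 0ᴿ ≤ᴿ 1ᴿ +ᴿ (-ᴿ val x)
    lo {q} q<0 =
      1ℚ + ½ * q , ½ * q + - 1ℚ
      , subst (1ℚ + ½ * q <_) (ℚₚ.+-identityʳ 1ℚ) (ℚₚ.+-monoʳ-< 1ℚ (half-neg q<0))
      , (1ℚ , (λ 1∈ → ℚₚ.<-irrefl refl (≤1 x 1∈))
            , subst (½ * q + - 1ℚ <_) (ℚₚ.+-identityˡ (- 1ℚ))
                (ℚₚ.+-monoˡ-< (- 1ℚ) (half-neg q<0)))
      , eq q
      where
      eq : ∀ q → q ≡ (1ℚ + ½ * q) + (½ * q + - 1ℚ)
      eq = solve 1 (λ q → q := (con 1ℚ :+ con ½ :* q) :+ (con ½ :* q :+ :- con 1ℚ)) refl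

    hi : 1ᴿ +ᴿ (-ᴿ val x) ≤ᴿ 1ᴿ
    hi (r , s , r<1 , (t , t∉ , s<-t) , refl) =
      subst (r + s <_) (ℚₚ.+-identityʳ 1ℚ)
        (ℚₚ.+-mono-< r<1 (ℚₚ.<-≤-trans s<-t
          (ℚₚ.neg-antimono-≤ (ℚₚ.≮⇒≥ (λ t<0 → t∉ (0≤ x t<0))))))

open Cuts public using (𝕀; _≤ᴵ_; _≈ᴵ_)

𝕀-setoid : Setoid _ _
𝕀-setoid = record
  { Carrier       = 𝕀
  ; _≈_           = _≈ᴵ_
  ; isEquivalence = record { refl = ≐-refl ; sym = ≐-sym ; trans = ≐-trans }
  }

record RawMVAlgebra c ℓ : Set (lsuc (c ⊔ ℓ)) where
  infix  4 _≈_ _≤_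
  infixl 6 _⊕_ _⊖_
  infix  8 ~_
  field
    Carrier : Set c
    _≈_     : Rel Carrier ℓ
    _⊕_     : Op₂ Carrier
    ~_      : Op₁ Carrier
    0#      : Carrier

  1# : Carrier
  1# = ~ 0#

  _⊖_ : Op₂ Carrier
  a ⊖ b = ~ (~ a ⊕ b)

  dist : Op₂ Carrier
  dist a b = (a ⊖ b) ⊕ (b ⊖ a)

  _≤_ : Rel Carrier ℓ
  a ≤ b = ~ a ⊕ b ≈ 1#

record MVAlgebra c ℓ : Set (lsuc (c ⊔ ℓ)) where
  field
    raw : RawMVAlgebra c ℓ
  open RawMVAlgebra raw public
  field
    ⊕-isCommutativeMonoid : IsCommutativeMonoid _≈_ _⊕_ 0#
    ~-cong                : Congruent _≈_ _≈_ ~_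
    ~-involutive          : Involutive _≈_ ~_
    ⊕-zeroʳ               : RightZero _≈_ 1# _⊕_
    łukasiewicz           : ∀ a b → ~ (~ a ⊕ b) ⊕ b ≈ ~ (~ b ⊕ a) ⊕ a
  open IsCommutativeMonoid ⊕-isCommutativeMonoid public
    renaming (∙-cong to ⊕-cong)

-- x ⊕ y = min (1 , x + y) and ~ x = 1 - x.
𝕀-raw : RawMVAlgebra _ _
𝕀-raw = record
  { Carrier = 𝕀 ; _≈_ = _≈ᴵ_ ; _⊕_ = Cuts._⊕ᴵ_ ; ~_ = Cuts.~ᴵ_ ; 0# = Cuts.0ᴵ }

record IsMVHomomorphism (A : RawMVAlgebra c₁ ℓ₁) (B : RawMVAlgebra c₂ ℓ₂)
         (f : RawMVAlgebra.Carrier A → RawMVAlgebra.Carrier B) :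
         Set (c₁ ⊔ ℓ₁ ⊔ ℓ₂) where
  private
    module A = RawMVAlgebra A
    module B = RawMVAlgebra B
  field
    ⟦⟧-cong : Congruent A._≈_ B._≈_ f
    ⊕-homo  : ∀ a b → f (a A.⊕ b) B.≈ f a B.⊕ f b
    ~-homo  : ∀ a → f (A.~ a) B.≈ B.~ f a
    0#-homo : f A.0# B.≈ B.0#

record MVHom (A : MVAlgebra c₁ ℓ₁) (B : MVAlgebra c₂ ℓ₂) :
         Set (c₁ ⊔ ℓ₁ ⊔ c₂ ⊔ ℓ₂) where
  private
    module A = MVAlgebra A
    module B = MVAlgebra B
  field
    fun              : A.Carrier → B.Carrier
    isMVHomomorphism : IsMVHomomorphism A.raw B.raw fun
  open IsMVHomomorphism isMVHomomorphism public

MV : ∀ c ℓ → Category (lsuc (c ⊔ ℓ)) (c ⊔ ℓ) (c ⊔ ℓ)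
MV c ℓ = record
  { Obj           = MVAlgebra c ℓ
  ; _⇒_           = MVHom
  ; _≈_           = λ {_} {B} f g → ∀ a → MVAlgebra._≈_ B (fun f a) (fun g a)
  ; idm           = λ {A} → record
    { fun              = id
    ; isMVHomomorphism = record
      { ⟦⟧-cong = id
      ; ⊕-homo  = λ _ _ → MVAlgebra.refl A
      ; ~-homo  = λ _ → MVAlgebra.refl A
      ; 0#-homo = MVAlgebra.refl A
      }
    }
  ; _⊚_           = λ {_} {_} {C} f g → record
    { fun              = fun f ∘ fun g
    ; isMVHomomorphism = record
      { ⟦⟧-cong = ⟦⟧-cong f ∘ ⟦⟧-cong g
      ; ⊕-homo  = λ a b → MVAlgebra.trans C (⟦⟧-cong f (⊕-homo g a b)) (⊕-homo f _ _)
      ; ~-homo  = λ a → MVAlgebra.trans C (⟦⟧-cong f (~-homo g a)) (~-homo f _)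
      ; 0#-homo = MVAlgebra.trans C (⟦⟧-cong f (0#-homo g)) (0#-homo f)
      }
    }
  ; isEquivalence = λ {_} {B} → record
    { refl  = λ _ → MVAlgebra.refl B
    ; sym   = λ p a → MVAlgebra.sym B (p a)
    ; trans = λ p q a → MVAlgebra.trans B (p a) (q a)
    }
  ; ⊚-cong        = λ {_} {_} {C} {f} {_} {_} {g′} p q a →
                      MVAlgebra.trans C (⟦⟧-cong f (q a)) (p (fun g′ a))
  ; assoc         = λ {_} {_} {_} {D} _ → MVAlgebra.refl D
  ; identityˡ     = λ {_} {B} _ → MVAlgebra.refl B
  ; identityʳ     = λ {_} {B} _ → MVAlgebra.refl B
  } where open MVHom

module _ (A : MVAlgebra c ℓ) where
  open MVAlgebra A

  record IsIdeal (J : Pred Carrier ℓ) : Set (c ⊔ ℓ) where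
    field
      0∈       : 0# ∈ J
      ⊕-closed : ∀ {a b} → a ∈ J → b ∈ J → a ⊕ b ∈ J
      downward : ∀ {a b} → a ≤ b → b ∈ J → a ∈ J

  record IsMaximalIdeal (M : Pred Carrier ℓ) : Set (c ⊔ lsuc ℓ) where
    field
      isIdeal : IsIdeal M
      proper  : 1# ∉ M
      maximal : ∀ {J : Pred Carrier ℓ} → IsIdeal J → 1# ∉ J → M ⊆ J → J ⊆ M

  record MaxIdeal : Set (c ⊔ lsuc ℓ) where
    field
      ideal          : Pred Carrier ℓ
      isMaximalIdeal : IsMaximalIdeal ideal
  open MaxIdeal

  -- Max A as a set of subsets: ideals with the same elements are identified.
  Max : Setoid (c ⊔ lsuc ℓ) (c ⊔ ℓ)
  Max = record
    { Carrier       = MaxIdeal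
    ; _≈_           = λ M N → ideal M ≐ ideal N
    ; isEquivalence = record { refl = ≐-refl ; sym = ≐-sym ; trans = ≐-trans }
    }

  Quotient : Pred Carrier ℓ → RawMVAlgebra c ℓ
  Quotient J = record
    { Carrier = Carrier
    ; _≈_     = λ a b → dist a b ∈ J
    ; _⊕_     = _⊕_
    ; ~_      = ~_
    ; 0#      = 0#
    }

  record Embedding (M : MaxIdeal) : Set (lsuc 0ℓ ⊔ c ⊔ ℓ) where
    field
      emb              : Carrier → 𝕀
      isMVHomomorphism : IsMVHomomorphism (Quotient (ideal M)) 𝕀-raw emb
      injective        : Injective (RawMVAlgebra._≈_ (Quotient (ideal M))) _≈ᴵ_ emb
  open Embedding

  𝕀^Max : Set (c ⊔ lsuc ℓ)
  𝕀^Max = Func Max 𝕀-setoid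

  -- f is the function â: its value at M is the image of a/M under the
  -- embedding of A/M in [0,1].  Classically the embedding exists and is unique
  -- for every M, so this describes exactly one f for each a.
  IsHat : Carrier → 𝕀^Max → Set (c ⊔ lsuc ℓ)
  IsHat a f = ∀ M → Σ (Embedding M) λ ε → Func.to f M ≈ᴵ emb ε a

  Â : Pred 𝕀^Max (c ⊔ lsuc ℓ)
  Â f = ∃ λ a → IsHat a f

  -- Pointwise joins and meets; bounds range over [0,1], so that the empty
  -- join is 0 and the empty meet is 1.
  IsJoin IsMeet : 𝕀^Max → Pred 𝕀^Max p → Set (c ⊔ lsuc ℓ ⊔ p)
  IsJoin f X = ∀ M →
    (∀ g → g ∈ X → Func.to g M ≤ᴵ Func.to f M) ×
    (∀ u → (∀ g → g ∈ X → Func.to g M ≤ᴵ u) → Func.to f M ≤ᴵ u)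
  IsMeet f Y = ∀ M →
    (∀ g → g ∈ Y → Func.to f M ≤ᴵ Func.to g M) ×
    (∀ l → (∀ g → g ∈ Y → l ≤ᴵ Func.to g M) → l ≤ᴵ Func.to f M)

  IsSemisimple : Set (c ⊔ lsuc ℓ)
  IsSemisimple = ∀ a → (∀ (M : MaxIdeal) → a ∈ ideal M) → a ≈ 0#

  record IsLCC : Set (lsuc (c ⊔ lsuc ℓ)) where
    field
      isSemisimple : IsSemisimple
      cutComplete  : ∀ (f : 𝕀^Max) (X Y : Pred 𝕀^Max (c ⊔ lsuc ℓ)) →
                     X ⊆ Â → Y ⊆ Â → IsJoin f X → IsMeet f Y → f ∈ Â

LCC : ∀ c ℓ → Category (lsuc (c ⊔ lsuc ℓ)) (c ⊔ ℓ) (c ⊔ ℓ)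
LCC c ℓ = fullSubcategory (MV c ℓ) IsLCC

-- By Hölder's theorem the maximal ideals of an MV-algebra are the kernels of its homomorphisms
-- to [0,1], so homomorphisms f i : A i → B induce a map from Max B to X = ∏ Hom(A i , [0,1]).
-- The coproduct is the algebra of those functions on X which are both pointwise joins and
-- pointwise meets of term functions, i.e. of elements of the subalgebra generated by the A i.
-- A homomorphism ψ from it to [0,1] is evaluation at the restriction x of ψ to the A i, since ψ F
-- is squeezed between the values at x of the terms below and above F.  Hence the maximal ideals
-- are the points of X, so that joins and meets of its elements give no new functions; and
-- composing F with Max B → X yields a join and a meet of elements of B̂, hence an element of B.

module Submission where

import Algebra.Properties.AbelianGroup
import Algebra.Properties.CommutativeMonoid.Mult as Mult
open import Algebra.Bundles using (AbelianGroup; CommutativeMonoid)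
open import Axiom.ExcludedMiddle using (ExcludedMiddle)
open import Data.Bool using (Bool; T)
open import Data.Integer as ℤ using (+_; -[1+_])
import Data.Integer.Properties as ℤₚ
open import Data.Nat as ℕ using (ℕ; zero; suc)
import Data.Nat.Properties as ℕₚ
import Data.Nat.Solver as ℕ-Solver
open import Data.Product using (Σ; ∃; ∃₂; _×_; _,_; proj₁; proj₂)
open import Data.Rational as ℚ using (ℚ; 0ℚ; 1ℚ; ½; mkℚ; toℚᵘ)
import Data.Rational.Properties as ℚₚ
import Data.Rational.Solver as ℚ-Solver
open import Data.Rational.Unnormalised as ℚᵘ using (mkℚᵘ)
import Data.Rational.Unnormalised.Properties as ℚᵘₚ
open import Data.Sum using (_⊎_; inj₁; inj₂)
open import Function using (_∘_; id)
open import Function.Bundles using (Func)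
open import Level as Level using (_⊔_; 0ℓ; Lift; lift) renaming (suc to lsuc)
open import Relation.Binary using (Poset)
import Relation.Binary.PropositionalEquality as ≡
open ≡ using (_≡_)
import Relation.Binary.Reasoning.PartialOrder
import Relation.Binary.Reasoning.Setoid
open import Relation.Nullary using (¬_; contradiction; yes; no)
open import Relation.Nullary.Decidable using (decidable-stable; True; toWitness; fromWitness; ⌊_⌋)
open import Relation.Unary using (Pred; _∈_; _∉_; _⊆_; _≐_)
open import Defs
open Cuts using
  (ℝ; lower; rounded; ∈∉⇒<; _≤ᴿ_; _+ᴿ_; -ᴿ_; fromℚ; 0ᴿ; 1ᴿ; mk𝕀; val; 0ᴵ; _⊕ᴵ_; ~ᴵ_)

-- MV-algebras

-- Existence in Hölder's theorem is not enough: `IsHat` lets the embedding of A/M be chosen afresh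
-- each time, and only uniqueness makes the choices agree. Both halves come from counting units in
-- multiples n a. The limit of floor (n a) / n gives the embedding, while two homomorphisms with the
-- same kernel carry at the same steps, so that they differ by at most 1 on every n a.
--
-- The other obstacle is size. Points and elements of the coproduct are functions into [0,1], whose
-- cuts live in a higher universe, yet the carrier has to stay at the level of the summands.
-- Excluded middle cuts both the numbers and the side conditions down to `Set`.
--
-- Since a cut is given by its lower half, a pointwise join can be tested one rational at a time: q
-- lies below f x exactly if it lies below t x for some term t below f. Meets are treated as joins
-- of complements. Hence closure under addition needs two facts, that ⊕ and its dual ⊙ are both
-- lower semicontinuous.

module MVProperties {κ ℓ} (A : MVAlgebra κ ℓ) where
  open MVAlgebra A

  infixl 7 _⊙_ _∧_
  -- In [0,1] these are max (0 , a + b - 1) and the minimum.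
  _⊙_ _∧_ : Carrier → Carrier → Carrier
  a ⊙ b = ~ (~ a ⊕ ~ b)
  a ∧ b = a ⊖ (a ⊖ b)

  ~1≈0 : ~ 1# ≈ 0#
  ~1≈0 = ~-involutive 0#

  ⊕-zeroˡ : ∀ a → 1# ⊕ a ≈ 1#
  ⊕-zeroˡ a = trans (comm 1# a) (⊕-zeroʳ a)

  ~1⊕ : ∀ {x} a → x ≈ 1# → ~ x ⊕ a ≈ a
  ~1⊕ a x≈1 = trans (⊕-cong (trans (~-cong x≈1) ~1≈0) refl) (identityˡ a)

  -- Instantiated at `1#` and b, the Łukasiewicz law has ~ b ⊕ b on its left and a sum with `1#` on
  -- its right.
  ≤-reflexive : ∀ {a b} → a ≈ b → a ≤ b
  ≤-reflexive {a} {b} a≈b = trans (⊕-cong (~-cong a≈b) refl) (trans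
    (sym (⊕-cong (~-cong (~1⊕ b refl)) refl))
    (trans (łukasiewicz 1# b) (⊕-zeroʳ _)))

  ≤-refl : ∀ {a} → a ≤ a
  ≤-refl = ≤-reflexive refl

  -- The left side is the join of a and b; the Łukasiewicz law rewrites it as (a ⊖ b) ⊕ b, whose
  -- first summand vanishes.
  ≤⇒⊖⊕ : ∀ {a b} → a ≤ b → (b ⊖ a) ⊕ a ≈ b
  ≤⇒⊖⊕ {a} {b} a≤b = trans (łukasiewicz b a) (~1⊕ b a≤b)

  ≤-antisym : ∀ {a b} → a ≤ b → b ≤ a → a ≈ b
  ≤-antisym {a} {b} a≤b b≤a = sym (trans (sym (≤⇒⊖⊕ a≤b)) (~1⊕ a b≤a))

  a≤a⊕b : ∀ {a} b → a ≤ a ⊕ b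
  a≤a⊕b b = trans (sym (assoc _ _ _)) (trans (⊕-cong ≤-refl refl) (⊕-zeroˡ b))

  ≤-respʳ : ∀ {a b c} → b ≈ c → a ≤ b → a ≤ c
  ≤-respʳ b≈c a≤b = trans (⊕-cong refl (sym b≈c)) a≤b

  ≤-respˡ : ∀ {a b c} → a ≈ b → a ≤ c → b ≤ c
  ≤-respˡ a≈b a≤c = trans (⊕-cong (~-cong (sym a≈b)) refl) a≤c

  ≤-trans : ∀ {a b c} → a ≤ b → b ≤ c → a ≤ c
  ≤-trans {a} {b} {c} a≤b b≤c = ≤-respʳ
    (trans (comm a _) (trans (assoc _ _ a) (trans (⊕-cong refl (≤⇒⊖⊕ a≤b)) (≤⇒⊖⊕ b≤c))))
    (a≤a⊕b ((c ⊖ b) ⊕ (b ⊖ a)))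

  poset : Poset κ ℓ ℓ
  poset = record
    { Carrier = Carrier ; _≈_ = _≈_ ; _≤_ = _≤_
    ; isPartialOrder = record
      { isPreorder = record
        { isEquivalence = isEquivalence ; reflexive = ≤-reflexive ; trans = ≤-trans }
      ; antisym = ≤-antisym
      }
    }

  module ≤-Reasoning = Relation.Binary.Reasoning.PartialOrder poset
  open ≤-Reasoning

  0≤ : ∀ {a} → 0# ≤ a
  0≤ {a} = ⊕-zeroˡ a

  ≤1 : ∀ {a} → a ≤ 1#
  ≤1 = ⊕-zeroʳ _

  ≤0⇒≈0 : ∀ {a} → a ≤ 0# → a ≈ 0#
  ≤0⇒≈0 a≤0 = ≤-antisym a≤0 0≤

  ⊕-monoˡ : ∀ c {a b} → a ≤ b → a ⊕ c ≤ b ⊕ c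
  ⊕-monoˡ c {a} {b} a≤b = begin
    a ⊕ c                   ≤⟨ a≤a⊕b (b ⊖ a) ⟩
    (a ⊕ c) ⊕ (b ⊖ a)       ≈⟨ comm _ _ ⟩
    (b ⊖ a) ⊕ (a ⊕ c)       ≈⟨ assoc _ _ _ ⟨
    ((b ⊖ a) ⊕ a) ⊕ c       ≈⟨ ⊕-cong (≤⇒⊖⊕ a≤b) refl ⟩
    b ⊕ c                   ∎

  ⊕-mono : ∀ {a b c d} → a ≤ b → c ≤ d → a ⊕ c ≤ b ⊕ d
  ⊕-mono {a} {b} {c} {d} a≤b c≤d = begin
    a ⊕ c     ≤⟨ ⊕-monoˡ c a≤b ⟩
    b ⊕ c     ≈⟨ comm b c ⟩
    c ⊕ b     ≤⟨ ⊕-monoˡ b c≤d ⟩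
    d ⊕ b     ≈⟨ comm d b ⟩
    b ⊕ d     ∎

  ~-anti : ∀ {a b} → a ≤ b → ~ b ≤ ~ a
  ~-anti a≤b = trans (⊕-cong (~-involutive _) refl) (trans (comm _ _) a≤b)

  -- Residuation: up to bracketing and double negation, hypothesis and conclusion are the same
  -- equation ~ a ⊕ b ⊕ c ≈ 1#.
  ≤⊕⇒⊖≤ : ∀ {a b c} → a ≤ b ⊕ c → a ⊖ b ≤ c
  ≤⊕⇒⊖≤ le = trans (⊕-cong (~-involutive _) refl) (trans (assoc _ _ _) le)

  ⊖≤⇒≤⊕ : ∀ {a b c} → a ⊖ b ≤ c → a ≤ b ⊕ c
  ⊖≤⇒≤⊕ le = trans (sym (assoc _ _ _)) (trans (⊕-cong (sym (~-involutive _)) refl) le)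

  ≤⊕⊖ : ∀ a b → a ≤ b ⊕ (a ⊖ b)
  ≤⊕⊖ a b = ⊖≤⇒≤⊕ ≤-refl

  a⊖b≤a : ∀ a b → a ⊖ b ≤ a
  a⊖b≤a a b = ≤⊕⇒⊖≤ (≤-respʳ (comm a b) (a≤a⊕b b))

  ⊖-cong : ∀ {a b c d} → a ≈ b → c ≈ d → a ⊖ c ≈ b ⊖ d
  ⊖-cong a≈b c≈d = ~-cong (⊕-cong (~-cong a≈b) c≈d)

  ⊖-mono : ∀ {a b c d} → a ≤ b → d ≤ c → a ⊖ c ≤ b ⊖ d
  ⊖-mono a≤b d≤c = ~-anti (⊕-mono (~-anti a≤b) d≤c)

  ⊖-identityʳ : ∀ a → a ⊖ 0# ≈ a
  ⊖-identityʳ a = trans (~-cong (identityʳ _)) (~-involutive a)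

  ≤⇒⊖≈0 : ∀ {a b} → a ≤ b → a ⊖ b ≈ 0#
  ≤⇒⊖≈0 a≤b = trans (~-cong a≤b) ~1≈0

  ⊖≈0⇒≤ : ∀ {a b} → a ⊖ b ≈ 0# → a ≤ b
  ⊖≈0⇒≤ eq = trans (sym (~-involutive _)) (~-cong eq)

  ⊖-triangle : ∀ a b c → a ⊖ c ≤ (a ⊖ b) ⊕ (b ⊖ c)
  ⊖-triangle a b c = ≤⊕⇒⊖≤ (begin
    a                            ≤⟨ ≤⊕⊖ a b ⟩
    b ⊕ (a ⊖ b)                  ≤⟨ ⊕-monoˡ _ (≤⊕⊖ b c) ⟩
    (c ⊕ (b ⊖ c)) ⊕ (a ⊖ b)      ≈⟨ trans (assoc _ _ _) (⊕-cong refl (comm _ _)) ⟩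
    c ⊕ ((a ⊖ b) ⊕ (b ⊖ c))      ∎)

  ⊕-interchange : ∀ a b c d → (a ⊕ b) ⊕ (c ⊕ d) ≈ (a ⊕ c) ⊕ (b ⊕ d)
  ⊕-interchange a b c d = begin-equality
    (a ⊕ b) ⊕ (c ⊕ d)     ≈⟨ assoc a b _ ⟩
    a ⊕ (b ⊕ (c ⊕ d))     ≈⟨ ⊕-cong refl (assoc b c d) ⟨
    a ⊕ ((b ⊕ c) ⊕ d)     ≈⟨ ⊕-cong refl (⊕-cong (comm b c) refl) ⟩
    a ⊕ ((c ⊕ b) ⊕ d)     ≈⟨ ⊕-cong refl (assoc c b d) ⟩
    a ⊕ (c ⊕ (b ⊕ d))     ≈⟨ assoc a c _ ⟨
    (a ⊕ c) ⊕ (b ⊕ d)     ∎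

  ⊕-⊖-⊕ : ∀ a b c d → (a ⊕ b) ⊖ (c ⊕ d) ≤ (a ⊖ c) ⊕ (b ⊖ d)
  ⊕-⊖-⊕ a b c d = ≤⊕⇒⊖≤ (begin
    a ⊕ b                                ≤⟨ ⊕-mono (≤⊕⊖ a c) (≤⊕⊖ b d) ⟩
    (c ⊕ (a ⊖ c)) ⊕ (d ⊕ (b ⊖ d))        ≈⟨ ⊕-interchange _ _ _ _ ⟩
    (c ⊕ d) ⊕ ((a ⊖ c) ⊕ (b ⊖ d))        ∎)

  ~⊖~ : ∀ a b → ~ a ⊖ ~ b ≈ b ⊖ a
  ~⊖~ a b = ~-cong (trans (⊕-cong (~-involutive a) refl) (comm a (~ b)))

  ∧-lowerˡ : ∀ a b → a ∧ b ≤ a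
  ∧-lowerˡ a b = a⊖b≤a a (a ⊖ b)

  ∧-lowerʳ : ∀ a b → a ∧ b ≤ b
  ∧-lowerʳ a b = ≤⊕⇒⊖≤ (≤-respʳ (comm _ _) (≤⊕⊖ a b))

  -- Under ~ the meet becomes (~ b ⊖ ~ a) ⊕ ~ a, the join of the complements, and ~ c is above both
  -- of them.
  ∧-glb : ∀ {a b c} → c ≤ a → c ≤ b → c ≤ a ∧ b
  ∧-glb {a} {b} {c} c≤a c≤b = ≤-respˡ (~-involutive c) (~-anti (begin
    ~ a ⊕ ~ (~ a ⊕ b)              ≈⟨ comm _ _ ⟩
    ~ (~ a ⊕ b) ⊕ ~ a              ≈⟨ ⊕-cong (~-cong (trans (comm _ _) (⊕-cong (sym (~-involutive b)) refl))) refl ⟩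
    (~ b ⊖ ~ a) ⊕ ~ a              ≤⟨ ⊕-monoˡ _ (⊖-mono (~-anti c≤b) ≤-refl) ⟩
    (~ c ⊖ ~ a) ⊕ ~ a              ≈⟨ ≤⇒⊖⊕ (~-anti c≤a) ⟩
    ~ c                            ∎))

  -- The hypothesis says that the sum is not truncated.
  ⊕-⊖-cancel : ∀ {c m} → m ≤ ~ c → (c ⊕ m) ⊖ m ≈ c
  ⊕-⊖-cancel {c} {m} m≤~c = begin-equality
    ~ (~ (c ⊕ m) ⊕ m)          ≈⟨ ~-cong (⊕-cong (~-cong (⊕-cong (~-involutive c) refl)) refl) ⟨
    ~ ((~ c ⊖ m) ⊕ m)          ≈⟨ ~-cong (≤⇒⊖⊕ m≤~c) ⟩
    ~ (~ c)                    ≈⟨ ~-involutive c ⟩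
    c                          ∎

  -- Adding the left side c to m = a ∧ b stays below a and below b, hence below m. As that sum is
  -- not truncated, c can be recovered from it and is at most m ⊖ m.
  prelinear : ∀ a b → (b ⊖ a) ∧ (a ⊖ b) ≈ 0#
  prelinear a b = ≤0⇒≈0 (begin
      c               ≈⟨ ⊕-⊖-cancel m≤~c ⟨
      (c ⊕ m) ⊖ m     ≤⟨ ⊖-mono (∧-glb c⊕m≤a c⊕m≤b) ≤-refl ⟩
      m ⊖ m           ≈⟨ ≤⇒⊖≈0 ≤-refl ⟩
      0#              ∎)
    where
    c = (b ⊖ a) ∧ (a ⊖ b)
    m = a ∧ b
    c⊕m≤a : c ⊕ m ≤ a
    c⊕m≤a = begin
      c ⊕ m                            ≤⟨ ⊕-monoˡ m (∧-lowerʳ (b ⊖ a) (a ⊖ b)) ⟩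
      (a ⊖ b) ⊕ (a ⊖ (a ⊖ b))          ≈⟨ comm _ _ ⟩
      (a ⊖ (a ⊖ b)) ⊕ (a ⊖ b)          ≈⟨ ≤⇒⊖⊕ (a⊖b≤a a b) ⟩
      a                                ∎
    c⊕m≤b : c ⊕ m ≤ b
    c⊕m≤b = begin
      c ⊕ m                            ≤⟨ ⊕-mono (∧-lowerˡ (b ⊖ a) (a ⊖ b))
                                                 (∧-glb (∧-lowerʳ a b) (∧-lowerˡ a b)) ⟩
      (b ⊖ a) ⊕ (b ⊖ (b ⊖ a))          ≈⟨ comm _ _ ⟩
      (b ⊖ (b ⊖ a)) ⊕ (b ⊖ a)          ≈⟨ ≤⇒⊖⊕ (a⊖b≤a b a) ⟩
      b                                ∎
    m≤~c : m ≤ ~ c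
    m≤~c = begin
      m                  ≤⟨ ∧-lowerʳ a b ⟩
      b                  ≤⟨ a≤a⊕b (~ a) ⟩
      b ⊕ ~ a            ≈⟨ trans (comm _ _) (sym (~-involutive _)) ⟩
      ~ (a ⊖ b)          ≤⟨ ~-anti (∧-lowerʳ (b ⊖ a) (a ⊖ b)) ⟩
      ~ c                ∎

  -- Residuate twice: the left side minus x is below y and d, so the left side minus y ∧ d is below
  -- x and d. In `∧-prime` this closes an ideal under addition.
  ⊕-∧-≤ : ∀ x y d → (x ⊕ y) ∧ d ≤ (x ∧ d) ⊕ (y ∧ d)
  ⊕-∧-≤ x y d = ≤-respʳ (comm _ _) (⊖≤⇒≤⊕ (∧-glb
      (≤⊕⇒⊖≤ (≤-respʳ (comm _ _) (⊖≤⇒≤⊕ (∧-glb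
        (≤⊕⇒⊖≤ (∧-lowerˡ (x ⊕ y) d)) (≤-trans (a⊖b≤a _ x) z≤d)))))
      (≤-trans (a⊖b≤a _ _) z≤d)))
    where z≤d = ∧-lowerʳ (x ⊕ y) d

  dist≈0⇒≈ : ∀ {a b} → dist a b ≈ 0# → a ≈ b
  dist≈0⇒≈ {a} {b} d≈0 = ≤-antisym
    (⊖≈0⇒≤ (≤0⇒≈0 (≤-respʳ d≈0 (a≤a⊕b (b ⊖ a)))))
    (⊖≈0⇒≤ (≤0⇒≈0 (≤-respʳ (trans (comm _ _) d≈0) (a≤a⊕b (a ⊖ b)))))

  ≈⇒dist≈0 : ∀ {a b} → a ≈ b → dist a b ≈ 0#
  ≈⇒dist≈0 a≈b = trans (⊕-cong (≤⇒⊖≈0 (≤-reflexive a≈b)) (≤⇒⊖≈0 (≤-reflexive (sym a≈b))))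
    (identityˡ 0#)

  ⊙-cong : ∀ {a b c d} → a ≈ b → c ≈ d → a ⊙ c ≈ b ⊙ d
  ⊙-cong a≈b c≈d = ~-cong (⊕-cong (~-cong a≈b) (~-cong c≈d))

  ⊙-comm : ∀ a b → a ⊙ b ≈ b ⊙ a
  ⊙-comm a b = ~-cong (comm (~ a) (~ b))

  ≤~-sym : ∀ {a b} → a ≤ ~ b → b ≤ ~ a
  ≤~-sym = trans (comm _ _)

  ~≤-sym : ∀ {a b} → ~ a ≤ b → ~ b ≤ a
  ~≤-sym ~a≤b = ≤-respʳ (~-involutive _) (~-anti ~a≤b)

  ⊕-cancelʳ : ∀ {a b m} → a ≤ ~ m → b ≤ ~ m → a ⊕ m ≈ b ⊕ m → a ≈ b
  ⊕-cancelʳ {a} {b} {m} a≤~m b≤~m eq = begin-equality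
    a               ≈⟨ ⊕-⊖-cancel (≤~-sym a≤~m) ⟨
    (a ⊕ m) ⊖ m     ≈⟨ ⊖-cong eq refl ⟩
    (b ⊕ m) ⊖ m     ≈⟨ ⊕-⊖-cancel (≤~-sym b≤~m) ⟩
    b               ∎

  ⊕-commutativeMonoid : CommutativeMonoid κ ℓ
  ⊕-commutativeMonoid = record { isCommutativeMonoid = ⊕-isCommutativeMonoid }

  module ⊕× = Mult ⊕-commutativeMonoid
  open ⊕× using () renaming (_×_ to _·⊕_) public

module IdealProperties {κ ℓ} (A : MVAlgebra κ ℓ) {J : Pred (MVAlgebra.Carrier A) ℓ}
                       (isIdeal : IsIdeal A J) where
  open MVAlgebra A
  open MVProperties A
  open IsIdeal isIdeal

  ∈-resp : ∀ {a b} → a ≈ b → b ∈ J → a ∈ J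
  ∈-resp a≈b = downward (≤-reflexive a≈b)

  ≈0⇒∈ : ∀ {a} → a ≈ 0# → a ∈ J
  ≈0⇒∈ a≈0 = ∈-resp a≈0 0∈

  dist-∈⁻ : ∀ {a b} → dist a b ∈ J → a ⊖ b ∈ J × b ⊖ a ∈ J
  dist-∈⁻ d∈ = downward (a≤a⊕b _) d∈ , downward (≤-respʳ (comm _ _) (a≤a⊕b _)) d∈

  ≈⇒dist-∈ : ∀ {a b} → a ≈ b → dist a b ∈ J
  ≈⇒dist-∈ a≈b = ⊕-closed (≈0⇒∈ (≤⇒⊖≈0 (≤-reflexive a≈b)))
                          (≈0⇒∈ (≤⇒⊖≈0 (≤-reflexive (sym a≈b))))

  quotient : MVAlgebra κ ℓ
  quotient = record
    { raw = Quotient A J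
    ; ⊕-isCommutativeMonoid = record
      { isMonoid = record
        { isSemigroup = record
          { isMagma = record
            { isEquivalence = record
              { refl  = ≈⇒dist-∈ refl
              ; sym   = ∈-resp (comm _ _)
              ; trans = λ p q → let p₁ , p₂ = dist-∈⁻ p ; q₁ , q₂ = dist-∈⁻ q in ⊕-closed
                  (downward (⊖-triangle _ _ _) (⊕-closed p₁ q₁))
                  (downward (⊖-triangle _ _ _) (⊕-closed q₂ p₂))
              }
            ; ∙-cong = λ p q → let p₁ , p₂ = dist-∈⁻ p ; q₁ , q₂ = dist-∈⁻ q in ⊕-closed
                (downward (⊕-⊖-⊕ _ _ _ _) (⊕-closed p₁ q₁))
                (downward (⊕-⊖-⊕ _ _ _ _) (⊕-closed p₂ q₂))
            }
          ; assoc = λ a b c → ≈⇒dist-∈ (assoc a b c)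
          }
        ; identity = (λ a → ≈⇒dist-∈ (identityˡ a)) , (λ a → ≈⇒dist-∈ (identityʳ a))
        }
      ; comm = λ a b → ≈⇒dist-∈ (comm a b)
      }
    ; ~-cong       = λ p → let p₁ , p₂ = dist-∈⁻ p in ⊕-closed
        (∈-resp (~⊖~ _ _) p₂) (∈-resp (~⊖~ _ _) p₁)
    ; ~-involutive = λ a → ≈⇒dist-∈ (~-involutive a)
    ; ⊕-zeroʳ      = λ a → ≈⇒dist-∈ (⊕-zeroʳ a)
    ; łukasiewicz  = λ a b → ≈⇒dist-∈ (łukasiewicz a b)
    }

  ∈⇒dist-0-∈ : ∀ {a} → a ∈ J → dist a 0# ∈ J
  ∈⇒dist-0-∈ {a} a∈ = ⊕-closed (downward (a⊖b≤a a 0#) a∈) (≈0⇒∈ (≤⇒⊖≈0 0≤))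

  dist-0-∈⇒∈ : ∀ {a} → dist a 0# ∈ J → a ∈ J
  dist-0-∈⇒∈ {a} d∈ = ∈-resp (sym (⊖-identityʳ a)) (proj₁ (dist-∈⁻ d∈))

module HomProperties {a₁ ℓ₁ a₂ ℓ₂} (A : MVAlgebra a₁ ℓ₁) (B : MVAlgebra a₂ ℓ₂)
  {f : MVAlgebra.Carrier A → MVAlgebra.Carrier B}
  (isHom : IsMVHomomorphism (MVAlgebra.raw A) (MVAlgebra.raw B) f) where
  private
    module A = MVAlgebra A
    module B = MVAlgebra B
    module Aₚ = MVProperties A
    module Bₚ = MVProperties B
  open IsMVHomomorphism isHom public

  1#-homo : f A.1# B.≈ B.1#
  1#-homo = B.trans (~-homo A.0#) (B.~-cong 0#-homo)

  ⊖-homo : ∀ a b → f (a A.⊖ b) B.≈ f a B.⊖ f b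
  ⊖-homo a b = B.trans (~-homo _) (B.~-cong (B.trans (⊕-homo _ _) (B.⊕-cong (~-homo a) B.refl)))

  ⊙-homo : ∀ a b → f (a Aₚ.⊙ b) B.≈ f a Bₚ.⊙ f b
  ⊙-homo a b = B.trans (⊖-homo a (A.~ b)) (Bₚ.⊖-cong B.refl (~-homo b))

  dist-homo : ∀ a b → f (A.dist a b) B.≈ B.dist (f a) (f b)
  dist-homo a b = B.trans (⊕-homo _ _) (B.⊕-cong (⊖-homo a b) (⊖-homo b a))

  homo-mono : ∀ {a b} → a A.≤ b → f a B.≤ f b
  homo-mono {a} {b} a≤b = B.trans (B.⊕-cong (B.sym (~-homo a)) B.refl)
    (B.trans (B.sym (⊕-homo _ b)) (B.trans (⟦⟧-cong a≤b) 1#-homo))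

  trivial-kernel⇒injective : (∀ {a} → f a B.≈ B.0# → a A.≈ A.0#) → ∀ {a b} → f a B.≈ f b → a A.≈ b
  trivial-kernel⇒injective ker fa≈fb =
    Aₚ.dist≈0⇒≈ (ker (B.trans (dist-homo _ _) (Bₚ.≈⇒dist≈0 fa≈fb)))

-- Terms, and algebras embedded in a power of an MV-algebra

data Term {v} (V : Set v) : Set v where
  var : V → Term V
  _⊕ₜ_ : Term V → Term V → Term V
  ~ₜ_ : Term V → Term V
  0ₜ : Term V

module _ {κ ℓ} (R : RawMVAlgebra κ ℓ) where
  open RawMVAlgebra R

  eval : ∀ {v} {V : Set v} → (V → Carrier) → Term V → Carrier
  eval ρ (var v)  = ρ v
  eval ρ (s ⊕ₜ t) = eval ρ s ⊕ eval ρ t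
  eval ρ (~ₜ t)   = ~ eval ρ t
  eval ρ 0ₜ       = 0#

module _ {κ₁ ℓ₁ κ₂ ℓ₂ v} {V : Set v} (R : RawMVAlgebra κ₁ ℓ₁) (B : MVAlgebra κ₂ ℓ₂) {f}
         (hom : IsMVHomomorphism R (MVAlgebra.raw B) f) where
  open MVAlgebra B
  open IsMVHomomorphism hom

  eval-hom : ∀ {ρ : V → RawMVAlgebra.Carrier R} {σ} → (∀ v → f (ρ v) ≈ σ v) →
             ∀ t → f (eval R ρ t) ≈ eval raw σ t
  eval-hom ρ≈ (var v)  = ρ≈ v
  eval-hom ρ≈ (s ⊕ₜ t) = trans (⊕-homo _ _) (⊕-cong (eval-hom ρ≈ s) (eval-hom ρ≈ t))
  eval-hom ρ≈ (~ₜ t)   = trans (~-homo _) (~-cong (eval-hom ρ≈ t))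
  eval-hom ρ≈ 0ₜ       = 0#-homo

module _ {κ ℓ v} {V : Set v} (A : MVAlgebra κ ℓ) where
  open MVAlgebra A

  eval-cong : ∀ {ρ σ : V → Carrier} → (∀ v → ρ v ≈ σ v) → ∀ t → eval raw ρ t ≈ eval raw σ t
  eval-cong = eval-hom raw A (record
    { ⟦⟧-cong = id ; ⊕-homo = λ _ _ → refl ; ~-homo = λ _ → refl ; 0#-homo = refl })

-- Equational classes are closed under subalgebras of powers. Each law is a pair of terms that agree
-- in `B`; the equivalence and congruence laws of the raw structure `R` are pulled back along the
-- maps as well.
module JointlyInjective {κ ℓ κ′ ℓ′ x} {X : Set x} (R : RawMVAlgebra κ ℓ) (B : MVAlgebra κ′ ℓ′)
  (f : X → RawMVAlgebra.Carrier R → MVAlgebra.Carrier B)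
  (hom : ∀ x → IsMVHomomorphism R (MVAlgebra.raw B) (f x))
  (injective : ∀ {a b} → (∀ x → MVAlgebra._≈_ B (f x a) (f x b)) → RawMVAlgebra._≈_ R a b)
  where
  private
    open RawMVAlgebra R
    module B = MVAlgebra B
    module f x = IsMVHomomorphism (hom x)

    identity : ∀ s t → (∀ σ → eval B.raw {V = Carrier} σ s B.≈ eval B.raw σ t) →
               eval R id s ≈ eval R id t
    identity s t eq = injective λ x → B.trans (eval-hom R B (hom x) (λ _ → B.refl) s)
      (B.trans (eq (f x)) (B.sym (eval-hom R B (hom x) (λ _ → B.refl) t)))

  mvAlgebra : MVAlgebra κ ℓ
  mvAlgebra = record
    { raw = R
    ; ⊕-isCommutativeMonoid = record
      { isMonoid = record
        { isSemigroup = record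
          { isMagma = record
            { isEquivalence = record
              { refl  = injective λ _ → B.refl
              ; sym   = λ p → injective λ x → B.sym (f.⟦⟧-cong x p)
              ; trans = λ p q → injective λ x → B.trans (f.⟦⟧-cong x p) (f.⟦⟧-cong x q)
              }
            ; ∙-cong = λ p q → injective λ x → B.trans (f.⊕-homo x _ _)
                (B.trans (B.⊕-cong (f.⟦⟧-cong x p) (f.⟦⟧-cong x q)) (B.sym (f.⊕-homo x _ _)))
            }
          ; assoc = λ a b c → identity ((var a ⊕ₜ var b) ⊕ₜ var c) (var a ⊕ₜ (var b ⊕ₜ var c))
              λ σ → B.assoc _ _ _
          }
        ; identity = (λ a → identity (0ₜ ⊕ₜ var a) (var a) λ σ → B.identityˡ _)
                   , (λ a → identity (var a ⊕ₜ 0ₜ) (var a) λ σ → B.identityʳ _)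
        }
      ; comm = λ a b → identity (var a ⊕ₜ var b) (var b ⊕ₜ var a) λ σ → B.comm _ _
      }
    ; ~-cong       = λ p → injective λ x → B.trans (f.~-homo x _)
        (B.trans (B.~-cong (f.⟦⟧-cong x p)) (B.sym (f.~-homo x _)))
    ; ~-involutive = λ a → identity (~ₜ (~ₜ var a)) (var a) λ σ → B.~-involutive _
    ; ⊕-zeroʳ      = λ a → identity (var a ⊕ₜ (~ₜ 0ₜ)) (~ₜ 0ₜ) λ σ → B.⊕-zeroʳ _
    ; łukasiewicz  = λ a b → identity ((~ₜ ((~ₜ var a) ⊕ₜ var b)) ⊕ₜ var b)
        ((~ₜ ((~ₜ var b) ⊕ₜ var a)) ⊕ₜ var a) λ σ → B.łukasiewicz _ _
    }

  ≤-reflect : ∀ {a b} → (∀ x → f x a B.≤ f x b) → a ≤ b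
  ≤-reflect le = injective λ x → B.trans (f.⊕-homo x _ _)
    (B.trans (B.⊕-cong (f.~-homo x _) B.refl)
      (B.trans (le x) (B.sym (HomProperties.1#-homo mvAlgebra B (hom x)))))

-- Rational and real numbers

module ℚ-Identities where
  open ℚ-Solver.+-*-Solver

  r+[q-r]≡q : ∀ q r → r ℚ.+ (q ℚ.+ ℚ.- r) ≡ q
  r+[q-r]≡q = solve 2 (λ q r → r :+ (q :+ :- r) := q) ≡.refl

  p+q-q≡p : ∀ p q → p ℚ.+ q ℚ.+ ℚ.- q ≡ p
  p+q-q≡p = solve 2 (λ p q → p :+ q :+ :- q := p) ≡.refl

  p-q+q≡p : ∀ p q → p ℚ.+ ℚ.- q ℚ.+ q ≡ p
  p-q+q≡p = solve 2 (λ p q → p :+ :- q :+ q := p) ≡.refl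

  [t-q]+[q-r]≡t-r : ∀ t q r → t ℚ.+ ℚ.- q ℚ.+ (q ℚ.+ ℚ.- r) ≡ t ℚ.+ ℚ.- r
  [t-q]+[q-r]≡t-r = solve 3 (λ t q r → t :+ :- q :+ (q :+ :- r) := t :+ :- r) ≡.refl

  h-r≡-[r-h] : ∀ h r → h ℚ.+ ℚ.- r ≡ ℚ.- (r ℚ.+ ℚ.- h)
  h-r≡-[r-h] = solve 2 (λ h r → h :+ :- r := :- (r :+ :- h)) ≡.refl

  ½q+½q≡q : ∀ q → ½ ℚ.* q ℚ.+ ½ ℚ.* q ≡ q
  ½q+½q≡q = solve 1 (λ q → con ½ :* q :+ con ½ :* q := q) ≡.refl

  a+m+e≡a+[e+m] : ∀ a e m → a ℚ.+ m ℚ.+ e ≡ a ℚ.+ (e ℚ.+ m)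
  a+m+e≡a+[e+m] = solve 3 (λ a e m → a :+ m :+ e := a :+ (e :+ m)) ≡.refl

  a+b+c≡b+[a+c] : ∀ a b c → a ℚ.+ b ℚ.+ c ≡ b ℚ.+ (a ℚ.+ c)
  a+b+c≡b+[a+c] = solve 3 (λ a b c → a :+ b :+ c := b :+ (a :+ c)) ≡.refl

open ℚ-Identities

module ℚ× = Mult ℚₚ.+-0-commutativeMonoid

infixr 8 _·_

opaque
  _·_ : ℕ → ℚ → ℚ
  _·_ = ℚ×._×_

  ·-zero : ∀ q → 0 · q ≡ 0ℚ
  ·-zero q = ≡.refl

  ·-suc : ∀ n q → suc n · q ≡ q ℚ.+ n · q
  ·-suc n q = ≡.refl

  ·-one : ∀ q → 1 · q ≡ q
  ·-one = ℚ×.×-homo-1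

  ·-assoc : ∀ m n q → m · (n · q) ≡ (m ℕ.* n) · q
  ·-assoc m n q = ℚ×.×-assocˡ q m n

  ·-+-distrib : ∀ n p q → n · (p ℚ.+ q) ≡ n · p ℚ.+ n · q
  ·-+-distrib n p q = ℚ×.×-distrib-+ p q n

  ·-zeroʳ : ∀ n → n · 0ℚ ≡ 0ℚ
  ·-zeroʳ zero    = ≡.refl
  ·-zeroʳ (suc n) = ≡.trans (ℚₚ.+-identityˡ _) (·-zeroʳ n)

  ·-*-assoc : ∀ n p q → n · (p ℚ.* q) ≡ (n · p) ℚ.* q
  ·-*-assoc zero    p q = ≡.sym (ℚₚ.*-zeroˡ q)
  ·-*-assoc (suc n) p q =
    ≡.trans (≡.cong (p ℚ.* q ℚ.+_) (·-*-assoc n p q)) (≡.sym (ℚₚ.*-distribʳ-+ q p (n · p)))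

  ·1-* : ∀ n q → n · q ≡ (n · 1ℚ) ℚ.* q
  ·1-* n q = ≡.trans (≡.cong (n ·_) (≡.sym (ℚₚ.*-identityˡ q))) (·-*-assoc n 1ℚ q)

  toℚᵘ-·1 : ∀ n → toℚᵘ (n · 1ℚ) ℚᵘ.≃ mkℚᵘ (+ n) 0
  toℚᵘ-·1 zero    = ℚᵘ.*≡* ≡.refl
  toℚᵘ-·1 (suc n) =
    ℚᵘₚ.≃-trans (ℚₚ.toℚᵘ-homo-+ 1ℚ (n · 1ℚ))
      (ℚᵘₚ.≃-trans (ℚᵘₚ.+-congʳ (toℚᵘ 1ℚ) (toℚᵘ-·1 n))
        (ℚᵘ.*≡* (≡.cong (ℤ._* + 1) (≡.cong (λ z → + 1 ℤ.+ z) (ℤₚ.*-identityʳ (+ n))))))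

  <·1 : ∀ p → ∃ λ n → p ℚ.< n · 1ℚ
  <·1 p@(mkℚ k d _) = n , ℚₚ.toℚᵘ-cancel-<
      (ℚᵘₚ.<-respʳ-≃ (ℚᵘₚ.≃-sym (toℚᵘ-·1 n)) (ℚᵘ.*<* (lt k)))
    where
    n : ℕ
    -- This exceeds the numerator, and the denominator is at least 1.
    n = suc ℤ.∣ k ∣
    lt : ∀ k → k ℤ.* + 1 ℤ.< + suc ℤ.∣ k ∣ ℤ.* + suc d
    lt (+ a) rewrite ℤₚ.*-identityʳ (+ a) =
      ℤ.+<+ (ℕₚ.m≤m*n (suc a) (suc d))
    lt -[1+ a ] rewrite ℤₚ.*-identityʳ -[1+ a ] = ℤ.-<+

  ·1-positive : ∀ n → ℚ.Positive (suc n · 1ℚ)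
  ·1-positive n = ℚₚ.pos+nonNeg⇒pos 1ℚ (n · 1ℚ) {{nonNeg n}}
    where
    nonNeg : ∀ n → ℚ.NonNegative (n · 1ℚ)
    nonNeg zero    = _
    nonNeg (suc n) = ℚₚ.nonNeg+nonNeg⇒nonNeg 1ℚ (n · 1ℚ) {{nonNeg n}}

  ·-mono-< : ∀ n {p q} → p ℚ.< q → suc n · p ℚ.< suc n · q
  ·-mono-< n {p} {q} p<q rewrite ·1-* (suc n) p | ·1-* (suc n) q =
    ℚₚ.*-monoʳ-<-pos (suc n · 1ℚ) {{·1-positive n}} p<q

  ·-mono-≤ : ∀ n {p q} → p ℚ.≤ q → n · p ℚ.≤ n · q
  ·-mono-≤ zero    _   = ℚₚ.≤-refl
  ·-mono-≤ (suc n) p≤q = ℚₚ.+-mono-≤ p≤q (·-mono-≤ n p≤q)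

  ·-cancel-< : ∀ n {p q} → n · p ℚ.< n · q → p ℚ.< q
  ·-cancel-< n np<nq = ℚₚ.≰⇒> λ q≤p → ℚₚ.<-irrefl ≡.refl (ℚₚ.<-≤-trans np<nq (·-mono-≤ n q≤p))

  divide : ∀ n q → ∃ λ r → suc n · r ≡ q
  divide n q = r , ≡.trans (·1-* (suc n) r)
      (≡.trans (≡.sym (ℚₚ.*-assoc d (ℚ.1/ d) q))
        (≡.trans (≡.cong (ℚ._* q) (ℚₚ.*-inverseʳ d)) (ℚₚ.*-identityˡ q)))
    where
    d : ℚ
    d = suc n · 1ℚ
    instance
      d≢0 : ℚ.NonZero d
      d≢0 = ℚₚ.pos⇒nonZero d {{·1-positive n}}
    r : ℚ
    r = (ℚ.1/ d) ℚ.* q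

  archimedean : ∀ {ε} → 0ℚ ℚ.< ε → ∀ q → ∃ λ n → q ℚ.< n · ε
  archimedean {ε} 0<ε q = n ,
      ≡.subst₂ ℚ._<_ eq (≡.sym (·1-* n ε)) (ℚₚ.*-monoˡ-<-pos ε q/ε<n)
    where
    instance
      ε>0 : ℚ.Positive ε
      ε>0 = ℚ.positive 0<ε
      ε≢0 : ℚ.NonZero ε
      ε≢0 = ℚₚ.pos⇒nonZero ε
    bound : ∃ λ n → q ℚ.* ℚ.1/ ε ℚ.< n · 1ℚ
    bound = <·1 (q ℚ.* ℚ.1/ ε)
    n : ℕ
    n = proj₁ bound
    q/ε<n : q ℚ.* ℚ.1/ ε ℚ.< n · 1ℚ
    q/ε<n = proj₂ bound
    eq : q ℚ.* ℚ.1/ ε ℚ.* ε ≡ q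
    eq = ≡.trans (ℚₚ.*-assoc q (ℚ.1/ ε) ε)
      (≡.trans (≡.cong (q ℚ.*_) (ℚₚ.*-inverseˡ ε)) (ℚₚ.*-identityʳ q))

  ·1-mono-≤ : ∀ {m n} → m ℕ.≤ n → m · 1ℚ ℚ.≤ n · 1ℚ
  ·1-mono-≤ {n = n} ℕ.z≤n = nonneg n
    where
    nonneg : ∀ n → 0ℚ ℚ.≤ n · 1ℚ
    nonneg zero    = ℚₚ.≤-refl
    nonneg (suc n) = ℚₚ.<⇒≤ (ℚₚ.positive⁻¹ (suc n · 1ℚ) {{·1-positive n}})
  ·1-mono-≤ (ℕ.s≤s m≤n) = ℚₚ.+-monoʳ-≤ 1ℚ (·1-mono-≤ m≤n)

module _ (em : ∀ {a} → ExcludedMiddle a) where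

  infix 4 _⊑_ _≃_

  -- Wrapping the inclusions lets Agda infer the reals from a comparison.
  record _⊑_ (x y : ℝ) : Set where
    constructor incl
    field ⊑⇒≤ᴿ : x ≤ᴿ y
  open _⊑_

  record _≃_ (x y : ℝ) : Set where
    constructor both
    field
      ≃⇒⊑ : x ⊑ y
      ≃⇒⊒ : y ⊑ x
  open _≃_

  ⊑-total : ∀ x y → x ⊑ y ⊎ y ⊑ x
  ⊑-total x y with em {P = ∃ λ q → q ∈ lower x × q ∉ lower y}
  ... | yes (q , q∈x , q∉y) = inj₂ (incl λ r∈y → Cuts.downward x (∈∉⇒< y r∈y q∉y) q∈x)
  ... | no  ∄q              = inj₁ (incl λ {q} q∈x →
    decidable-stable em λ q∉y → ∄q (q , q∈x , q∉y))

  ℝ-poset : Poset _ _ _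
  ℝ-poset = record
    { Carrier = ℝ ; _≈_ = _≃_ ; _≤_ = _⊑_
    ; isPartialOrder = record
      { isPreorder = record
        { isEquivalence = record
          { refl  = both (incl λ q∈ → q∈) (incl λ q∈ → q∈)
          ; sym   = λ (both a b) → both b a
          ; trans = λ (both a b) (both c d) → both (a ⍮ c) (d ⍮ b)
          }
        ; reflexive = ≃⇒⊑
        ; trans     = _⍮_
        }
      ; antisym = both
      }
    }
    where
    _⍮_ : ∀ {x y z} → x ⊑ y → y ⊑ z → x ⊑ z
    incl a ⍮ incl b = incl λ q∈ → b (a q∈)

  module ⊑ = Poset ℝ-poset

  private
    <⇒-<0 : ∀ {p q} → p ℚ.< q → p ℚ.+ ℚ.- q ℚ.< 0ℚ
    <⇒-<0 {p} {q} p<q =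
      ≡.subst (p ℚ.+ ℚ.- q ℚ.<_) (ℚₚ.+-inverseʳ q) (ℚₚ.+-monoˡ-< (ℚ.- q) p<q)

    +<0⇒< : ∀ {r s} → s ℚ.< 0ℚ → r ℚ.+ s ℚ.< r
    +<0⇒< {r} {s} s<0 = ≡.subst (r ℚ.+ s ℚ.<_) (ℚₚ.+-identityʳ r) (ℚₚ.+-monoʳ-< r s<0)

  private
    transpose : ∀ {t q r} → t ℚ.+ ℚ.- q ℚ.< r → t ℚ.+ ℚ.- r ℚ.< q
    transpose {t} {q} {r} lt = ≡.subst₂ ℚ._<_
      ([t-q]+[q-r]≡t-r t q r)
      (r+[q-r]≡q q r)
      (ℚₚ.+-monoˡ-< (q ℚ.+ ℚ.- r) lt)

    <+⇒-< : ∀ {t p q} → t ℚ.< p ℚ.+ q → t ℚ.+ ℚ.- q ℚ.< p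
    <+⇒-< {t} {p} {q} lt = ≡.subst (t ℚ.+ ℚ.- q ℚ.<_)
      (p+q-q≡p p q) (ℚₚ.+-monoˡ-< (ℚ.- q) lt)

  -- Otherwise adding ε never leaves the cut, and from any of its elements one climbs past a bound.
  approximate : ∀ x {ε} → 0ℚ ℚ.< ε → ∃ λ r → r ∈ lower x × r ℚ.+ ε ∉ lower x
  approximate x {ε} 0<ε with em {P = ∃ λ r → r ∈ lower x × r ℚ.+ ε ∉ lower x}
  ... | yes found = found
  ... | no  none  = contradiction (Cuts.downward x b<a+nε (climb n)) b∉
    where
    a = proj₁ (Cuts.inhabited x)
    b = proj₁ (Cuts.bounded x)
    b∉ = proj₂ (Cuts.bounded x)
    n = proj₁ (archimedean 0<ε (b ℚ.+ ℚ.- a))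
    b<a+nε : b ℚ.< a ℚ.+ n · ε
    b<a+nε = ≡.subst (ℚ._< a ℚ.+ n · ε)
      (r+[q-r]≡q b a)
      (ℚₚ.+-monoʳ-< a (proj₂ (archimedean 0<ε (b ℚ.+ ℚ.- a))))
    climb : ∀ n → a ℚ.+ n · ε ∈ lower x
    climb zero    = ≡.subst (_∈ lower x)
      (≡.sym (≡.trans (≡.cong (a ℚ.+_) (·-zero ε)) (ℚₚ.+-identityʳ a))) (proj₂ (Cuts.inhabited x))
    climb (suc n) = decidable-stable em λ ∉ →
      none (a ℚ.+ n · ε , climb n , λ ∈ → ∉ (≡.subst (_∈ lower x)
        (≡.trans (a+m+e≡a+[e+m] a ε (n · ε))
          (≡.cong (a ℚ.+_) (≡.sym (·-suc n ε)))) ∈))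

  infixl 6 _⊞_
  infix 8 ⊟_

  opaque
    _⊞_ : ℝ → ℝ → ℝ
    _⊞_ = _+ᴿ_

    ⊟_ : ℝ → ℝ
    ⊟_ = -ᴿ_

    ⊞-mono : ∀ {x x′ y y′} → x ⊑ x′ → y ⊑ y′ → x ⊞ y ⊑ x′ ⊞ y′
    ⊞-mono (incl x≤) (incl y≤) = incl λ (r , s , r∈ , s∈ , eq) → r , s , x≤ r∈ , y≤ s∈ , eq

    ⊟-anti : ∀ {x y} → x ⊑ y → ⊟ y ⊑ ⊟ x
    ⊟-anti (incl x≤y) = incl λ (r , r∉y , q<) → r , (λ r∈x → r∉y (x≤y r∈x)) , q<

    ⊞-assoc : ∀ x y z → (x ⊞ y) ⊞ z ≃ x ⊞ (y ⊞ z)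
    ⊞-assoc x y z = both
      (incl λ { (_ , s , (a , b , a∈ , b∈ , ≡.refl) , s∈ , ≡.refl) →
           a , b ℚ.+ s , a∈ , (b , s , b∈ , s∈ , ≡.refl) , ℚₚ.+-assoc a b s })
      (incl λ { (a , _ , a∈ , (b , s , b∈ , s∈ , ≡.refl) , ≡.refl) →
           a ℚ.+ b , s , (a , b , a∈ , b∈ , ≡.refl) , s∈ , ≡.sym (ℚₚ.+-assoc a b s) })

    ⊞-comm : ∀ x y → x ⊞ y ≃ y ⊞ x
    ⊞-comm x y = both (swap x y) (swap y x)
      where
      swap : ∀ x y → x ⊞ y ⊑ y ⊞ x
      swap x y = incl λ { (r , s , r∈ , s∈ , ≡.refl) → s , r , s∈ , r∈ , ℚₚ.+-comm r s }

    ∈-⊞ : ∀ x y {q r} → r ∈ lower x → q ℚ.+ ℚ.- r ∈ lower y → q ∈ lower (x ⊞ y)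
    ∈-⊞ x y {q} {r} r∈ q-r∈ = r , q ℚ.+ ℚ.- r , r∈ , q-r∈ ,
      ≡.sym (r+[q-r]≡q q r)

    ⊞-identityʳ : ∀ x → x ⊞ 0ᴿ ≃ x
    ⊞-identityʳ x = both
      (incl λ { (r , s , r∈ , s<0 , ≡.refl) → Cuts.downward x (+<0⇒< s<0) r∈ })
      (incl λ {q} q∈ → let r , q<r , r∈ = rounded x q∈ in ∈-⊞ x 0ᴿ r∈ (<⇒-<0 q<r))

    ⊞-inverseʳ : ∀ x → x ⊞ (⊟ x) ≃ 0ᴿ
    ⊞-inverseʳ x = both (incl to) (incl from)
      where
      to : x ⊞ (⊟ x) ≤ᴿ 0ᴿ
      to (r , s , r∈ , (t , t∉ , s<-t) , ≡.refl) =
        ≡.subst (r ℚ.+ s ℚ.<_) (ℚₚ.+-inverseʳ t) (ℚₚ.+-mono-< (∈∉⇒< x r∈ t∉) s<-t)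
      from : 0ᴿ ≤ᴿ x ⊞ (⊟ x)
      from {q} q<0 = ∈-⊞ x (⊟ x) r∈ (r ℚ.+ ε , r+ε∉ , lt)
        where
        ε : ℚ
        -- Half of the distance from q to 0; the other half pays for the strict inequality that
        -- membership in `⊟ x` demands.
        ε = ℚ.- (½ ℚ.* q)
        ½q<0 : ½ ℚ.* q ℚ.< 0ℚ
        ½q<0 = ≡.subst (½ ℚ.* q ℚ.<_) (ℚₚ.*-zeroʳ ½) (ℚₚ.*-monoʳ-<-pos ½ q<0)
        q<½q : q ℚ.< ½ ℚ.* q
        q<½q = ≡.subst (ℚ._< ½ ℚ.* q)
          (½q+½q≡q q) (+<0⇒< ½q<0)
        apx : ∃ λ r → r ∈ lower x × r ℚ.+ ε ∉ lower x
        apx = approximate x (ℚₚ.neg-antimono-< ½q<0)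
        r : ℚ
        r = proj₁ apx
        r∈ : r ∈ lower x
        r∈ = proj₁ (proj₂ apx)
        r+ε∉ : r ℚ.+ ε ∉ lower x
        r+ε∉ = proj₂ (proj₂ apx)
        lt : q ℚ.+ ℚ.- r ℚ.< ℚ.- (r ℚ.+ ε)
        lt = ≡.subst (q ℚ.+ ℚ.- r ℚ.<_)
          (h-r≡-[r-h] (½ ℚ.* q) r)
          (ℚₚ.+-monoˡ-< (ℚ.- r) q<½q)

    fromℚ-+ : ∀ p q → fromℚ (p ℚ.+ q) ≃ fromℚ p ⊞ fromℚ q
    fromℚ-+ p q = both (incl to) (incl λ { (r , s , r<p , s<q , ≡.refl) → ℚₚ.+-mono-< r<p s<q })
      where
      to : fromℚ (p ℚ.+ q) ≤ᴿ fromℚ p ⊞ fromℚ q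
      to {t} t<p+q =
        let r , t-q<r , r<p = ℚₚ.<-dense (<+⇒-< {t} {p} {q} t<p+q)
        in ∈-⊞ (fromℚ p) (fromℚ q) {t} {r} r<p (transpose {t} {q} {r} t-q<r)

  ℝ-abelianGroup : AbelianGroup _ _
  ℝ-abelianGroup = record
    { Carrier = ℝ ; _≈_ = _≃_ ; _∙_ = _⊞_ ; ε = 0ᴿ ; _⁻¹ = ⊟_
    ; isAbelianGroup = record
      { isGroup = record
        { isMonoid = record
          { isSemigroup = record
            { isMagma = record
              { isEquivalence = ⊑.isEquivalence
              ; ∙-cong = λ (both a b) (both c d) → both (⊞-mono a c) (⊞-mono b d)
              }
            ; assoc = ⊞-assoc
            }
          ; identity = (λ x → ⊑.Eq.trans (⊞-comm 0ᴿ x) (⊞-identityʳ x)) , ⊞-identityʳ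
          }
        ; inverse = (λ x → ⊑.Eq.trans (⊞-comm (⊟ x) x) (⊞-inverseʳ x)) , ⊞-inverseʳ
        ; ⁻¹-cong = λ (both a b) → both (⊟-anti b) (⊟-anti a)
        }
      ; comm = ⊞-comm
      }
    }

  module ℝ+ = AbelianGroup ℝ-abelianGroup
  module ℝ+ₚ = Algebra.Properties.AbelianGroup ℝ-abelianGroup
  module ℝ× = Mult ℝ+.commutativeMonoid

  infixr 8 _·ᴿ_

  opaque
    _·ᴿ_ : ℕ → ℝ → ℝ
    _·ᴿ_ = ℝ×._×_

    ·ᴿ-zero : ∀ x → 0 ·ᴿ x ≃ 0ᴿ
    ·ᴿ-zero _ = ⊑.Eq.refl

    ·ᴿ-suc : ∀ n x → suc n ·ᴿ x ≃ x ⊞ n ·ᴿ x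
    ·ᴿ-suc _ _ = ⊑.Eq.refl

    ·ᴿ-one : ∀ x → 1 ·ᴿ x ≃ x
    ·ᴿ-one = ℝ×.×-homo-1

    ·ᴿ-zeroʳ : ∀ n → n ·ᴿ 0ᴿ ≃ 0ᴿ
    ·ᴿ-zeroʳ zero    = ⊑.Eq.refl
    ·ᴿ-zeroʳ (suc n) = ℝ+.trans (ℝ+.identityˡ _) (·ᴿ-zeroʳ n)

    ·ᴿ-+ : ∀ m n x → (m ℕ.+ n) ·ᴿ x ≃ m ·ᴿ x ⊞ n ·ᴿ x
    ·ᴿ-+ m n x = ℝ×.×-homo-+ x m n

    ·ᴿ-⊞ : ∀ n x y → n ·ᴿ (x ⊞ y) ≃ n ·ᴿ x ⊞ n ·ᴿ y
    ·ᴿ-⊞ n x y = ℝ×.×-distrib-+ x y n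

  module ⊑-Reasoning = Relation.Binary.Reasoning.PartialOrder ℝ-poset

  ⊞-monoˡ : ∀ z {x y} → x ⊑ y → x ⊞ z ⊑ y ⊞ z
  ⊞-monoˡ z x≤y = ⊞-mono x≤y ⊑.refl

  ⊞-monoʳ : ∀ z {x y} → x ⊑ y → z ⊞ x ⊑ z ⊞ y
  ⊞-monoʳ z x≤y = ⊞-mono ⊑.refl x≤y

  ⊞-cancelʳ-⊑ : ∀ z {x y} → x ⊞ z ⊑ y ⊞ z → x ⊑ y
  ⊞-cancelʳ-⊑ z {x} {y} le = begin
    x                     ≈⟨ ℝ+ₚ.//-rightDividesʳ z x ⟨
    x ⊞ z ⊞ (⊟ z)      ≤⟨ ⊞-monoˡ (⊟ z) le ⟩
    y ⊞ z ⊞ (⊟ z)      ≈⟨ ℝ+ₚ.//-rightDividesʳ z y ⟩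
    y                     ∎
    where open ⊑-Reasoning

  opaque
    unfolding _·ᴿ_

    ·ᴿ-mono : ∀ n {x y} → x ⊑ y → n ·ᴿ x ⊑ n ·ᴿ y
    ·ᴿ-mono zero    _   = ⊑.refl
    ·ᴿ-mono (suc n) x≤y = ⊞-mono x≤y (·ᴿ-mono n x≤y)

  fromℚ-cancel : ∀ {p q} → fromℚ p ⊑ fromℚ q → p ℚ.≤ q
  fromℚ-cancel (incl le) = ℚₚ.≮⇒≥ λ q<p → ℚₚ.<-irrefl ≡.refl (le q<p)

  fromℚ-· : ∀ n q → fromℚ (n · q) ≃ n ·ᴿ fromℚ q
  fromℚ-· zero    q = ℝ+.trans (⊑.Eq.reflexive (≡.cong fromℚ (·-zero q))) (ℝ+.sym (·ᴿ-zero (fromℚ q)))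
  fromℚ-· (suc n) q = ℝ+.trans (⊑.Eq.reflexive (≡.cong fromℚ (·-suc n q)))
    (ℝ+.trans (fromℚ-+ q (n · q))
      (ℝ+.trans (ℝ+.∙-congˡ (fromℚ-· n q)) (ℝ+.sym (·ᴿ-suc n (fromℚ q)))))

  ∈⇒fromℚ-⊑ : ∀ x {q} → q ∈ lower x → fromℚ q ⊑ x
  ∈⇒fromℚ-⊑ x q∈ = incl λ r<q → Cuts.downward x r<q q∈

  ∉⇒⊑-fromℚ : ∀ x {q} → q ∉ lower x → x ⊑ fromℚ q
  ∉⇒⊑-fromℚ x q∉ = incl λ r∈ → ∈∉⇒< x r∈ q∉

  -- Rationals q < r separating y < x would satisfy n (r - q) ≤ k for every n.
  ⊑-archimedean : ∀ k {x y} → (∀ n → n ·ᴿ x ⊑ n ·ᴿ y ⊞ k ·ᴿ 1ᴿ) → x ⊑ y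
  ⊑-archimedean k {x} {y} bound = incl λ {q} q∈x → decidable-stable em λ q∉y →
    let r , q<r , r∈x = rounded x q∈x
        0<δ = ≡.subst (ℚ._< r ℚ.+ ℚ.- q) (ℚₚ.+-inverseʳ q) (ℚₚ.+-monoˡ-< (ℚ.- q) q<r)
        n , large = archimedean 0<δ (k · 1ℚ)
    in ℚₚ.<-irrefl ≡.refl (ℚₚ.<-≤-trans large (small q∉y r∈x n))
    where
    small : ∀ {q r} → q ∉ lower y → r ∈ lower x → ∀ n → n · (r ℚ.+ ℚ.- q) ℚ.≤ k · 1ℚ
    small {q} {r} q∉y r∈x n = ≡.subst₂ ℚ._≤_ eq₁ eq₂ (ℚₚ.+-monoˡ-≤ (n · ℚ.- q) (fromℚ-cancel (begin
        fromℚ (n · r)                       ≈⟨ fromℚ-· n r ⟩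
        n ·ᴿ fromℚ r                        ≤⟨ ·ᴿ-mono n (∈⇒fromℚ-⊑ x r∈x) ⟩
        n ·ᴿ x                              ≤⟨ bound n ⟩
        n ·ᴿ y ⊞ k ·ᴿ 1ᴿ                   ≤⟨ ⊞-monoˡ (k ·ᴿ 1ᴿ) (·ᴿ-mono n (∉⇒⊑-fromℚ y q∉y)) ⟩
        n ·ᴿ fromℚ q ⊞ k ·ᴿ 1ᴿ             ≈⟨ ℝ+.∙-cong (fromℚ-· n q) (fromℚ-· k 1ℚ) ⟨
        fromℚ (n · q) ⊞ fromℚ (k · 1ℚ)     ≈⟨ fromℚ-+ (n · q) (k · 1ℚ) ⟨
        fromℚ (n · q ℚ.+ k · 1ℚ)            ∎)))
      where
      open ⊑-Reasoning
      eq₁ : n · r ℚ.+ n · ℚ.- q ≡ n · (r ℚ.+ ℚ.- q)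
      eq₁ = ≡.sym (·-+-distrib n r (ℚ.- q))
      eq₂ : n · q ℚ.+ k · 1ℚ ℚ.+ n · ℚ.- q ≡ k · 1ℚ
      eq₂ = ≡.trans (a+b+c≡b+[a+c] (n · q) (k · 1ℚ) (n · ℚ.- q))
        (≡.trans (≡.cong (k · 1ℚ ℚ.+_) (≡.trans (≡.sym (·-+-distrib n q (ℚ.- q)))
          (≡.trans (≡.cong (n ·_) (ℚₚ.+-inverseʳ q)) (·-zeroʳ n)))) (ℚₚ.+-identityʳ (k · 1ℚ)))

  -- The hypotheses place m (k n) / (k n) between m n / n and (m n + 1) / n. These intervals
  -- therefore all contain one real, the supremum of the m n / n.
  module _ (m : ℕ → ℕ)
    (super : ∀ k n → k ℕ.* m n ℕ.≤ m (k ℕ.* n))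
    (sub   : ∀ k n → m (suc k ℕ.* n) ℕ.< suc k ℕ.* suc (m n)) where

    private
      Below : Pred ℚ 0ℓ
      Below q = ∃ λ n → suc n · q ℚ.< m (suc n) · 1ℚ

      -- The bound at index suc n and a supposed witness at suc k are compared at the product of the
      -- indices: `super` carries the witness there, `sub` the bound.
      unbelow : ∀ n {q} → suc (m (suc n)) · 1ℚ ℚ.≤ suc n · q → q ∉ Below
      unbelow n {q} le (k , lt) = ℚₚ.<-irrefl ≡.refl (begin-strict
          suc k · (suc n · q)                  ≡⟨ ·-assoc (suc k) (suc n) q ⟩
          (suc k ℕ.* suc n) · q                ≡⟨ ≡.cong (_· q) (ℕₚ.*-comm (suc k) (suc n)) ⟩
          (suc n ℕ.* suc k) · q                ≡⟨ ·-assoc (suc n) (suc k) q ⟨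
          suc n · (suc k · q)                  <⟨ ·-mono-< n lt ⟩
          suc n · (m (suc k) · 1ℚ)             ≡⟨ ·-assoc (suc n) (m (suc k)) 1ℚ ⟩
          (suc n ℕ.* m (suc k)) · 1ℚ           ≤⟨ ·1-mono-≤ (super (suc n) (suc k)) ⟩
          m (suc n ℕ.* suc k) · 1ℚ             ≡⟨ ≡.cong (λ i → m i · 1ℚ) (ℕₚ.*-comm (suc n) (suc k)) ⟩
          m (suc k ℕ.* suc n) · 1ℚ             ≤⟨ ·1-mono-≤ (ℕₚ.<⇒≤ (sub k (suc n))) ⟩
          (suc k ℕ.* suc (m (suc n))) · 1ℚ     ≡⟨ ·-assoc (suc k) (suc (m (suc n))) 1ℚ ⟨
          suc k · (suc (m (suc n)) · 1ℚ)       ≤⟨ ·-mono-≤ (suc k) le ⟩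
          suc k · (suc n · q)                  ∎)
        where open ℚₚ.≤-Reasoning

    limit : ℝ
    limit = record
      { lower     = Below
      ; inhabited = ℚ.- 1ℚ , 0 , ℚₚ.<-≤-trans
                      (≡.subst (ℚ._< 0ℚ) (≡.sym (·-one (ℚ.- 1ℚ))) (ℚₚ.negative⁻¹ (ℚ.- 1ℚ)))
                      (≡.subst (ℚ._≤ m 1 · 1ℚ) (·-zero 1ℚ) (·1-mono-≤ (ℕ.z≤n {m 1})))
      ; bounded   = suc (m 1) · 1ℚ ,
                    unbelow 0 {suc (m 1) · 1ℚ} (ℚₚ.≤-reflexive (≡.sym (·-one (suc (m 1) · 1ℚ))))
      ; downward  = λ q<r (n , lt) → n , ℚₚ.<-trans (·-mono-< n q<r) lt
      ; rounded   = λ {q} (n , lt) →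
          let p , q<p , p<m = ℚₚ.<-dense lt
              r , eq = divide n p
          in r , ·-cancel-< (suc n) {q} {r} (≡.subst (suc n · q ℚ.<_) (≡.sym eq) q<p)
               , n , ≡.subst (ℚ._< m (suc n) · 1ℚ) (≡.sym eq) p<m
      }

    limit-lower : ∀ n → m (suc n) ·ᴿ 1ᴿ ⊑ suc n ·ᴿ limit
    limit-lower n = begin
        m (suc n) ·ᴿ 1ᴿ            ≈⟨ fromℚ-· (m (suc n)) 1ℚ ⟨
        fromℚ (m (suc n) · 1ℚ)     ≡⟨ ≡.cong fromℚ (proj₂ d) ⟨
        fromℚ (suc n · r)          ≈⟨ fromℚ-· (suc n) r ⟩
        suc n ·ᴿ fromℚ r           ≤⟨ ·ᴿ-mono (suc n) (incl λ {q} q<r →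
                                        n , ≡.subst (suc n · q ℚ.<_) (proj₂ d) (·-mono-< n q<r)) ⟩
        suc n ·ᴿ limit             ∎
      where
      open ⊑-Reasoning
      d = divide n (m (suc n) · 1ℚ)
      r = proj₁ d

    limit-upper : ∀ n → suc n ·ᴿ limit ⊑ suc (m (suc n)) ·ᴿ 1ᴿ
    limit-upper n = begin
        suc n ·ᴿ limit                   ≤⟨ ·ᴿ-mono (suc n) (∉⇒⊑-fromℚ limit r∉) ⟩
        suc n ·ᴿ fromℚ r                 ≈⟨ fromℚ-· (suc n) r ⟨
        fromℚ (suc n · r)                ≡⟨ ≡.cong fromℚ (proj₂ d) ⟩
        fromℚ (suc (m (suc n)) · 1ℚ)     ≈⟨ fromℚ-· (suc (m (suc n))) 1ℚ ⟩
        suc (m (suc n)) ·ᴿ 1ᴿ            ∎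
      where
      open ⊑-Reasoning
      d = divide n (suc (m (suc n)) · 1ℚ)
      r = proj₁ d
      r∉ : r ∉ Below
      r∉ = unbelow n {r} (ℚₚ.≤-reflexive (≡.sym (proj₂ d)))

  -- The MV-algebra [0,1]

  module UnitInterval where
    open ⊑-Reasoning

    ≤ᴵ⇒⊑ : ∀ x y → x ≤ᴵ y → val x ⊑ val y
    ≤ᴵ⇒⊑ _ _ le = incl le

    ≈ᴵ⇒≃ : ∀ x y → x ≈ᴵ y → val x ≃ val y
    ≈ᴵ⇒≃ _ _ (a , b) = both (incl a) (incl b)

    ≃⇒≈ᴵ : ∀ x y → val x ≃ val y → x ≈ᴵ y
    ≃⇒≈ᴵ _ _ (both (incl a) (incl b)) = a , b

    0⊑ : ∀ x → 0ᴿ ⊑ val x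
    0⊑ x = incl (Cuts.0≤ x)

    ⊑1 : ∀ x → val x ⊑ 1ᴿ
    ⊑1 x = incl (Cuts.≤1 x)

    infixl 6 _⊹_
    infix 8 ∼_

    -- Opaque copies of the operations of [0,1], which must not unfold to cuts.
    opaque
      _⊹_ : 𝕀 → 𝕀 → 𝕀
      _⊹_ = _⊕ᴵ_

      ∼_ : 𝕀 → 𝕀
      ∼_ = ~ᴵ_

    opaque
      unfolding _⊞_ _⊹_

      ⊹-⊑-⊞ : ∀ x y → val (x ⊹ y) ⊑ val x ⊞ val y
      ⊹-⊑-⊞ x y = incl proj₂

      ⊹-glb : ∀ x y {z} → z ⊑ 1ᴿ → z ⊑ val x ⊞ val y → z ⊑ val (x ⊹ y)
      ⊹-glb x y (incl a) (incl b) = incl λ q∈ → a q∈ , b q∈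

      ∼-complement : ∀ x → val (∼ x) ⊞ val x ≃ 1ᴿ
      ∼-complement x = ℝ+ₚ.//-rightDividesˡ (val x) 1ᴿ

    ⊹-⊞ : ∀ x y → val x ⊞ val y ⊑ 1ᴿ → val (x ⊹ y) ≃ val x ⊞ val y
    ⊹-⊞ x y le = both (⊹-⊑-⊞ x y) (⊹-glb x y le ⊑.refl)

    ⊹-1 : ∀ x y → 1ᴿ ⊑ val x ⊞ val y → val (x ⊹ y) ≃ 1ᴿ
    ⊹-1 x y le = both (⊑1 (x ⊹ y)) (⊹-glb x y ⊑.refl le)

    ⊹-mono : ∀ x x′ y y′ → val x ⊑ val x′ → val y ⊑ val y′ → val (x ⊹ y) ⊑ val (x′ ⊹ y′)
    ⊹-mono x x′ y y′ a b =
      ⊹-glb x′ y′ (⊑1 (x ⊹ y)) (⊑.trans (⊹-⊑-⊞ x y) (⊞-mono a b))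

    ∼-unique : ∀ x {z} → z ⊞ val x ≃ 1ᴿ → z ≃ val (∼ x)
    ∼-unique x {z} eq = ℝ+ₚ.∙-cancelʳ (val x) z (val (∼ x)) (ℝ+.trans eq (ℝ+.sym (∼-complement x)))

    ∼-anti : ∀ x y → val x ⊑ val y → val (∼ y) ⊑ val (∼ x)
    ∼-anti x y le = ⊞-cancelʳ-⊑ (val x) (begin
      val (∼ y) ⊞ val x     ≤⟨ ⊞-monoʳ _ le ⟩
      val (∼ y) ⊞ val y     ≈⟨ ∼-complement y ⟩
      1ᴿ                     ≈⟨ ∼-complement x ⟨
      val (∼ x) ⊞ val x     ∎)

    ∼-involutive : ∀ x → val (∼ (∼ x)) ≃ val x
    ∼-involutive x = ℝ+.sym (∼-unique (∼ x)
      (ℝ+.trans (ℝ+.comm (val x) (val (∼ x))) (∼-complement x)))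

    ∼-0 : val (∼ 0ᴵ) ≃ 1ᴿ
    ∼-0 = ℝ+.sym (∼-unique 0ᴵ (ℝ+.identityʳ 1ᴿ))

    ∼-1⇒0 : ∀ x → val x ≃ 1ᴿ → val (∼ x) ≃ 0ᴿ
    ∼-1⇒0 x eq = ℝ+.sym (∼-unique x (ℝ+.trans (ℝ+.identityˡ (val x)) eq))

    ⊹-comm : ∀ x y → val (x ⊹ y) ≃ val (y ⊹ x)
    ⊹-comm x y = both (le x y) (le y x)
      where
      le : ∀ x y → val (x ⊹ y) ⊑ val (y ⊹ x)
      le x y = ⊹-glb y x (⊑1 (x ⊹ y)) (⊑.trans (⊹-⊑-⊞ x y) (⊑.reflexive (ℝ+.comm (val x) (val y))))

    -- The inner truncation is harmless: either a + b is at most 1 and nothing is lost, or `a ⊹ b`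
    -- is 1 already. Truncated sums can thus be compared through the sums in the group of reals.
    ⊹-sum-mono : ∀ x y z a b c → val x ⊞ val y ⊞ val z ⊑ val a ⊞ val b ⊞ val c →
                  val ((x ⊹ y) ⊹ z) ⊑ val ((a ⊹ b) ⊹ c)
    ⊹-sum-mono x y z a b c le = ⊹-glb (a ⊹ b) c (⊑1 w) bound
      where
      w = (x ⊹ y) ⊹ z
      bound : val w ⊑ val (a ⊹ b) ⊞ val c
      bound with ⊑-total (val a ⊞ val b) 1ᴿ
      ... | inj₁ ≤1 = begin
        val w                       ≤⟨ ⊹-⊑-⊞ (x ⊹ y) z ⟩
        val (x ⊹ y) ⊞ val z        ≤⟨ ⊞-monoˡ (val z) (⊹-⊑-⊞ x y) ⟩
        val x ⊞ val y ⊞ val z       ≤⟨ le ⟩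
        val a ⊞ val b ⊞ val c       ≈⟨ ℝ+.∙-congʳ (⊹-⊞ a b ≤1) ⟨
        val (a ⊹ b) ⊞ val c        ∎
      ... | inj₂ 1≤ = begin
        val w                       ≤⟨ ⊑1 w ⟩
        1ᴿ                          ≈⟨ ⊹-1 a b 1≤ ⟨
        val (a ⊹ b)                ≈⟨ ℝ+.identityʳ _ ⟨
        val (a ⊹ b) ⊞ 0ᴿ           ≤⟨ ⊞-monoʳ _ (0⊑ c) ⟩
        val (a ⊹ b) ⊞ val c        ∎

    -- Commutativity turns the right side into a left-nested sum of the rotated triple, the shape
    -- that `⊹-sum-mono` handles.
    ⊹-assoc : ∀ x y z → val ((x ⊹ y) ⊹ z) ≃ val (x ⊹ (y ⊹ z))
    ⊹-assoc x y z = begin-equality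
      val ((x ⊹ y) ⊹ z)     ≈⟨ both (⊹-sum-mono x y z y z x (⊑.reflexive rotate))
                                      (⊹-sum-mono y z x x y z (⊑.reflexive (ℝ+.sym rotate))) ⟩
      val ((y ⊹ z) ⊹ x)     ≈⟨ ⊹-comm (y ⊹ z) x ⟩
      val (x ⊹ (y ⊹ z))     ∎
      where
      rotate : val x ⊞ val y ⊞ val z ≃ val y ⊞ val z ⊞ val x
      rotate = ℝ+.trans (ℝ+.assoc (val x) (val y) (val z)) (ℝ+.comm (val x) (val y ⊞ val z))

    ⊹-identityʳ : ∀ x → val (x ⊹ 0ᴵ) ≃ val x
    ⊹-identityʳ x = ℝ+.trans
      (⊹-⊞ x 0ᴵ (⊑.trans (⊑.reflexive (ℝ+.identityʳ (val x))) (⊑1 x))) (ℝ+.identityʳ (val x))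

    ⊹-zeroʳ : ∀ x → val (x ⊹ ∼ 0ᴵ) ≃ val (∼ 0ᴵ)
    ⊹-zeroʳ x = ℝ+.trans (⊹-1 x (∼ 0ᴵ) (begin
      1ᴿ                       ≈⟨ ℝ+.identityˡ 1ᴿ ⟨
      0ᴿ ⊞ 1ᴿ                  ≤⟨ ⊞-mono (0⊑ x) (⊑.reflexive (ℝ+.sym ∼-0)) ⟩
      val x ⊞ val (∼ 0ᴵ)      ∎)) (ℝ+.sym ∼-0)

    ⊑⇒∼⊹-1 : ∀ x y → val x ⊑ val y → val (∼ x ⊹ y) ≃ 1ᴿ
    ⊑⇒∼⊹-1 x y x≤y = ⊹-1 (∼ x) y (begin
      1ᴿ                     ≈⟨ ∼-complement x ⟨
      val (∼ x) ⊞ val x     ≤⟨ ⊞-monoʳ _ x≤y ⟩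
      val (∼ x) ⊞ val y     ∎)

    ∼⊹-1⇒⊑ : ∀ x y → val (∼ x ⊹ y) ≃ 1ᴿ → val x ⊑ val y
    ∼⊹-1⇒⊑ x y eq = ⊞-cancelʳ-⊑ (val (∼ x)) (begin
      val x ⊞ val (∼ x)     ≈⟨ ℝ+.comm _ _ ⟩
      val (∼ x) ⊞ val x     ≈⟨ ∼-complement x ⟩
      1ᴿ                     ≈⟨ eq ⟨
      val (∼ x ⊹ y)        ≤⟨ ⊹-⊑-⊞ (∼ x) y ⟩
      val (∼ x) ⊞ val y     ≈⟨ ℝ+.comm _ _ ⟩
      val y ⊞ val (∼ x)     ∎)

    private
      join-larger : ∀ x y → val x ⊑ val y → val (∼ (∼ x ⊹ y) ⊹ y) ≃ val y
      join-larger x y x≤y = ℝ+.trans (⊹-⊞ u y (⊑.trans (⊑.reflexive sum) (⊑1 y))) sum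
        where
        u = ∼ (∼ x ⊹ y)
        sum : val u ⊞ val y ≃ val y
        sum = ℝ+.trans (ℝ+.∙-congʳ (∼-1⇒0 (∼ x ⊹ y) (⊑⇒∼⊹-1 x y x≤y))) (ℝ+.identityˡ (val y))

      join-smaller : ∀ x y → val x ⊑ val y → val (∼ (∼ y ⊹ x) ⊹ x) ≃ val y
      join-smaller x y x≤y = ℝ+.trans (⊹-⊞ u x (⊑.trans (⊑.reflexive sum) (⊑1 y))) sum
        where
        u = ∼ (∼ y ⊹ x)
        exact : val (∼ y ⊹ x) ≃ val (∼ y) ⊞ val x
        exact = ⊹-⊞ (∼ y) x (⊑.trans (⊞-monoʳ _ x≤y) (⊑.reflexive (∼-complement y)))
        sum : val u ⊞ val x ≃ val y
        sum = ℝ+ₚ.∙-cancelʳ (val (∼ y)) _ _ (begin-equality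
          val u ⊞ val x ⊞ val (∼ y)       ≈⟨ ℝ+.trans (ℝ+.assoc _ _ _) (ℝ+.∙-congˡ (ℝ+.comm _ _)) ⟩
          val u ⊞ (val (∼ y) ⊞ val x)     ≈⟨ ℝ+.∙-congˡ exact ⟨
          val u ⊞ val (∼ y ⊹ x)          ≈⟨ ∼-complement (∼ y ⊹ x) ⟩
          1ᴿ                               ≈⟨ ∼-complement y ⟨
          val (∼ y) ⊞ val y               ≈⟨ ℝ+.comm _ _ ⟩
          val y ⊞ val (∼ y)               ∎)

    -- Both sides are the maximum of x and y.
    ⊹-łukasiewicz : ∀ x y → val (∼ (∼ x ⊹ y) ⊹ y) ≃ val (∼ (∼ y ⊹ x) ⊹ x)
    ⊹-łukasiewicz x y with ⊑-total (val x) (val y)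
    ... | inj₁ x≤y = ℝ+.trans (join-larger x y x≤y) (ℝ+.sym (join-smaller x y x≤y))
    ... | inj₂ y≤x = ℝ+.trans (join-smaller y x y≤x) (ℝ+.sym (join-larger y x y≤x))

    record _≋_ (x y : 𝕀) : Set where
      constructor val≃
      field ≋⇒≃ : val x ≃ val y
    open _≋_ public

    infix 4 _≋_

    𝕀°-raw : RawMVAlgebra _ _
    𝕀°-raw = record { Carrier = 𝕀 ; _≈_ = _≋_ ; _⊕_ = _⊹_ ; ~_ = ∼_ ; 0# = 0ᴵ }

    𝕀° : MVAlgebra _ _
    𝕀° = record
      { raw = 𝕀°-raw
      ; ⊕-isCommutativeMonoid = record
        { isMonoid = record
          { isSemigroup = record
            { isMagma = record
              { isEquivalence = record
                { refl  = val≃ ℝ+.refl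
                ; sym   = λ (val≃ a) → val≃ (ℝ+.sym a)
                ; trans = λ (val≃ a) (val≃ b) → val≃ (ℝ+.trans a b)
                }
              ; ∙-cong = λ {x} {x′} {y} {y′} (val≃ (both a b)) (val≃ (both c d)) →
                  val≃ (both (⊹-mono x x′ y y′ a c) (⊹-mono x′ x y′ y b d))
              }
            ; assoc = λ x y z → val≃ (⊹-assoc x y z)
            }
          ; identity = (λ x → val≃ (ℝ+.trans (⊹-comm 0ᴵ x) (⊹-identityʳ x)))
                     , (λ x → val≃ (⊹-identityʳ x))
          }
        ; comm = λ x y → val≃ (⊹-comm x y)
        }
      ; ~-cong       = λ {x} {y} (val≃ (both a b)) → val≃ (both (∼-anti y x b) (∼-anti x y a))
      ; ~-involutive = λ x → val≃ (∼-involutive x)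
      ; ⊕-zeroʳ      = λ x → val≃ (⊹-zeroʳ x)
      ; łukasiewicz  = λ x y → val≃ (⊹-łukasiewicz x y)
      }

    opaque
      unfolding _⊹_

      toOpaque : ∀ {c ℓ} {R : RawMVAlgebra c ℓ} {f} → IsMVHomomorphism R 𝕀-raw f → IsMVHomomorphism R 𝕀°-raw f
      toOpaque {f = f} h = record
        { ⟦⟧-cong = λ a≈b → val≃ (≈ᴵ⇒≃ (f _) (f _) (⟦⟧-cong a≈b))
        ; ⊕-homo  = λ a b → val≃ (≈ᴵ⇒≃ (f _) (f a ⊹ f b) (⊕-homo a b))
        ; ~-homo  = λ a → val≃ (≈ᴵ⇒≃ (f _) (∼ f a) (~-homo a))
        ; 0#-homo = val≃ (≈ᴵ⇒≃ (f _) 0ᴵ 0#-homo)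
        }
        where open IsMVHomomorphism h

      fromOpaque : ∀ {c ℓ} {R : RawMVAlgebra c ℓ} {f} → IsMVHomomorphism R 𝕀°-raw f → IsMVHomomorphism R 𝕀-raw f
      fromOpaque {f = f} h = record
        { ⟦⟧-cong = λ a≈b → ≃⇒≈ᴵ (f _) (f _) (≋⇒≃ (⟦⟧-cong a≈b))
        ; ⊕-homo  = λ a b → ≃⇒≈ᴵ (f _) (f a ⊹ f b) (≋⇒≃ (⊕-homo a b))
        ; ~-homo  = λ a → ≃⇒≈ᴵ (f _) (∼ f a) (≋⇒≃ (~-homo a))
        ; 0#-homo = ≃⇒≈ᴵ (f _) 0ᴵ (≋⇒≃ 0#-homo)
        }
        where open IsMVHomomorphism h

  open UnitInterval

  -- Hölder's theorem

  module MaximalIdealProperties {κ ℓ} (A : MVAlgebra κ ℓ) {M : Pred (MVAlgebra.Carrier A) ℓ}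
                                (isMaximal : IsMaximalIdeal A M) where
    open MVAlgebra A
    open MVProperties A
    open IsMaximalIdeal isMaximal
    open IsIdeal isIdeal
    open IdealProperties A isIdeal

    -- The x with x ∧ d in M form an ideal above M, and it is proper because 1 ∧ d is d. Maximality
    -- makes it M.
    ∧-prime : ∀ {a d} → a ∧ d ∈ M → d ∉ M → a ∈ M
    ∧-prime {a} {d} a∧d∈ d∉ = maximal {J = λ x → x ∧ d ∈ M}
      (record
        { 0∈       = downward (∧-lowerˡ 0# d) 0∈
        ; ⊕-closed = λ x∈ y∈ → downward (⊕-∧-≤ _ _ d) (⊕-closed x∈ y∈)
        ; downward = λ x≤y → downward (∧-glb (≤-trans (∧-lowerˡ _ d) x≤y) (∧-lowerʳ _ d))
        })
      (λ 1∧d∈ → d∉ (downward (∧-glb ≤1 ≤-refl) 1∧d∈))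
      (downward (∧-lowerˡ _ d))
      a∧d∈

    -- By prelinearity the meet of the two differences is 0, and M is prime. Hence A/M is a chain.
    total : ∀ a b → a ⊖ b ∈ M ⊎ b ⊖ a ∈ M
    total a b with em {P = a ⊖ b ∈ M}
    ... | yes ∈M = inj₁ ∈M
    ... | no  ∉M = inj₂ (∧-prime (≈0⇒∈ (prelinear a b)) ∉M)

    -- `J` is the ideal generated by M and d; were it proper, maximality would put d into M. This is
    -- the archimedean property of A/M.
    ∉⇒multiple-1 : ∀ {d} → d ∉ M → ∃ λ n → 1# ⊖ n ·⊕ d ∈ M
    ∉⇒multiple-1 {d} d∉ = decidable-stable em λ 1∉ → d∉ (maximal {J = J}
      (record
        { 0∈       = 0 , ≈0⇒∈ (≤⇒⊖≈0 0≤)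
        ; ⊕-closed = λ (m , x∈) (n , y∈) → m ℕ.+ n ,
            downward (≤-trans (≤-reflexive (⊖-cong refl (⊕×.×-homo-+ d m n))) (⊕-⊖-⊕ _ _ _ _))
              (⊕-closed x∈ y∈)
        ; downward = λ x≤y (n , y∈) → n , downward (⊖-mono x≤y ≤-refl) y∈
        })
      1∉
      (λ x∈ → 0 , downward (a⊖b≤a _ 0#) x∈)
      (1 , ≈0⇒∈ (≤⇒⊖≈0 (a≤a⊕b 0#))))
      where
      J : Pred Carrier ℓ
      J x = ∃ λ n → x ⊖ n ·⊕ d ∈ M

  -- Chang's construction: over an MV-chain, (m , r) stands for the element m·1 + r of the
  -- enveloping group.  A carry occurs only if the residues add up to more than 1, so that
  -- nonzero elements have their residue in (0,1].
  module Chang {κ ℓ} (A : MVAlgebra κ ℓ)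
               (total : ∀ a b → MVAlgebra._≤_ A a b ⊎ MVAlgebra._≤_ A b a) where
    open MVAlgebra A
    open MVProperties A
    open ≤-Reasoning

    ≰~⇒~≤ : ∀ {a b} → ¬ a ≤ ~ b → ~ b ≤ a
    ≰~⇒~≤ {a} {b} ≰ with total a (~ b)
    ... | inj₁ a≤~b = contradiction a≤~b ≰
    ... | inj₂ ~b≤a = ~b≤a

    -- The graph of the addition of residues. Matching on it exposes carry, residue and side
    -- condition together.
    data Sum (r x : Carrier) : ℕ → Carrier → Set (κ ⊔ ℓ) where
      low  : ∀ {s} → r ≤ ~ x   → s ≈ r ⊕ x → Sum r x 0 s
      high : ∀ {s} → ¬ r ≤ ~ x → s ≈ r ⊙ x → Sum r x 1 s

    sum : ∀ r x → ∃ λ k → ∃ λ s → Sum r x k s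
    sum r x with em {P = r ≤ ~ x}
    ... | yes r≤~x = 0 , r ⊕ x , low r≤~x refl
    ... | no  r≰~x = 1 , r ⊙ x , high r≰~x refl

    Sum-cong : ∀ {r r′ x x′ k k′ s s′} → r ≈ r′ → x ≈ x′ →
               Sum r x k s → Sum r′ x′ k′ s′ → k ≡ k′ × s ≈ s′
    Sum-cong r≈ x≈ (low _ s≈) (low _ s′≈) =
      ≡.refl , trans s≈ (trans (⊕-cong r≈ x≈) (sym s′≈))
    Sum-cong r≈ x≈ (low le _) (high nle _) =
      contradiction (≤-respˡ r≈ (≤-respʳ (~-cong x≈) le)) nle
    Sum-cong r≈ x≈ (high nle _) (low le _) =
      contradiction (≤-respˡ (sym r≈) (≤-respʳ (~-cong (sym x≈)) le)) nle
    Sum-cong r≈ x≈ (high _ s≈) (high _ s′≈) =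
      ≡.refl , trans s≈ (trans (⊙-cong r≈ x≈) (sym s′≈))

    Sum-comm : ∀ {r x k s} → Sum r x k s → Sum x r k s
    Sum-comm (low le s≈)   = low (≤~-sym le) (trans s≈ (comm _ _))
    Sum-comm (high nle s≈) = high (λ le → nle (≤~-sym le)) (trans s≈ (⊙-comm _ _))

    Sum-carry : ∀ {r x k s} → Sum r x k s → k ℕ.≤ 1
    Sum-carry (low _ _)  = ℕ.z≤n
    Sum-carry (high _ _) = ℕ.s≤s ℕ.z≤n

    private
      -- As r + x is not truncated, the second hypothesis says r + x + y ≤ 1, which is symmetric in
      -- x and y.
      ⊕≤~-swap : ∀ {r x y} → r ≤ ~ x → r ⊕ x ≤ ~ y → r ⊕ y ≤ ~ x
      ⊕≤~-swap {r} {x} {y} r≤~x le = begin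
        r ⊕ y                ≈⟨ comm r y ⟩
        y ⊕ r                ≤⟨ ⊕-monoˡ r (≤~-sym le) ⟩
        ~ (r ⊕ x) ⊕ r        ≈⟨ ⊕-cong (~-cong (trans (comm r x) (⊕-cong (sym (~-involutive x)) refl))) refl ⟩
        (~ x ⊖ r) ⊕ r        ≈⟨ ≤⇒⊖⊕ r≤~x ⟩
        ~ x                  ∎

      -- Both inequalities say r + x + y ≤ 2, in the form ~ r ⊕ ~ x ⊕ ~ y ≈ 1#.
      ⊙≤~-swap : ∀ {r x y} → r ⊙ x ≤ ~ y → r ⊙ y ≤ ~ x
      ⊙≤~-swap {r} {x} {y} le = begin-equality
        ~ (~ (~ r ⊕ ~ y)) ⊕ ~ x     ≈⟨ ⊕-cong (~-involutive _) refl ⟩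
        (~ r ⊕ ~ y) ⊕ ~ x           ≈⟨ assoc _ _ _ ⟩
        ~ r ⊕ (~ y ⊕ ~ x)           ≈⟨ ⊕-cong refl (comm _ _) ⟩
        ~ r ⊕ (~ x ⊕ ~ y)           ≈⟨ assoc _ _ _ ⟨
        (~ r ⊕ ~ x) ⊕ ~ y           ≈⟨ ⊕-cong (~-involutive _) refl ⟨
        ~ (~ (~ r ⊕ ~ x)) ⊕ ~ y     ≈⟨ le ⟩
        1#                          ∎

      ⊖~≤ : ∀ {a y} → a ⊖ ~ y ≤ ~ (~ y)
      ⊖~≤ {a} {y} = ≤-respʳ (sym (~-involutive y)) (≤⊕⇒⊖≤ (≤-trans ≤1 (≤-reflexive (sym ≤-refl))))

      -- Both sides are r + x + y − 1: they agree after adding ~ y, which cancels.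
      ⊕⊙-swap : ∀ {r x y} → r ≤ ~ x → r ≤ ~ y → ~ y ≤ r ⊕ x → (r ⊕ x) ⊙ y ≈ (r ⊕ y) ⊙ x
      ⊕⊙-swap {r} {x} {y} r≤~x r≤~y ~y≤r⊕x = ⊕-cancelʳ ⊖~≤ q≤y (begin-equality
          ((r ⊕ x) ⊖ ~ y) ⊕ ~ y        ≈⟨ ≤⇒⊖⊕ ~y≤r⊕x ⟩
          r ⊕ x                        ≈⟨ comm r x ⟩
          x ⊕ r                        ≈⟨ ⊕-cong (≤⇒⊖⊕ w≤x) refl ⟨
          ((x ⊖ w) ⊕ w) ⊕ r            ≈⟨ assoc _ _ _ ⟩
          (x ⊖ w) ⊕ (w ⊕ r)            ≈⟨ ⊕-cong (~-cong (comm _ _)) w⊕r≈~y ⟩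
          ((r ⊕ y) ⊙ x) ⊕ ~ y          ∎)
        where
        w = ~ (r ⊕ y)
        w≈ : w ≈ ~ y ⊖ r
        w≈ = ~-cong (trans (comm r y) (⊕-cong (sym (~-involutive y)) refl))
        w⊕r≈~y : w ⊕ r ≈ ~ y
        w⊕r≈~y = trans (⊕-cong w≈ refl) (≤⇒⊖⊕ r≤~y)
        w≤x : w ≤ x
        w≤x = ≤-respˡ (sym w≈) (≤⊕⇒⊖≤ ~y≤r⊕x)
        q≤y : (r ⊕ y) ⊙ x ≤ ~ (~ y)
        q≤y = begin
          (r ⊕ y) ⊙ x            ≈⟨ ~-cong (comm _ _) ⟩
          x ⊖ w                  ≤⟨ ⊖-mono (≤~-sym r≤~x) ≤-refl ⟩
          ~ r ⊖ w                ≤⟨ ≤⊕⇒⊖≤ (≤-respʳ (comm _ _) (begin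
              ~ r                  ≤⟨ ≤⊕⊖ (~ r) y ⟩
              y ⊕ (~ r ⊖ y)        ≈⟨ ⊕-cong refl (~-cong (⊕-cong (~-involutive r) refl)) ⟩
              y ⊕ w                ∎)) ⟩
          y                      ≈⟨ ~-involutive y ⟨
          ~ (~ y)                ∎

      -- Again both sides are r + x + y - 1, but now r + y is at least 1, so the unit can be removed
      -- before x is added.
      ⊕⊙-exchange : ∀ {r x y} → r ≤ ~ x → ~ y ≤ r → (r ⊕ x) ⊙ y ≈ (r ⊙ y) ⊕ x
      ⊕⊙-exchange {r} {x} {y} r≤~x ~y≤r = ⊕-cancelʳ ⊖~≤ q≤y (begin-equality
          ((r ⊕ x) ⊖ ~ y) ⊕ ~ y        ≈⟨ ≤⇒⊖⊕ (≤-trans ~y≤r (a≤a⊕b x)) ⟩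
          r ⊕ x                        ≈⟨ ⊕-cong (≤⇒⊖⊕ ~y≤r) refl ⟨
          ((r ⊖ ~ y) ⊕ ~ y) ⊕ x        ≈⟨ assoc _ _ _ ⟩
          (r ⊖ ~ y) ⊕ (~ y ⊕ x)        ≈⟨ ⊕-cong refl (comm _ _) ⟩
          (r ⊖ ~ y) ⊕ (x ⊕ ~ y)        ≈⟨ assoc _ _ _ ⟨
          ((r ⊙ y) ⊕ x) ⊕ ~ y          ∎)
        where
        q≤y : (r ⊙ y) ⊕ x ≤ ~ (~ y)
        q≤y = begin
          (r ⊙ y) ⊕ x            ≤⟨ ⊕-mono (≤-reflexive (⊙-comm r y)) (≤~-sym r≤~x) ⟩
          (y ⊖ ~ r) ⊕ ~ r        ≈⟨ ≤⇒⊖⊕ (~≤-sym ~y≤r) ⟩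
          y                      ≈⟨ ~-involutive y ⟨
          ~ (~ y)                ∎

      -- Dual to ⊕⊙-swap under ~.
      ⊙⊕-swap : ∀ {r x y} → ~ x ≤ r → ~ y ≤ r → r ⊙ x ≤ ~ y → (r ⊙ x) ⊕ y ≈ (r ⊙ y) ⊕ x
      ⊙⊕-swap {r} {x} {y} ~x≤r ~y≤r r⊙x≤~y = begin-equality
          (r ⊙ x) ⊕ y                       ≈⟨ ~~⊕ x y ⟨
          ~ ((~ r ⊕ ~ x) ⊙ ~ y)             ≈⟨ ~-cong (⊕⊙-swap (~-anti ~x≤r) (~-anti ~y≤r) (~≤-sym r⊙x≤~y)) ⟩
          ~ ((~ r ⊕ ~ y) ⊙ ~ x)             ≈⟨ ~~⊕ y x ⟩
          (r ⊙ y) ⊕ x                       ∎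
        where
        ~~⊕ : ∀ x y → ~ ((~ r ⊕ ~ x) ⊙ ~ y) ≈ (r ⊙ x) ⊕ y
        ~~⊕ x y = trans (~-involutive _) (⊕-cong refl (~-involutive y))

      ⊙⊙-swap : ∀ r x y → (r ⊙ x) ⊙ y ≈ (r ⊙ y) ⊙ x
      ⊙⊙-swap r x y = ~-cong (begin-equality
        ~ (~ (~ r ⊕ ~ x)) ⊕ ~ y     ≈⟨ ⊕-cong (~-involutive _) refl ⟩
        (~ r ⊕ ~ x) ⊕ ~ y           ≈⟨ assoc _ _ _ ⟩
        ~ r ⊕ (~ x ⊕ ~ y)           ≈⟨ ⊕-cong refl (comm _ _) ⟩
        ~ r ⊕ (~ y ⊕ ~ x)           ≈⟨ assoc _ _ _ ⟨
        (~ r ⊕ ~ y) ⊕ ~ x           ≈⟨ ⊕-cong (~-involutive _) refl ⟨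
        ~ (~ (~ r ⊕ ~ y)) ⊕ ~ x     ∎)

      ⊕⊕-swap : ∀ r x y → (r ⊕ x) ⊕ y ≈ (r ⊕ y) ⊕ x
      ⊕⊕-swap r x y = trans (assoc _ _ _) (trans (⊕-cong refl (comm x y)) (sym (assoc _ _ _)))

    private
      Sum-respˡ : ∀ {r r′ x k s} → r ≈ r′ → Sum r x k s → Sum r′ x k s
      Sum-respˡ r≈ (low le s≈)   = low (≤-respˡ r≈ le) (trans s≈ (⊕-cong r≈ refl))
      Sum-respˡ r≈ (high nle s≈) =
        high (λ le → nle (≤-respˡ (sym r≈) le)) (trans s≈ (⊙-cong r≈ refl))

      -- Exactly one carry occurs in either order, and y causes it: r ⊕ x is above r and still
      -- carries with y, while r ⊙ y is below r and still does not carry with x.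
      mixed : ∀ {r x y l l′ t t′} → r ≤ ~ x → ¬ r ≤ ~ y →
              Sum (r ⊕ x) y l t → Sum (r ⊙ y) x l′ t′ → l ≡ 1 × l′ ≡ 0 × t ≈ t′
      mixed r≤~x r≰~y (low le _) _ = contradiction (≤-trans (a≤a⊕b _) le) r≰~y
      mixed {r} {x} {y} r≤~x r≰~y (high _ t≈) (low _ t′≈) = ≡.refl , ≡.refl ,
        trans t≈ (trans (⊕⊙-exchange r≤~x (≰~⇒~≤ r≰~y)) (sym t′≈))
      mixed {r} {x} {y} r≤~x _ (high _ _) (high nle _) =
        contradiction (≤-trans (a⊖b≤a r (~ y)) r≤~x) nle

      -- Associativity is proved as (r + x) + y = (r + y) + x: both sides start from r, so the case
      -- analysis is symmetric in x and y. Commutativity then gives the usual form.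
      swap′ : ∀ {r x y k k′ l l′ s s′ t t′} →
              Sum r x k s → Sum r y k′ s′ → Sum s y l t → Sum s′ x l′ t′ →
              k ℕ.+ l ≡ k′ ℕ.+ l′ × t ≈ t′
      swap′ (low r≤~x s≈) (low r≤~y s′≈) u v with Sum-respˡ s≈ u | Sum-respˡ s′≈ v
      ... | low _ t≈    | low _ t′≈    = ≡.refl , trans t≈ (trans (⊕⊕-swap _ _ _) (sym t′≈))
      ... | low le _    | high nle _   = contradiction (⊕≤~-swap r≤~x le) nle
      ... | high nle _  | low le _     = contradiction (⊕≤~-swap r≤~y le) nle
      ... | high nle t≈ | high _ t′≈   = ≡.refl ,
        trans t≈ (trans (⊕⊙-swap r≤~x r≤~y (≰~⇒~≤ nle)) (sym t′≈))
      swap′ (low r≤~x s≈) (high r≰~y s′≈) u v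
        with mixed r≤~x r≰~y (Sum-respˡ s≈ u) (Sum-respˡ s′≈ v)
      ... | ≡.refl , ≡.refl , t≈t′ = ≡.refl , t≈t′
      swap′ (high r≰~x s≈) (low r≤~y s′≈) u v
        with mixed r≤~y r≰~x (Sum-respˡ s′≈ v) (Sum-respˡ s≈ u)
      ... | ≡.refl , ≡.refl , t′≈t = ≡.refl , sym t′≈t
      swap′ (high r≰~x s≈) (high r≰~y s′≈) u v with Sum-respˡ s≈ u | Sum-respˡ s′≈ v
      ... | low le t≈   | low _ t′≈    = ≡.refl ,
        trans t≈ (trans (⊙⊕-swap (≰~⇒~≤ r≰~x) (≰~⇒~≤ r≰~y) le) (sym t′≈))
      ... | low le _    | high nle _   = contradiction (⊙≤~-swap le) nle
      ... | high nle _  | low le _     = contradiction (⊙≤~-swap le) nle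
      ... | high _ t≈   | high _ t′≈   = ≡.refl , trans t≈ (trans (⊙⊙-swap _ _ _) (sym t′≈))

    infixl 6 _+ᴳ_
    infix 4 _≈ᴳ_

    _≈ᴳ_ : ℕ × Carrier → ℕ × Carrier → Set ℓ
    (m , r) ≈ᴳ (n , x) = m ≡ n × r ≈ x

    carry : Carrier → Carrier → ℕ
    carry r x = proj₁ (sum r x)

    residue : Carrier → Carrier → Carrier
    residue r x = proj₁ (proj₂ (sum r x))

    sum-correct : ∀ r x → Sum r x (carry r x) (residue r x)
    sum-correct r x = proj₂ (proj₂ (sum r x))

    _+ᴳ_ : ℕ × Carrier → ℕ × Carrier → ℕ × Carrier
    (m , r) +ᴳ (n , x) = carry r x ℕ.+ (m ℕ.+ n) , residue r x

    private
      +ᴳ-cong : ∀ {g g′ h h′} → g ≈ᴳ g′ → h ≈ᴳ h′ → g +ᴳ h ≈ᴳ g′ +ᴳ h′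
      +ᴳ-cong (≡.refl , r≈) (≡.refl , x≈) with Sum-cong r≈ x≈ (sum-correct _ _) (sum-correct _ _)
      ... | k≡ , s≈ = ≡.cong (ℕ._+ _) k≡ , s≈

      +ᴳ-comm : ∀ g h → g +ᴳ h ≈ᴳ h +ᴳ g
      +ᴳ-comm (m , r) (n , x) with Sum-cong refl refl (Sum-comm (sum-correct r x)) (sum-correct x r)
      ... | k≡ , s≈ = ≡.cong₂ ℕ._+_ k≡ (ℕₚ.+-comm m n) , s≈

      +ᴳ-swap : ∀ g h i → (g +ᴳ h) +ᴳ i ≈ᴳ (g +ᴳ i) +ᴳ h
      +ᴳ-swap (m , r) (n , x) (o , y)
        with swap′ (sum-correct r x) (sum-correct r y) (sum-correct _ y) (sum-correct _ x)
      ... | k≡ , t≈ = eq , t≈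
        where
        open ℕ-Solver.+-*-Solver
        regroup : ∀ k l m n o → l ℕ.+ ((k ℕ.+ (m ℕ.+ n)) ℕ.+ o) ≡ (k ℕ.+ l) ℕ.+ (m ℕ.+ n ℕ.+ o)
        regroup = solve 5 (λ k l m n o → l :+ ((k :+ (m :+ n)) :+ o) := (k :+ l) :+ (m :+ n :+ o)) ≡.refl
        regroup′ : ∀ k l m n o → l ℕ.+ ((k ℕ.+ (m ℕ.+ o)) ℕ.+ n) ≡ (k ℕ.+ l) ℕ.+ (m ℕ.+ n ℕ.+ o)
        regroup′ = solve 5 (λ k l m n o → l :+ ((k :+ (m :+ o)) :+ n) := (k :+ l) :+ (m :+ n :+ o)) ≡.refl
        k = carry r x
        k′ = carry r y
        l = carry (residue r x) y
        l′ = carry (residue r y) x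
        eq = ≡.trans (regroup k l m n o) (≡.trans (≡.cong (ℕ._+ (m ℕ.+ n ℕ.+ o)) k≡)
          (≡.sym (regroup′ k′ l′ m n o)))

      ≈ᴳ-trans : ∀ {g h i} → g ≈ᴳ h → h ≈ᴳ i → g ≈ᴳ i
      ≈ᴳ-trans (p , q) (p′ , q′) = ≡.trans p p′ , trans q q′

    carry-0ʳ : ∀ r → carry r 0# ≡ 0 × residue r 0# ≈ r
    carry-0ʳ r = Sum-cong refl refl (sum-correct r 0#) (low ≤1 (sym (identityʳ r)))

    -- A monoid is enough, since only multiples of pairs (0 , a) are formed. The pairs (m , 0#) with
    -- m > 0 are harmless: a carry always leaves a nonzero residue.
    enveloping : CommutativeMonoid κ ℓ
    enveloping = record
      { Carrier = ℕ × Carrier ; _≈_ = _≈ᴳ_ ; _∙_ = _+ᴳ_ ; ε = 0 , 0#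
      ; isCommutativeMonoid = record
        { isMonoid = record
          { isSemigroup = record
            { isMagma = record
              { isEquivalence = record
                { refl  = ≡.refl , refl
                ; sym   = λ (p , q) → ≡.sym p , sym q
                ; trans = ≈ᴳ-trans
                }
              ; ∙-cong = λ {g} {g′} {h} {h′} → +ᴳ-cong {g} {g′} {h} {h′}
              }
            ; assoc = λ g h i → ≈ᴳ-trans {(g +ᴳ h) +ᴳ i} {(h +ᴳ g) +ᴳ i} {g +ᴳ (h +ᴳ i)}
                (+ᴳ-cong {g +ᴳ h} {h +ᴳ g} {i} {i} (+ᴳ-comm g h) (≡.refl , refl))
                (≈ᴳ-trans {(h +ᴳ g) +ᴳ i} {(h +ᴳ i) +ᴳ g} {g +ᴳ (h +ᴳ i)} (+ᴳ-swap h g i) (+ᴳ-comm (h +ᴳ i) g))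
            }
          ; identity = (λ g → ≈ᴳ-trans {(0 , 0#) +ᴳ g} {g +ᴳ (0 , 0#)} {g} (+ᴳ-comm (0 , 0#) g) (idʳ g)) , idʳ
          }
        ; comm = +ᴳ-comm
        }
      }
      where
      idʳ : ∀ g → g +ᴳ (0 , 0#) ≈ᴳ g
      idʳ (m , r) = ≡.trans (≡.cong (ℕ._+ (m ℕ.+ 0)) (proj₁ (carry-0ʳ r))) (ℕₚ.+-identityʳ m)
                  , proj₂ (carry-0ʳ r)

  module 𝕀° = MVAlgebra 𝕀°
  module 𝕀°ₚ = MVProperties 𝕀°
  module 𝕀°-Reasoning = Relation.Binary.Reasoning.Setoid 𝕀°.setoid

  𝕀°-≤⇒⊑ : ∀ {x y} → x 𝕀°.≤ y → val x ⊑ val y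
  𝕀°-≤⇒⊑ {x} {y} (val≃ eq) = ∼⊹-1⇒⊑ x y (ℝ+.trans eq ∼-0)

  ⊑⇒𝕀°-≤ : ∀ {x y} → val x ⊑ val y → x 𝕀°.≤ y
  ⊑⇒𝕀°-≤ {x} {y} le = val≃ (ℝ+.trans (⊑⇒∼⊹-1 x y le) (ℝ+.sym ∼-0))

  ¬1ᴿ⊑0ᴿ : ¬ 1ᴿ ⊑ 0ᴿ
  ¬1ᴿ⊑0ᴿ le = ℚₚ.<-irrefl ≡.refl (ℚₚ.<-≤-trans (ℚₚ.positive⁻¹ ℚ.1ℚ) (fromℚ-cancel le))

  ·1ᴿ-mono : ∀ {m n} → m ℕ.≤ n → m ·ᴿ 1ᴿ ⊑ n ·ᴿ 1ᴿ
  ·1ᴿ-mono {m} m≤n with ℕₚ.m≤n⇒∃[o]m+o≡n m≤n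
  ... | o , ≡.refl = begin
      m ·ᴿ 1ᴿ                 ≈⟨ ℝ+.identityʳ _ ⟨
      m ·ᴿ 1ᴿ ⊞ 0ᴿ            ≤⟨ ⊞-monoʳ _ (nonneg o) ⟩
      m ·ᴿ 1ᴿ ⊞ o ·ᴿ 1ᴿ       ≈⟨ ·ᴿ-+ m o 1ᴿ ⟨
      (m ℕ.+ o) ·ᴿ 1ᴿ         ∎
    where
    open ⊑-Reasoning
    0⊑1 : 0ᴿ ⊑ 1ᴿ
    0⊑1 = incl λ q<0 → ℚₚ.<-trans q<0 (ℚₚ.positive⁻¹ ℚ.1ℚ)
    nonneg : ∀ o → 0ᴿ ⊑ o ·ᴿ 1ᴿ
    nonneg zero    = ⊑.reflexive (ℝ+.sym (·ᴿ-zero 1ᴿ))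
    nonneg (suc o) = begin
      0ᴿ                      ≈⟨ ℝ+.identityˡ 0ᴿ ⟨
      0ᴿ ⊞ 0ᴿ                 ≤⟨ ⊞-mono 0⊑1 (nonneg o) ⟩
      1ᴿ ⊞ o ·ᴿ 1ᴿ            ≈⟨ ·ᴿ-suc o 1ᴿ ⟨
      suc o ·ᴿ 1ᴿ             ∎

  module Hölder {κ ℓ} (A : MVAlgebra κ ℓ)
    (total : ∀ a b → MVAlgebra._≤_ A a b ⊎ MVAlgebra._≤_ A b a)
    (1≉0 : ¬ MVAlgebra._≈_ A (MVAlgebra.1# A) (MVAlgebra.0# A))
    (archimedean : ∀ {d} → ¬ MVAlgebra._≈_ A d (MVAlgebra.0# A) →
                   ∃ λ n → MVAlgebra._≈_ A (MVProperties._·⊕_ A n d) (MVAlgebra.1# A))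
    where
    open MVAlgebra A
    open MVProperties A
    open Chang A total
    module G = CommutativeMonoid enveloping
    module G× = Mult enveloping
    open G× using () renaming (_×_ to _·ᴳ_)

    -- The largest m with m·1 < n a in the enveloping group, and 0 if n a = 0.
    floor : Carrier → ℕ → ℕ
    floor a n = proj₁ (n ·ᴳ (0 , a))

    private
      ·ᴳ-shift : ∀ k m r → k ·ᴳ (m , r) ≡ (k ℕ.* m ℕ.+ proj₁ (k ·ᴳ (0 , r)) , proj₂ (k ·ᴳ (0 , r)))
      ·ᴳ-shift zero    m r = ≡.refl
      ·ᴳ-shift (suc k) m r rewrite ·ᴳ-shift k m r =
        ≡.cong (_, residue r x) (solve 4 (λ c m p q → c :+ (m :+ (p :+ q)) := (m :+ p) :+ (c :+ q)) ≡.refl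
          (carry r x) m (k ℕ.* m) (proj₁ (k ·ᴳ (0 , r))))
        where
        open ℕ-Solver.+-*-Solver
        x : Carrier
        x = proj₂ (k ·ᴳ (0 , r))

      -- If n a is m·1 + r, then its k-fold multiple is (k m)·1 + k r.
      floor-* : ∀ a k n → floor a (k ℕ.* n) ≡ k ℕ.* floor a n ℕ.+ floor (proj₂ (n ·ᴳ (0 , a))) k
      floor-* a k n = ≡.trans (≡.sym (proj₁ (G×.×-assocˡ (0 , a) k n)))
        (≡.cong proj₁ (·ᴳ-shift k (floor a n) (proj₂ (n ·ᴳ (0 , a)))))

    -- Of the suc k additions each carries at most one unit, and the innermost one, to `0#`, carries
    -- none. The unit saved here makes `sub` strict.
    floor-suc-≤ : ∀ a k → floor a (suc k) ℕ.≤ k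
    floor-suc-≤ a zero    = ℕₚ.≤-reflexive (≡.trans (ℕₚ.+-identityʳ _) (proj₁ (carry-0ʳ a)))
    floor-suc-≤ a (suc k) = ℕₚ.+-mono-≤ (Sum-carry (sum-correct a _)) (floor-suc-≤ a k)

    private
      super : ∀ a k n → k ℕ.* floor a n ℕ.≤ floor a (k ℕ.* n)
      super a k n = ≡.subst (k ℕ.* floor a n ℕ.≤_) (≡.sym (floor-* a k n)) (ℕₚ.m≤m+n _ _)

      sub : ∀ a k n → floor a (suc k ℕ.* n) ℕ.< suc k ℕ.* suc (floor a n)
      sub a k n = begin-strict
        floor a (suc k ℕ.* n)                           ≡⟨ floor-* a (suc k) n ⟩
        suc k ℕ.* floor a n ℕ.+ floor r (suc k)         ≤⟨ ℕₚ.+-monoʳ-≤ (suc k ℕ.* floor a n) (floor-suc-≤ r k) ⟩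
        suc k ℕ.* floor a n ℕ.+ k                       <⟨ ℕₚ.+-monoʳ-< (suc k ℕ.* floor a n) (ℕₚ.n<1+n k) ⟩
        suc k ℕ.* floor a n ℕ.+ suc k                   ≡⟨ ℕₚ.+-comm (suc k ℕ.* floor a n) (suc k) ⟩
        suc k ℕ.+ suc k ℕ.* floor a n                   ≡⟨ ℕₚ.*-suc (suc k) (floor a n) ⟨
        suc k ℕ.* suc (floor a n)                       ∎
        where
        open ℕₚ.≤-Reasoning
        r : Carrier
        r = proj₂ (n ·ᴳ (0 , a))

    opaque
      -- Hölder's real number, the limit of floor a n / n.
      value : Carrier → ℝ
      value a = limit (floor a) (super a) (sub a)

      value-lower : ∀ a n → floor a n ·ᴿ 1ᴿ ⊑ n ·ᴿ value a
      value-lower a zero    = ⊑.trans (⊑.reflexive (·ᴿ-zero 1ᴿ)) (⊑.reflexive (ℝ+.sym (·ᴿ-zero (value a))))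
      value-lower a (suc n) = limit-lower (floor a) (super a) (sub a) n

      value-upper : ∀ a n → n ·ᴿ value a ⊑ suc (floor a n) ·ᴿ 1ᴿ
      value-upper a zero    = ⊑.trans (⊑.reflexive (ℝ+.trans (·ᴿ-zero (value a)) (ℝ+.sym (·ᴿ-zero 1ᴿ))))
        (·1ᴿ-mono ℕ.z≤n)
      value-upper a (suc n) = limit-upper (floor a) (super a) (sub a) n

    open ⊑-Reasoning

    opaque
      value-0≤ : ∀ a → 0ᴿ ≤ᴿ value a
      value-0≤ a = ⊑⇒≤ᴿ (begin
        0ᴿ                      ≈⟨ ·ᴿ-zero 1ᴿ ⟨
        0 ·ᴿ 1ᴿ                 ≤⟨ ·1ᴿ-mono ℕ.z≤n ⟩
        floor a 1 ·ᴿ 1ᴿ         ≤⟨ value-lower a 1 ⟩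
        1 ·ᴿ value a            ≈⟨ ·ᴿ-one (value a) ⟩
        value a                 ∎)

      value-≤1 : ∀ a → value a ≤ᴿ 1ᴿ
      value-≤1 a = ⊑⇒≤ᴿ (begin
        value a                 ≈⟨ ·ᴿ-one (value a) ⟨
        1 ·ᴿ value a            ≤⟨ value-upper a 1 ⟩
        suc (floor a 1) ·ᴿ 1ᴿ   ≤⟨ ·1ᴿ-mono (ℕ.s≤s (floor-suc-≤ a 0)) ⟩
        1 ·ᴿ 1ᴿ                 ≈⟨ ·ᴿ-one 1ᴿ ⟩
        1ᴿ                      ∎)

    φ : Carrier → 𝕀
    φ a = mk𝕀 (value a) (value-0≤ a) (value-≤1 a)

    value-mono : ∀ {a b} k → (∀ n → floor a n ℕ.≤ k ℕ.+ floor b n) → value a ⊑ value b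
    -- The error is k from the hypothesis plus 1 from `value-upper`, whatever n is.
    value-mono {a} {b} k le = ⊑-archimedean (suc k) λ n → begin
      n ·ᴿ value a                             ≤⟨ value-upper a n ⟩
      suc (floor a n) ·ᴿ 1ᴿ                    ≤⟨ ·1ᴿ-mono (ℕ.s≤s (le n)) ⟩
      (suc k ℕ.+ floor b n) ·ᴿ 1ᴿ              ≈⟨ ·ᴿ-+ (suc k) (floor b n) 1ᴿ ⟩
      suc k ·ᴿ 1ᴿ ⊞ floor b n ·ᴿ 1ᴿ            ≈⟨ ℝ+.comm _ _ ⟩
      floor b n ·ᴿ 1ᴿ ⊞ suc k ·ᴿ 1ᴿ            ≤⟨ ⊞-monoˡ _ (value-lower b n) ⟩
      n ·ᴿ value b ⊞ suc k ·ᴿ 1ᴿ               ∎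

    floor-cong : ∀ {a b} n → a ≈ b → floor a n ≡ floor b n
    floor-cong n a≈b = proj₁ (G×.×-congʳ n (≡.refl , a≈b))

    value-cong : ∀ {a b} → a ≈ b → value a ≃ value b
    value-cong a≈b = both (value-mono 0 λ n → ℕₚ.≤-reflexive (floor-cong n a≈b))
                          (value-mono 0 λ n → ℕₚ.≤-reflexive (floor-cong n (sym a≈b)))

    private
      -- A sum that is not truncated is the sum in the enveloping monoid. Multiples distribute over
      -- it, and only the two residues can contribute a carry.
      floor-⊕ : ∀ {a b} → a ≤ ~ b → ∀ n → ∃ λ k → k ℕ.≤ 1 × floor (a ⊕ b) n ≡ k ℕ.+ (floor a n ℕ.+ floor b n)
      floor-⊕ {a} {b} a≤~b n = carry r x , Sum-carry (sum-correct r x) ,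
        ≡.trans (proj₁ (G×.×-congʳ n split)) (proj₁ (G×.×-distrib-+ (0 , a) (0 , b) n))
        where
        r x : Carrier
        r = proj₂ (n ·ᴳ (0 , a))
        x = proj₂ (n ·ᴳ (0 , b))
        split : (0 , a ⊕ b) G.≈ ((0 , a) +ᴳ (0 , b))
        split with Sum-cong refl refl (low a≤~b refl) (sum-correct a b)
        ... | 0≡k , eq = ≡.trans 0≡k (≡.sym (ℕₚ.+-identityʳ _)) , eq

    value-⊕ : ∀ {a b} → a ≤ ~ b → value (a ⊕ b) ≃ value a ⊞ value b
    value-⊕ {a} {b} a≤~b = both
      -- One unit for the rounding of a ⊕ b and one for the carry.
      (⊑-archimedean 2 λ n → let k , k≤1 , eq = floor-⊕ a≤~b n in begin
        n ·ᴿ value (a ⊕ b)                                  ≤⟨ value-upper (a ⊕ b) n ⟩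
        suc (floor (a ⊕ b) n) ·ᴿ 1ᴿ                         ≤⟨ ·1ᴿ-mono (ℕ.s≤s
                                                                 (ℕₚ.≤-trans (ℕₚ.≤-reflexive eq) (ℕₚ.+-monoˡ-≤ _ k≤1))) ⟩
        (2 ℕ.+ (floor a n ℕ.+ floor b n)) ·ᴿ 1ᴿ             ≈⟨ ·ᴿ-+ 2 _ 1ᴿ ⟩
        2 ·ᴿ 1ᴿ ⊞ (floor a n ℕ.+ floor b n) ·ᴿ 1ᴿ           ≈⟨ ℝ+.∙-congˡ (·ᴿ-+ (floor a n) _ 1ᴿ) ⟩
        2 ·ᴿ 1ᴿ ⊞ (floor a n ·ᴿ 1ᴿ ⊞ floor b n ·ᴿ 1ᴿ)       ≈⟨ ℝ+.comm _ _ ⟩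
        (floor a n ·ᴿ 1ᴿ ⊞ floor b n ·ᴿ 1ᴿ) ⊞ 2 ·ᴿ 1ᴿ       ≤⟨ ⊞-monoˡ _
                                                                 (⊞-mono (value-lower a n) (value-lower b n)) ⟩
        (n ·ᴿ value a ⊞ n ·ᴿ value b) ⊞ 2 ·ᴿ 1ᴿ             ≈⟨ ℝ+.∙-congʳ (·ᴿ-⊞ n _ _) ⟨
        n ·ᴿ (value a ⊞ value b) ⊞ 2 ·ᴿ 1ᴿ                  ∎)
      -- One unit for the rounding of each summand; the carry only helps.
      (⊑-archimedean 2 λ n → let k , _ , eq = floor-⊕ a≤~b n in begin
        n ·ᴿ (value a ⊞ value b)                            ≈⟨ ·ᴿ-⊞ n _ _ ⟩
        n ·ᴿ value a ⊞ n ·ᴿ value b                         ≤⟨ ⊞-mono (value-upper a n) (value-upper b n) ⟩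
        suc (floor a n) ·ᴿ 1ᴿ ⊞ suc (floor b n) ·ᴿ 1ᴿ       ≈⟨ ·ᴿ-+ (suc (floor a n)) _ 1ᴿ ⟨
        (suc (floor a n) ℕ.+ suc (floor b n)) ·ᴿ 1ᴿ         ≤⟨ ·1ᴿ-mono (count k eq) ⟩
        (floor (a ⊕ b) n ℕ.+ 2) ·ᴿ 1ᴿ                       ≈⟨ ·ᴿ-+ (floor (a ⊕ b) n) 2 1ᴿ ⟩
        floor (a ⊕ b) n ·ᴿ 1ᴿ ⊞ 2 ·ᴿ 1ᴿ                     ≤⟨ ⊞-monoˡ _ (value-lower (a ⊕ b) n) ⟩
        n ·ᴿ value (a ⊕ b) ⊞ 2 ·ᴿ 1ᴿ                        ∎)
      where
      count : ∀ {p q s} k → s ≡ k ℕ.+ (p ℕ.+ q) → suc p ℕ.+ suc q ℕ.≤ s ℕ.+ 2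
      count {p} {q} k ≡.refl = ≡.subst₂ ℕ._≤_
        (solve 2 (λ p q → (p :+ q) :+ con 2 := con 1 :+ p :+ (con 1 :+ q)) ≡.refl p q) ≡.refl
        (ℕₚ.+-monoˡ-≤ 2 (ℕₚ.m≤n+m (p ℕ.+ q) k))
        where open ℕ-Solver.+-*-Solver

    value-0 : value 0# ≃ 0ᴿ
    value-0 = ℝ+ₚ.∙-cancelˡ (value 0#) _ _ (ℝ+.trans (ℝ+.sym (value-⊕ ≤1))
      (ℝ+.trans (value-cong (identityʳ 0#)) (ℝ+.sym (ℝ+.identityʳ (value 0#)))))

    private
      -- The unit is the pair (0 , 1#), which explains the shift by one: each further summand
      -- carries and leaves the residue `1#`.
      multiples-of-1 : ∀ n → suc n ·ᴳ (0 , 1#) G.≈ (n , 1#)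
      multiples-of-1 zero    = G.identityʳ (0 , 1#)
      multiples-of-1 (suc n) = G.trans (G.∙-congˡ {0 , 1#} (multiples-of-1 n)) 1+n
        where
        1+n : (0 , 1#) +ᴳ (n , 1#) G.≈ (suc n , 1#)
        1+n with sum 1# 1#
        ... | _ , _ , low 1≤~1 _ = contradiction (≤0⇒≈0 (≤-respʳ ~1≈0 1≤~1)) 1≉0
        ... | _ , _ , high _ s≈  = ≡.refl , trans s≈ (~-cong (trans (⊕-cong ~1≈0 refl) (trans (identityˡ _) ~1≈0)))

    value-1 : value 1# ≃ 1ᴿ
    value-1 = both (⊑1 (φ 1#)) (⊑-archimedean 1 λ n → begin
        n ·ᴿ 1ᴿ                              ≤⟨ ·1ᴿ-mono (bound n) ⟩
        (floor 1# n ℕ.+ 1) ·ᴿ 1ᴿ             ≈⟨ ·ᴿ-+ (floor 1# n) 1 1ᴿ ⟩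
        floor 1# n ·ᴿ 1ᴿ ⊞ 1 ·ᴿ 1ᴿ           ≤⟨ ⊞-monoˡ _ (value-lower 1# n) ⟩
        n ·ᴿ value 1# ⊞ 1 ·ᴿ 1ᴿ              ∎)
      where
      bound : ∀ n → n ℕ.≤ floor 1# n ℕ.+ 1
      bound zero    = ℕ.z≤n
      bound (suc n) = ℕₚ.≤-reflexive (≡.trans (ℕₚ.+-comm 1 n)
        (≡.cong (ℕ._+ 1) (≡.sym (proj₁ (multiples-of-1 n)))))

    value-~ : ∀ a → value a ⊞ value (~ a) ≃ 1ᴿ
    value-~ a = ℝ+.trans (ℝ+.sym (value-⊕ (≤-reflexive (sym (~-involutive a)))))
      (ℝ+.trans (value-cong (trans (comm a (~ a)) ≤-refl)) value-1)

    value-≤ : ∀ {a b} → a ≤ b → value a ⊑ value b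
    value-≤ {a} {b} a≤b = begin
      value a                          ≈⟨ ℝ+.identityˡ _ ⟨
      0ᴿ ⊞ value a                     ≤⟨ ⊞-monoˡ _ (0⊑ (φ (b ⊖ a))) ⟩
      value (b ⊖ a) ⊞ value a          ≈⟨ value-⊕ (≤~-sym (≤-respʳ
                                            (trans (comm a (~ b)) (sym (~-involutive _))) (a≤a⊕b (~ b)))) ⟨
      value ((b ⊖ a) ⊕ a)              ≈⟨ value-cong (≤⇒⊖⊕ a≤b) ⟩
      value b                          ∎

    φ-isHomomorphism : IsMVHomomorphism raw 𝕀°-raw φ
    φ-isHomomorphism = record
      { ⟦⟧-cong = λ a≈b → val≃ (value-cong a≈b)
      ; ⊕-homo  = λ a b → val≃ (homo a b)
      ; ~-homo  = λ a → val≃ (∼-unique (φ a) (ℝ+.trans (ℝ+.comm _ _) (value-~ a)))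
      ; 0#-homo = val≃ value-0
      }
      where
      homo : ∀ a b → value (a ⊕ b) ≃ val (φ a ⊹ φ b)
      homo a b with em {P = a ≤ ~ b}
      ... | yes a≤~b = ℝ+.trans (value-⊕ a≤~b)
        (ℝ+.sym (⊹-⊞ (φ a) (φ b) (⊑.trans (⊑.reflexive (ℝ+.sym (value-⊕ a≤~b))) (⊑1 (φ (a ⊕ b))))))
      -- In a chain this means ~ a ≤ b, so the sum is 1 in the algebra and in [0,1].
      ... | no  a≰~b = ℝ+.trans (ℝ+.trans (value-cong a⊕b≈1) value-1)
        (ℝ+.sym (⊹-1 (φ a) (φ b) (begin
          1ᴿ                          ≈⟨ value-~ a ⟨
          value a ⊞ value (~ a)       ≤⟨ ⊞-monoʳ _ (value-≤ ~a≤b) ⟩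
          value a ⊞ value b           ∎)))
        where
        ~a≤b : ~ a ≤ b
        ~a≤b = ~≤-sym (≰~⇒~≤ a≰~b)
        a⊕b≈1 : a ⊕ b ≈ 1#
        a⊕b≈1 = trans (⊕-cong (sym (~-involutive a)) refl) ~a≤b

    private
      module φ = HomProperties A 𝕀° φ-isHomomorphism

      multiples-of-kernel : ∀ {d} → φ d ≋ 0ᴵ → ∀ n → φ (n ·⊕ d) ≋ 0ᴵ
      multiples-of-kernel φd≈0 zero    = φ.0#-homo
      multiples-of-kernel φd≈0 (suc n) = 𝕀°.trans (φ.⊕-homo _ _)
        (𝕀°.trans (𝕀°.⊕-cong φd≈0 (multiples-of-kernel φd≈0 n)) (𝕀°.identityʳ 0ᴵ))

    -- A nonzero element of the kernel has a multiple equal to `1#`, on which φ would be both 0 and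
    -- 1.
    φ-injective : ∀ {a b} → φ a ≋ φ b → a ≈ b
    φ-injective = φ.trivial-kernel⇒injective λ φd≈0 → decidable-stable em λ d≉0 →
      let n , nd≈1 = archimedean d≉0
      in ¬1ᴿ⊑0ᴿ (begin
        1ᴿ                    ≈⟨ value-1 ⟨
        value 1#              ≈⟨ value-cong nd≈1 ⟨
        value (n ·⊕ _)        ≈⟨ ≋⇒≃ (multiples-of-kernel φd≈0 n) ⟩
        0ᴿ                    ∎)

  -- Maximal ideals and the hat functions

  module _ where
    open ⊑-Reasoning

    -- Whether x + y exceeds 1 is decided by x ⊙ y being 0. For images of a homomorphism that is a
    -- condition on its kernel, and so `division` can make the same choice for two homomorphisms.
    ⊙≈0⇒⊞ : ∀ x y → x 𝕀°ₚ.⊙ y ≋ 0ᴵ → val (x ⊹ y) ≃ val x ⊞ val y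
    ⊙≈0⇒⊞ x y x⊙y≈0 = ⊹-⊞ x y (begin
      val x ⊞ val y           ≤⟨ ⊞-monoˡ _ (𝕀°-≤⇒⊑ (𝕀°ₚ.⊖≈0⇒≤ {x} {∼ y} x⊙y≈0)) ⟩
      val (∼ y) ⊞ val y       ≈⟨ ∼-complement y ⟩
      1ᴿ                      ∎)

    complements : ∀ x y → val (∼ x) ⊞ val (∼ y) ⊞ (val x ⊞ val y) ≃ 1ᴿ ⊞ 1ᴿ
    complements x y = begin-equality
      val (∼ x) ⊞ val (∼ y) ⊞ (val x ⊞ val y)                               ≈⟨ ℝ+.assoc _ _ _ ⟩
      val (∼ x) ⊞ (val (∼ y) ⊞ (val x ⊞ val y))          ≈⟨ ℝ+.∙-congˡ (ℝ+.∙-congˡ (ℝ+.comm _ _)) ⟩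
      val (∼ x) ⊞ (val (∼ y) ⊞ (val y ⊞ val x))          ≈⟨ ℝ+.∙-congˡ (ℝ+.assoc _ _ _) ⟨
      val (∼ x) ⊞ (val (∼ y) ⊞ val y ⊞ val x)            ≈⟨ ℝ+.∙-congˡ (ℝ+.∙-congʳ (∼-complement y)) ⟩
      val (∼ x) ⊞ (1ᴿ ⊞ val x)                           ≈⟨ ℝ+.∙-congˡ (ℝ+.comm _ _) ⟩
      val (∼ x) ⊞ (val x ⊞ 1ᴿ)                           ≈⟨ ℝ+.assoc _ _ _ ⟨
      val (∼ x) ⊞ val x ⊞ 1ᴿ                             ≈⟨ ℝ+.∙-congʳ (∼-complement x) ⟩
      1ᴿ ⊞ 1ᴿ                                            ∎

    ⊙≉0⇒⊞ : ∀ x y → ¬ x 𝕀°ₚ.⊙ y ≋ 0ᴵ → val x ⊞ val y ≃ 1ᴿ ⊞ val (x 𝕀°ₚ.⊙ y)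
    ⊙≉0⇒⊞ x y x⊙y≉0 = ℝ+ₚ.∙-cancelʳ co _ _ (begin-equality
        val x ⊞ val y ⊞ co                      ≈⟨ ℝ+.comm _ _ ⟩
        co ⊞ (val x ⊞ val y)                    ≈⟨ complements x y ⟩
        1ᴿ ⊞ 1ᴿ                                 ≈⟨ ℝ+.∙-congˡ (∼-complement (∼ x ⊹ ∼ y)) ⟨
        1ᴿ ⊞ (val z ⊞ val (∼ x ⊹ ∼ y))          ≈⟨ ℝ+.assoc _ _ _ ⟨
        1ᴿ ⊞ val z ⊞ val (∼ x ⊹ ∼ y)            ≈⟨ ℝ+.∙-congˡ (⊹-⊞ (∼ x) (∼ y) co⊑1) ⟩
        1ᴿ ⊞ val z ⊞ co                         ∎)
      where
      z = x 𝕀°ₚ.⊙ y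
      co = val (∼ x) ⊞ val (∼ y)
      1⊑ : 1ᴿ ⊑ val x ⊞ val y
      1⊑ with ⊑-total 1ᴿ (val x ⊞ val y)
      ... | inj₁ 1⊑x+y = 1⊑x+y
      ... | inj₂ x+y⊑1 = contradiction (𝕀°ₚ.≤⇒⊖≈0 {x} {∼ y} (⊑⇒𝕀°-≤ (⊞-cancelʳ-⊑ (val y)
        (⊑.trans x+y⊑1 (⊑.reflexive (ℝ+.sym (∼-complement y))))))) x⊙y≉0
      co⊑1 : co ⊑ 1ᴿ
      co⊑1 = ⊞-cancelʳ-⊑ (val x ⊞ val y) (⊑.trans (⊑.reflexive (complements x y)) (⊞-monoʳ 1ᴿ 1⊑))

  module _ {κ ℓ} (A : MVAlgebra κ ℓ) {φ ψ : MVAlgebra.Carrier A → 𝕀}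
    (φ-hom : IsMVHomomorphism (MVAlgebra.raw A) 𝕀°-raw φ)
    (ψ-hom : IsMVHomomorphism (MVAlgebra.raw A) 𝕀°-raw ψ) where
    private
      open MVAlgebra A
      open MVProperties A using (_⊙_)
      module φ = HomProperties A 𝕀° φ-hom
      module ψ = HomProperties A 𝕀° ψ-hom
      open ⊑-Reasoning

      -- φ and ψ determine the same integer part m and the same residue r of n a.
      division : (∀ {a} → φ a ≋ 0ᴵ → ψ a ≋ 0ᴵ) → (∀ {a} → ψ a ≋ 0ᴵ → φ a ≋ 0ᴵ) → ∀ a n →
        ∃₂ λ m r → n ·ᴿ val (φ a) ≃ m ·ᴿ 1ᴿ ⊞ val (φ r) × n ·ᴿ val (ψ a) ≃ m ·ᴿ 1ᴿ ⊞ val (ψ r)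
      division to from a zero = 0 , 0# , base (φ a) (φ 0#) φ.0#-homo , base (ψ a) (ψ 0#) ψ.0#-homo
        where
        base : ∀ x y → y ≋ 0ᴵ → 0 ·ᴿ val x ≃ 0 ·ᴿ 1ᴿ ⊞ val y
        base x y (val≃ y≃0) = ℝ+.trans (·ᴿ-zero _) (ℝ+.trans (ℝ+.sym (ℝ+.identityʳ 0ᴿ))
          (ℝ+.∙-cong (ℝ+.sym (·ᴿ-zero 1ᴿ)) (ℝ+.sym y≃0)))
      division to from a (suc n)
        with division to from a n | em {P = φ (proj₁ (proj₂ (division to from a n)) ⊙ a) ≋ 0ᴵ}
      ... | m , r , eφ , eψ | yes φ≈0 = m , r ⊕ a ,
            step eφ (φ.⊕-homo r a) (𝕀°.trans (𝕀°.sym (φ.⊙-homo r a)) φ≈0) ,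
            step eψ (ψ.⊕-homo r a) (𝕀°.trans (𝕀°.sym (ψ.⊙-homo r a)) (to φ≈0))
        where
        step : ∀ {x y z} → n ·ᴿ val x ≃ m ·ᴿ 1ᴿ ⊞ val y → z ≋ y ⊹ x → y 𝕀°ₚ.⊙ x ≋ 0ᴵ →
               suc n ·ᴿ val x ≃ m ·ᴿ 1ᴿ ⊞ val z
        step {x} {y} {z} eq (val≃ z≃) small = begin-equality
          suc n ·ᴿ val x                      ≈⟨ ·ᴿ-suc n _ ⟩
          val x ⊞ n ·ᴿ val x                  ≈⟨ ℝ+.comm _ _ ⟩
          n ·ᴿ val x ⊞ val x                  ≈⟨ ℝ+.∙-congʳ eq ⟩
          m ·ᴿ 1ᴿ ⊞ val y ⊞ val x             ≈⟨ ℝ+.assoc _ _ _ ⟩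
          m ·ᴿ 1ᴿ ⊞ (val y ⊞ val x)           ≈⟨ ℝ+.∙-congˡ (ℝ+.trans z≃ (⊙≈0⇒⊞ y x small)) ⟨
          m ·ᴿ 1ᴿ ⊞ val z                     ∎
      ... | m , r , eφ , eψ | no φ≉0 = suc m , r ⊙ a ,
            step eφ (φ.⊙-homo r a) (λ z → φ≉0 (𝕀°.trans (φ.⊙-homo r a) z)) ,
            step eψ (ψ.⊙-homo r a) (λ z → φ≉0 (from (𝕀°.trans (ψ.⊙-homo r a) z)))
        where
        step : ∀ {x y z} → n ·ᴿ val x ≃ m ·ᴿ 1ᴿ ⊞ val y → z ≋ y 𝕀°ₚ.⊙ x → ¬ y 𝕀°ₚ.⊙ x ≋ 0ᴵ →
               suc n ·ᴿ val x ≃ suc m ·ᴿ 1ᴿ ⊞ val z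
        step {x} {y} {z} eq (val≃ z≃) large = begin-equality
          suc n ·ᴿ val x                         ≈⟨ ·ᴿ-suc n _ ⟩
          val x ⊞ n ·ᴿ val x                     ≈⟨ ℝ+.comm _ _ ⟩
          n ·ᴿ val x ⊞ val x                     ≈⟨ ℝ+.∙-congʳ eq ⟩
          m ·ᴿ 1ᴿ ⊞ val y ⊞ val x                ≈⟨ ℝ+.assoc _ _ _ ⟩
          m ·ᴿ 1ᴿ ⊞ (val y ⊞ val x)              ≈⟨ ℝ+.∙-congˡ (⊙≉0⇒⊞ y x large) ⟩
          m ·ᴿ 1ᴿ ⊞ (1ᴿ ⊞ val (y 𝕀°ₚ.⊙ x))       ≈⟨ ℝ+.assoc _ _ _ ⟨
          m ·ᴿ 1ᴿ ⊞ 1ᴿ ⊞ val (y 𝕀°ₚ.⊙ x)         ≈⟨ ℝ+.∙-cong (ℝ+.trans (·ᴿ-suc m 1ᴿ) (ℝ+.comm _ _)) z≃ ⟨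
          suc m ·ᴿ 1ᴿ ⊞ val z                    ∎

    -- The multiples n φ(a) and n ψ(a) have a common integer part, so they differ by at most 1 for
    -- every n.
    same-kernel⇒≋ : (∀ {a} → φ a ≋ 0ᴵ → ψ a ≋ 0ᴵ) → (∀ {a} → ψ a ≋ 0ᴵ → φ a ≋ 0ᴵ) → ∀ a → φ a ≋ ψ a
    same-kernel⇒≋ to from a = val≃ (both
        (⊑-archimedean 1 λ n → let m , r , eφ , eψ = division to from a n in close m (φ r) (ψ r) eφ eψ)
        (⊑-archimedean 1 λ n → let m , r , eφ , eψ = division to from a n in close m (ψ r) (φ r) eψ eφ))
      where
      close : ∀ m u v {x y} → x ≃ m ·ᴿ 1ᴿ ⊞ val u → y ≃ m ·ᴿ 1ᴿ ⊞ val v → x ⊑ y ⊞ 1 ·ᴿ 1ᴿ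
      close m u v {x} {y} ex ey = begin
        x                                   ≈⟨ ex ⟩
        m ·ᴿ 1ᴿ ⊞ val u                     ≤⟨ ⊞-mono (begin
            m ·ᴿ 1ᴿ                           ≈⟨ ℝ+.identityʳ _ ⟨
            m ·ᴿ 1ᴿ ⊞ 0ᴿ                      ≤⟨ ⊞-monoʳ _ (0⊑ v) ⟩
            m ·ᴿ 1ᴿ ⊞ val v                   ≈⟨ ey ⟨
            y                                 ∎) (begin
            val u                             ≤⟨ ⊑1 u ⟩
            1ᴿ                                ≈⟨ ·ᴿ-one 1ᴿ ⟨
            1 ·ᴿ 1ᴿ                           ∎) ⟩
        y ⊞ 1 ·ᴿ 1ᴿ                         ∎

  module MaxIdealEmbedding {κ ℓ} (A : MVAlgebra κ ℓ) (M : MaxIdeal A) where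
    open MVAlgebra A
    open MaxIdeal M
    open IsMaximalIdeal isMaximalIdeal
    open IdealProperties A isIdeal
    open MaximalIdealProperties A isMaximalIdeal
    private
      module Aₚ = MVProperties A
      module Q = MVAlgebra quotient
      module Qₚ = MVProperties quotient

      quotient-total : ∀ a b → a Q.≤ b ⊎ b Q.≤ a
      quotient-total a b with total a b
      ... | inj₁ ∈M = inj₁ (Qₚ.⊖≈0⇒≤ (∈⇒dist-0-∈ ∈M))
      ... | inj₂ ∈M = inj₂ (Qₚ.⊖≈0⇒≤ (∈⇒dist-0-∈ ∈M))

      ·⊕-quotient : ∀ n a → n Aₚ.·⊕ a ≡ n Qₚ.·⊕ a
      ·⊕-quotient zero    a = ≡.refl
      ·⊕-quotient (suc n) a = ≡.cong (a ⊕_) (·⊕-quotient n a)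

      quotient-archimedean : ∀ {d} → ¬ d Q.≈ 0# → ∃ λ n → n Qₚ.·⊕ d Q.≈ 1#
      quotient-archimedean {d} d≉0 =
        let n , 1⊖nd∈ = ∉⇒multiple-1 λ d∈ → d≉0 (∈⇒dist-0-∈ d∈)
        in n , Qₚ.≤-antisym Qₚ.≤1 (Qₚ.⊖≈0⇒≤ (∈⇒dist-0-∈
             (≡.subst (λ x → 1# ⊖ x ∈ ideal) (·⊕-quotient n d) 1⊖nd∈)))

      module H = Hölder quotient quotient-total (λ 1≈0 → proper (dist-0-∈⇒∈ 1≈0)) quotient-archimedean

    opaque
      hat : Carrier → 𝕀
      hat = H.φ

      hat-quotient-isHomomorphism : IsMVHomomorphism (Quotient A ideal) 𝕀°-raw hat
      hat-quotient-isHomomorphism = H.φ-isHomomorphism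

      hat-injective : ∀ {a b} → hat a ≋ hat b → dist a b ∈ ideal
      hat-injective = H.φ-injective

    lift-hom : ∀ {f} → IsMVHomomorphism (Quotient A ideal) 𝕀°-raw f → IsMVHomomorphism raw 𝕀°-raw f
    lift-hom h = record
      { ⟦⟧-cong = λ a≈b → ⟦⟧-cong (≈⇒dist-∈ a≈b)
      ; ⊕-homo = ⊕-homo ; ~-homo = ~-homo ; 0#-homo = 0#-homo
      }
      where open IsMVHomomorphism h

    hat-isHomomorphism : IsMVHomomorphism raw 𝕀°-raw hat
    hat-isHomomorphism = lift-hom hat-quotient-isHomomorphism

    hat-≈0⁺ : ∀ {a} → a ∈ ideal → hat a ≋ 0ᴵ
    hat-≈0⁺ a∈ = 𝕀°.trans (⟦⟧-cong (∈⇒dist-0-∈ a∈)) 0#-homo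
      where open IsMVHomomorphism hat-quotient-isHomomorphism

    hat-≈0⁻ : ∀ {a} → hat a ≋ 0ᴵ → a ∈ ideal
    hat-≈0⁻ a≈0 = dist-0-∈⇒∈ (hat-injective (𝕀°.trans a≈0 (𝕀°.sym 0#-homo)))
      where open IsMVHomomorphism hat-quotient-isHomomorphism

    embedding : Embedding A M
    embedding = record
      { emb              = hat
      ; isMVHomomorphism = fromOpaque hat-quotient-isHomomorphism
      ; injective        = λ {a} {b} a≈b → hat-injective (val≃ (≈ᴵ⇒≃ (hat a) (hat b) a≈b))
      }

    hat-unique : ∀ {f} → IsMVHomomorphism raw 𝕀°-raw f →
      (∀ {a} → f a ≋ 0ᴵ → a ∈ ideal) → (∀ {a} → a ∈ ideal → f a ≋ 0ᴵ) → ∀ a → f a ≋ hat a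
    hat-unique f-hom to from = same-kernel⇒≋ A f-hom hat-isHomomorphism
      (λ f≈0 → hat-≈0⁺ (to f≈0)) (λ h≈0 → from (hat-≈0⁻ h≈0))

    -- Ties whatever embedding an `IsHat` proof supplies to the fixed `hat`: both have kernel M.
    embedding-unique : ∀ (ε : Embedding A M) a → Embedding.emb ε a ≋ hat a
    embedding-unique ε = hat-unique (lift-hom hom)
      (λ {a} e≈0 → dist-0-∈⇒∈ (ε.injective (≃⇒≈ᴵ (ε.emb a) (ε.emb 0#) (≋⇒≃ (𝕀°.trans e≈0 (𝕀°.sym 0#-homo))))))
      (λ a∈ → 𝕀°.trans (⟦⟧-cong (∈⇒dist-0-∈ a∈)) 0#-homo)
      where
      module ε = Embedding ε
      hom = toOpaque ε.isMVHomomorphism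
      open IsMVHomomorphism hom

  open MaxIdealEmbedding using (hat; hat-isHomomorphism; embedding; embedding-unique; hat-unique;
    hat-≈0⁺; hat-≈0⁻)

  IsHat⇒≋ : ∀ {κ ℓ} (A : MVAlgebra κ ℓ) a g → IsHat A a g → ∀ M → Func.to g M ≋ hat A M a
  IsHat⇒≋ A a g isHat M = let ε , eq = isHat M in
    𝕀°.trans (val≃ (≈ᴵ⇒≃ (Func.to g M) (Embedding.emb ε a) eq)) (embedding-unique A M ε a)

  hat-cong : ∀ {κ ℓ} (A : MVAlgebra κ ℓ) (M N : MaxIdeal A) →
             MaxIdeal.ideal M ≐ MaxIdeal.ideal N → ∀ a → hat A M a ≋ hat A N a
  hat-cong A M N (M⊆N , N⊆M) = hat-unique A N (hat-isHomomorphism A M)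
    (λ h≈0 → M⊆N (hat-≈0⁻ A M h≈0)) (λ a∈N → hat-≈0⁺ A M (N⊆M a∈N))

  -- Equal hats put the distance of a and b into every maximal ideal.
  semisimple-separated : ∀ {κ ℓ} (A : MVAlgebra κ ℓ) → IsSemisimple A → ∀ {a b} →
    (∀ M → hat A M a ≋ hat A M b) → MVAlgebra._≈_ A a b
  semisimple-separated A semisimple eq = MVProperties.dist≈0⇒≈ A (semisimple _ λ M →
    hat-≈0⁻ A M (𝕀°.trans (HomProperties.dist-homo A 𝕀° (hat-isHomomorphism A M) _ _)
      (𝕀°ₚ.≈⇒dist≈0 (eq M))))

  module Kernel {κ ℓ} (A : MVAlgebra κ ℓ) {ψ : MVAlgebra.Carrier A → 𝕀}
                (ψ-hom : IsMVHomomorphism (MVAlgebra.raw A) 𝕀°-raw ψ) where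
    open MVAlgebra A
    open MVProperties A
    private
      module ψ = HomProperties A 𝕀° ψ-hom
      module R = ⊑-Reasoning

    -- If no multiple reached 1, no sum would be truncated, so n ψ(a) ≤ 1 for all n and ψ(a) would
    -- be 0.
    multiple-1 : ∀ {a} → ¬ ψ a ≋ 0ᴵ → ∃ λ n → ψ (n ·⊕ a) ≋ 𝕀°.1#
    multiple-1 {a} a≉0 = decidable-stable em λ none → a≉0 (val≃ (both
        (⊑-archimedean 1 λ n → R.begin
          n ·ᴿ val (ψ a)              R.≈⟨ exact none n ⟨
          val (ψ (n ·⊕ a))            R.≤⟨ ⊑1 (ψ (n ·⊕ a)) ⟩
          1ᴿ                          R.≈⟨ ·ᴿ-one 1ᴿ ⟨
          1 ·ᴿ 1ᴿ                     R.≈⟨ ℝ+.identityˡ _ ⟨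
          0ᴿ ⊞ 1 ·ᴿ 1ᴿ                R.≈⟨ ℝ+.∙-congʳ (·ᴿ-zeroʳ n) ⟨
          n ·ᴿ 0ᴿ ⊞ 1 ·ᴿ 1ᴿ           R.∎)
        (0⊑ (ψ a))))
      where
      exact : ¬ (∃ λ n → ψ (n ·⊕ a) ≋ 𝕀°.1#) → ∀ n → val (ψ (n ·⊕ a)) ≃ n ·ᴿ val (ψ a)
      exact none zero    = ℝ+.trans (≋⇒≃ ψ.0#-homo) (ℝ+.sym (·ᴿ-zero _))
      exact none (suc n) = R.begin-equality
          val (ψ (a ⊕ n ·⊕ a))                R.≈⟨ ≋⇒≃ (ψ.⊕-homo a (n ·⊕ a)) ⟩
          val (ψ a ⊹ ψ (n ·⊕ a))              R.≈⟨ ⊹-⊞ (ψ a) (ψ (n ·⊕ a)) bounded ⟩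
          val (ψ a) ⊞ val (ψ (n ·⊕ a))        R.≈⟨ ℝ+.∙-congˡ (exact none n) ⟩
          val (ψ a) ⊞ n ·ᴿ val (ψ a)          R.≈⟨ ·ᴿ-suc n _ ⟨
          suc n ·ᴿ val (ψ a)                  R.∎
        where
        bounded : val (ψ a) ⊞ val (ψ (n ·⊕ a)) ⊑ 1ᴿ
        bounded with ⊑-total (val (ψ a) ⊞ val (ψ (n ·⊕ a))) 1ᴿ
        ... | inj₁ ≤1 = ≤1
        ... | inj₂ 1≤ = contradiction (suc n , 𝕀°.trans (ψ.⊕-homo a (n ·⊕ a))
          (val≃ (ℝ+.trans (⊹-1 (ψ a) (ψ (n ·⊕ a)) 1≤) (ℝ+.sym ∼-0)))) none

    ¬1≈0 : ¬ 𝕀°.1# ≋ 0ᴵ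
    ¬1≈0 (val≃ eq) = ¬1ᴿ⊑0ᴿ (⊑.reflexive (ℝ+.trans (ℝ+.sym ∼-0) eq))

    kernel : MaxIdeal A
    kernel = record
      { ideal          = λ a → Lift ℓ (ψ a ≋ 0ᴵ)
      ; isMaximalIdeal = record
        { isIdeal = record
          { 0∈       = lift ψ.0#-homo
          ; ⊕-closed = λ (lift a≈0) (lift b≈0) → lift (𝕀°.trans (ψ.⊕-homo _ _)
              (𝕀°.trans (𝕀°.⊕-cong a≈0 b≈0) (𝕀°.identityʳ 0ᴵ)))
          ; downward = λ a≤b (lift b≈0) → lift (𝕀°ₚ.≤0⇒≈0 (𝕀°ₚ.≤-respʳ b≈0 (ψ.homo-mono a≤b)))
          }
        ; proper  = λ (lift 1≈0) → ¬1≈0 (𝕀°.trans (𝕀°.sym ψ.1#-homo) 1≈0)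
        -- Some multiple n a is mapped to 1. Its complement lies in the kernel, hence in J along
        -- with n a, and the two add up to `1#`.
        ; maximal = λ J-ideal 1∉J ker⊆J {a} a∈J → decidable-stable em λ a∉ker →
            let open IsIdeal J-ideal
                n , na≈1 = multiple-1 {a} (λ a≈0 → a∉ker (lift a≈0))
                ~na∈ker = 𝕀°.trans (ψ.~-homo _) (𝕀°.trans (𝕀°.~-cong na≈1) 𝕀°ₚ.~1≈0)
            in 1∉J (downward (≤-reflexive (sym ≤-refl)) (⊕-closed (ker⊆J (lift ~na∈ker)) (multiples J-ideal a∈J n)))
        }
      }
      where
      multiples : ∀ {J : Pred Carrier ℓ} → IsIdeal A J → ∀ {a} → a ∈ J → ∀ n → n ·⊕ a ∈ J
      multiples J a∈ zero    = IsIdeal.0∈ J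
      multiples J a∈ (suc n) = IsIdeal.⊕-closed J a∈ (multiples J a∈ n)

    hat-kernel : ∀ a → hat A kernel a ≋ ψ a
    hat-kernel a = 𝕀°.sym (hat-unique A kernel ψ-hom lift Level.lower a)

  -- Lower semicontinuity of the operations of [0,1]

  infix 4 _∈ᴵ_
  _∈ᴵ_ : ℚ → 𝕀 → Set
  q ∈ᴵ x = q ∈ lower (val x)

  ∈-⊑ : ∀ x y {q} → val x ⊑ val y → q ∈ᴵ x → q ∈ᴵ y
  ∈-⊑ _ _ (incl le) = le

  opaque
    unfolding _⊹_

    -- The thresholds r and s are part of a membership proof in a sum of cuts, and that proof
    -- mentions x and y in no other way.
    ⊹-continuous : ∀ x y {q} → q ∈ᴵ (x ⊹ y) → ∃₂ λ r s → r ∈ᴵ x × s ∈ᴵ y ×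
                   (∀ x′ y′ → r ∈ᴵ x′ → s ∈ᴵ y′ → q ∈ᴵ (x′ ⊹ y′))
    ⊹-continuous x y (q<1 , r , s , r∈ , s∈ , eq) =
      r , s , r∈ , s∈ , λ x′ y′ r∈′ s∈′ → q<1 , r , s , r∈′ , s∈′ , eq

  opaque
    unfolding _⊞_

    ∈-⊞⁺ : ∀ x y {r s} → r ∈ lower x → s ∈ lower y → r ℚ.+ s ∈ lower (x ⊞ y)
    ∈-⊞⁺ x y r∈ s∈ = _ , _ , r∈ , s∈ , ≡.refl

    ∈-⊞⁻ : ∀ x y {q} → q ∈ lower (x ⊞ y) →
           ∃₂ λ r s → r ∈ lower x × s ∈ lower y × q ≡ r ℚ.+ s
    ∈-⊞⁻ x y q∈ = q∈

  ∈-1⊞⁺ : ∀ x {q} → q ∈ lower x → 1ℚ ℚ.+ q ∈ lower (1ᴿ ⊞ x)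
  ∈-1⊞⁺ x {q} q∈ =
    let r , q<r , r∈ = rounded x q∈
    in ≡.subst (_∈ lower (1ᴿ ⊞ x)) (p-q+q≡p (1ℚ ℚ.+ q) r)
         (∈-⊞⁺ 1ᴿ x {1ℚ ℚ.+ q ℚ.+ ℚ.- r} {r} (below q<r) r∈)
    where
    below : ∀ {r} → q ℚ.< r → 1ℚ ℚ.+ q ℚ.+ ℚ.- r ℚ.< 1ℚ
    below {r} q<r = ≡.subst (1ℚ ℚ.+ q ℚ.+ ℚ.- r ℚ.<_)
      (p+q-q≡p 1ℚ r)
      (ℚₚ.+-monoˡ-< (ℚ.- r) (ℚₚ.+-monoʳ-< 1ℚ q<r))

  ∈-1⊞⁻ : ∀ x {q} → 1ℚ ℚ.+ q ∈ lower (1ᴿ ⊞ x) → q ∈ lower x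
  ∈-1⊞⁻ x {q} 1+q∈ =
    let r , s , r<1 , s∈ , eq = ∈-⊞⁻ 1ᴿ x 1+q∈
    in Cuts.downward x (ℚₚ.≰⇒> λ s≤q → ℚₚ.<-irrefl (≡.sym eq) (ℚₚ.+-mono-<-≤ r<1 s≤q)) s∈

  ⊞-⊑-1⊞⊙ : ∀ x y → val x ⊞ val y ⊑ 1ᴿ ⊞ val (x 𝕀°ₚ.⊙ y)
  ⊞-⊑-1⊞⊙ x y with em {P = x 𝕀°ₚ.⊙ y ≋ 0ᴵ}
  ... | no  ≉0 = ⊑.reflexive (⊙≉0⇒⊞ x y ≉0)
  ... | yes ≈0 = begin
      val x ⊞ val y                  ≈⟨ ⊙≈0⇒⊞ x y ≈0 ⟨
      val (x ⊹ y)                    ≤⟨ ⊑1 (x ⊹ y) ⟩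
      1ᴿ                             ≈⟨ ℝ+.identityʳ 1ᴿ ⟨
      1ᴿ ⊞ 0ᴿ                        ≤⟨ ⊞-monoʳ 1ᴿ (0⊑ (x 𝕀°ₚ.⊙ y)) ⟩
      1ᴿ ⊞ val (x 𝕀°ₚ.⊙ y)           ∎
    where open ⊑-Reasoning

  -- The value is 0 if x + y ≥ 1. Otherwise 1 plus the value is ∼ x + ∼ y, so thresholds for 1 + q
  -- can be read off a sum of cuts; x′ + y′ ≤ 1 + x′ ⊙ y′ then brings q back.
  ⊙-continuous : ∀ x y {q} → q ∈ᴵ ∼ (x ⊹ y) → q ∈ᴵ 0ᴵ ⊎ ∃₂ λ r s → r ∈ᴵ ∼ x × s ∈ᴵ ∼ y ×
                 (∀ x′ y′ → r ∈ᴵ x′ → s ∈ᴵ y′ → q ∈ᴵ (x′ 𝕀°ₚ.⊙ y′))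
  ⊙-continuous x y {q} q∈ with ⊑-total 1ᴿ (val x ⊞ val y)
  ... | inj₁ 1≤ = inj₁ (∈-⊑ (∼ (x ⊹ y)) 0ᴵ (⊑.reflexive (∼-1⇒0 (x ⊹ y) (⊹-1 x y 1≤))) q∈)
  ... | inj₂ ≤1 =
    let r , s , r∈ , s∈ , eq = ∈-⊞⁻ (val (∼ x)) (val (∼ y)) {1ℚ ℚ.+ q} (⊑⇒≤ᴿ bound (∈-1⊞⁺ (val (∼ (x ⊹ y))) q∈))
    in inj₂ (r , s , r∈ , s∈ , λ x′ y′ r∈′ s∈′ → ∈-1⊞⁻ (val (x′ 𝕀°ₚ.⊙ y′))
         (⊑⇒≤ᴿ (⊞-⊑-1⊞⊙ x′ y′)
           (≡.subst (_∈ lower (val x′ ⊞ val y′)) (≡.sym eq) (∈-⊞⁺ (val x′) (val y′) {r} {s} r∈′ s∈′))))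
    where
    open ⊑-Reasoning
    bound : 1ᴿ ⊞ val (∼ (x ⊹ y)) ⊑ val (∼ x) ⊞ val (∼ y)
    bound = ⊞-cancelʳ-⊑ (val x ⊞ val y) (begin
      1ᴿ ⊞ val (∼ (x ⊹ y)) ⊞ (val x ⊞ val y)        ≈⟨ ℝ+.∙-congˡ (⊹-⊞ x y ≤1) ⟨
      1ᴿ ⊞ val (∼ (x ⊹ y)) ⊞ val (x ⊹ y)            ≈⟨ ℝ+.assoc _ _ _ ⟩
      1ᴿ ⊞ (val (∼ (x ⊹ y)) ⊞ val (x ⊹ y))          ≈⟨ ℝ+.∙-congˡ (∼-complement (x ⊹ y)) ⟩
      1ᴿ ⊞ 1ᴿ                                       ≈⟨ complements x y ⟨
      val (∼ x) ⊞ val (∼ y) ⊞ (val x ⊞ val y)       ∎)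

  ⊑∼-sym : ∀ x y → val x ⊑ val (∼ y) → val y ⊑ val (∼ x)
  ⊑∼-sym x y le = ⊑.trans (⊑.reflexive (ℝ+.sym (∼-involutive y))) (∼-anti x (∼ y) le)

  ∼⊑-sym : ∀ x y → val (∼ x) ⊑ val y → val (∼ y) ⊑ val x
  ∼⊑-sym x y le = ⊑.trans (∼-anti (∼ x) y le) (⊑.reflexive (∼-involutive x))

  -- The coproduct

  -- Excluded middle resizes propositions, so [0,1] has a copy in Set: this keeps the
  -- carrier of the coproduct at the level of the summands.
  Squash : ∀ {p} → Set p → Set
  Squash P = True (em {P = P})

  opaque
    𝕀ₛ : Set
    𝕀ₛ = Σ (ℚ → Bool) λ b → Squash (Σ 𝕀 λ x → ∀ q → (T (b q) → q ∈ᴵ x) × (q ∈ᴵ x → T (b q)))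

    decode : 𝕀ₛ → 𝕀
    decode (_ , x) = proj₁ (toWitness x)

    encode : 𝕀 → 𝕀ₛ
    encode x = (λ q → ⌊ em {P = q ∈ᴵ x} ⌋) , fromWitness (x , λ q → toWitness , fromWitness)

    decode-encode : ∀ x → decode (encode x) ≋ x
    decode-encode x = val≃ (both (incl λ {q} q∈ → toWitness (proj₂ (correct q) q∈))
                                 (incl λ {q} q∈ → proj₁ (correct q) (fromWitness q∈)))
      where
      correct : ∀ q → (True (em {P = q ∈ᴵ x}) → q ∈ᴵ decode (encode x)) ×
                      (q ∈ᴵ decode (encode x) → True (em {P = q ∈ᴵ x}))
      correct = proj₂ (toWitness (proj₂ (encode x)))

  module Clopens {c ℓ} {I : Set c} (A : I → MVAlgebra c ℓ) where
    private module A i = MVAlgebra (A i)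

    Generator : Set c
    Generator = Σ I A.Carrier

    Point : Set c
    Point = Σ (∀ i → A.Carrier i → 𝕀ₛ) λ x →
      Squash (∀ i → IsMVHomomorphism (A.raw i) 𝕀°-raw (decode ∘ x i))

    at : Point → ∀ i → A.Carrier i → 𝕀
    at x i a = decode (proj₁ x i a)

    at-isHomomorphism : ∀ x i → IsMVHomomorphism (A.raw i) 𝕀°-raw (at x i)
    at-isHomomorphism x = toWitness (proj₂ x)

    module _ (f : ∀ i → A.Carrier i → 𝕀) (f-hom : ∀ i → IsMVHomomorphism (A.raw i) 𝕀°-raw (f i)) where

      point : Point
      point = (λ i a → encode (f i a)) , fromWitness λ i → let open IsMVHomomorphism (f-hom i) in record
        { ⟦⟧-cong = λ a≈b → via (⟦⟧-cong a≈b)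
        ; ⊕-homo  = λ a b → 𝕀°.trans (via (⊕-homo a b)) (𝕀°.sym (𝕀°.trans
            (𝕀°.⊕-cong (decode-encode _) (decode-encode _)) (𝕀°.sym (decode-encode _))))
        ; ~-homo  = λ a → 𝕀°.trans (via (~-homo a)) (𝕀°.sym (𝕀°.trans
            (𝕀°.~-cong (decode-encode _)) (𝕀°.sym (decode-encode _))))
        ; 0#-homo = 𝕀°.trans (via 0#-homo) (decode-encode 0ᴵ)
        }
        where
        via : ∀ {x y} → x ≋ y → decode (encode x) ≋ decode (encode y)
        via x≋y = 𝕀°.trans (decode-encode _) (𝕀°.trans x≋y (𝕀°.sym (decode-encode _)))

      at-point : ∀ i a → at point i a ≋ f i a
      at-point i a = decode-encode (f i a)

    termValue : Point → Term Generator → 𝕀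
    termValue x = eval 𝕀°-raw λ (i , a) → at x i a

    -- f is the pointwise join of the term functions below it; for ∼ f this makes f a meet.
    Open : (Point → 𝕀) → Set c
    Open f = ∀ x q → q ∈ᴵ f x → ∃ λ t → (∀ y → val (termValue y t) ⊑ val (f y)) × q ∈ᴵ termValue x t

    Clopen : (Point → 𝕀) → Set c
    Clopen f = Open f × Open (∼_ ∘ f)

    Open-resp : ∀ {f g} → (∀ x → f x ≋ g x) → Open f → Open g
    Open-resp {f} {g} f≋g open-f x q q∈ =
      let t , t⊑f , q∈t = open-f x q (∈-⊑ (g x) (f x) (≃⇒⊒ (≋⇒≃ (f≋g x))) q∈)
      in t , (λ y → ⊑.trans (t⊑f y) (≃⇒⊑ (≋⇒≃ (f≋g y)))) , q∈t

    Clopen-resp : ∀ {f g} → (∀ x → f x ≋ g x) → Clopen f → Clopen g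
    Clopen-resp f≋g (o , o′) = Open-resp f≋g o , Open-resp (λ x → 𝕀°.~-cong (f≋g x)) o′

    Clopen-term : ∀ t → Clopen (λ x → termValue x t)
    Clopen-term t = (λ x q q∈ → t , (λ _ → ⊑.refl) , q∈) , (λ x q q∈ → (~ₜ t) , (λ _ → ⊑.refl) , q∈)

    Clopen-∼ : ∀ {f} → Clopen f → Clopen (∼_ ∘ f)
    Clopen-∼ (o , o′) = o′ , Open-resp (λ x → 𝕀°.sym (𝕀°.~-involutive _)) o

    Clopen-⊹ : ∀ {f g} → Clopen f → Clopen g → Clopen (λ x → f x ⊹ g x)
    Clopen-⊹ {f} {g} (of , of′) (og , og′) = sums , products
      where
      sums : Open (λ x → f x ⊹ g x)
      sums x q q∈ =
        let r , s , r∈ , s∈ , cont = ⊹-continuous (f x) (g x) q∈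
            t , t⊑f , r∈t = of x r r∈
            u , u⊑g , s∈u = og x s s∈
        in (t ⊕ₜ u) , (λ y → ⊹-mono (termValue y t) (f y) (termValue y u) (g y) (t⊑f y) (u⊑g y)) ,
           cont (termValue x t) (termValue x u) r∈t s∈u
      products : Open (λ x → ∼ (f x ⊹ g x))
      products x q q∈ with ⊙-continuous (f x) (g x) q∈
      ... | inj₁ q∈0 = 0ₜ , (λ y → 0⊑ (∼ (f y ⊹ g y))) , q∈0
      ... | inj₂ (r , s , r∈ , s∈ , cont) =
        let t , t⊑∼f , r∈t = of′ x r r∈
            u , u⊑∼g , s∈u = og′ x s s∈
        -- The term for t ⊙ u, because ∼ (f ⊹ g) is ∼ f ⊙ ∼ g.
        in (~ₜ ((~ₜ t) ⊕ₜ (~ₜ u))) ,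
           (λ y → ∼-anti (f y ⊹ g y) (∼ termValue y t ⊹ ∼ termValue y u)
             (⊹-mono (f y) (∼ termValue y t) (g y) (∼ termValue y u)
               (⊑∼-sym (termValue y t) (f y) (t⊑∼f y)) (⊑∼-sym (termValue y u) (g y) (u⊑∼g y)))) ,
           cont (termValue x t) (termValue x u) r∈t s∈u

    -- If q lay below no member at x, then q itself would bound the family and hence f x. A negative
    -- q is no element of [0,1] to serve as that bound, and the term 0 covers it, even for an empty
    -- family.
    Open-join : ∀ {k} {K : Set k} (g : K → Point → 𝕀) (f : Point → 𝕀) → (∀ i → Open (g i)) →
                (∀ i x → val (g i x) ⊑ val (f x)) →
                (∀ x u → (∀ i → val (g i x) ⊑ val u) → val (f x) ⊑ val u) → Open f
    Open-join g f open-g upper least x q q∈ with q ℚₚ.<? 0ℚ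
    ... | yes q<0 = 0ₜ , (λ y → 0⊑ (f y)) , q<0
    ... | no  q≮0 with em {P = ∃ λ i → q ∈ᴵ g i x}
    ...   | yes (i , q∈g) =
      let t , t⊑g , q∈t = open-g i x q q∈g
      in t , (λ y → ⊑.trans (t⊑g y) (upper i y)) , q∈t
    ...   | no  none = contradiction
      (⊑⇒≤ᴿ {val (f x)} {val u} (least x u λ i → ∉⇒⊑-fromℚ (val (g i x)) λ q∈g → none (i , q∈g)) q∈)
      (ℚₚ.<-irrefl ≡.refl)
      where
      u : 𝕀
      u = mk𝕀 (fromℚ q) (λ r<0 → ℚₚ.<-≤-trans r<0 (ℚₚ.≮⇒≥ q≮0))
                        (λ r<q → ℚₚ.<-trans r<q (⊑⇒≤ᴿ (⊑1 (f x)) q∈))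

    opaque
      Carrier : Set c
      Carrier = Σ (Point → 𝕀ₛ) λ F → Squash (Clopen (decode ∘ F))

      ⟦_⟧ : Carrier → Point → 𝕀
      ⟦ F ⟧ x = decode (proj₁ F x)

      ⟦⟧-clopen : ∀ F → Clopen ⟦ F ⟧
      ⟦⟧-clopen F = toWitness (proj₂ F)

      clopen : ∀ f → Clopen f → Carrier
      clopen f f-clopen = encode ∘ f ,
        fromWitness (Clopen-resp (λ x → 𝕀°.sym (decode-encode (f x))) f-clopen)

      ⟦clopen⟧ : ∀ f f-clopen x → ⟦ clopen f f-clopen ⟧ x ≋ f x
      ⟦clopen⟧ f _ x = decode-encode (f x)

      infixl 6 _⊕ᶜ_
      _⊕ᶜ_ : Carrier → Carrier → Carrier
      F ⊕ᶜ G = clopen (λ x → ⟦ F ⟧ x ⊹ ⟦ G ⟧ x) (Clopen-⊹ (⟦⟧-clopen F) (⟦⟧-clopen G))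

      ⟦⊕⟧ : ∀ F G x → ⟦ F ⊕ᶜ G ⟧ x ≋ ⟦ F ⟧ x ⊹ ⟦ G ⟧ x
      ⟦⊕⟧ F G x = decode-encode (⟦ F ⟧ x ⊹ ⟦ G ⟧ x)

      ~ᶜ_ : Carrier → Carrier
      ~ᶜ F = clopen (λ x → ∼ ⟦ F ⟧ x) (Clopen-∼ (⟦⟧-clopen F))

      ⟦~⟧ : ∀ F x → ⟦ ~ᶜ F ⟧ x ≋ ∼ ⟦ F ⟧ x
      ⟦~⟧ F x = decode-encode (∼ ⟦ F ⟧ x)

      term : Term Generator → Carrier
      term t = clopen (λ x → termValue x t) (Clopen-term t)

      ⟦term⟧ : ∀ t x → ⟦ term t ⟧ x ≋ termValue x t
      ⟦term⟧ t x = decode-encode (termValue x t)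

    -- Pointwise equality quantifies over all points; squashing and lifting bring it to the level ℓ.
    raw : RawMVAlgebra c ℓ
    raw = record
      { Carrier = Carrier
      ; _≈_     = λ F G → Lift ℓ (Squash (∀ x → ⟦ F ⟧ x ≋ ⟦ G ⟧ x))
      ; _⊕_     = _⊕ᶜ_
      ; ~_      = ~ᶜ_
      ; 0#      = term 0ₜ
      }

    ⟦⟧-isHomomorphism : ∀ x → IsMVHomomorphism raw 𝕀°-raw (λ F → ⟦ F ⟧ x)
    ⟦⟧-isHomomorphism x = record
      { ⟦⟧-cong = λ (lift F≈G) → toWitness F≈G x
      ; ⊕-homo  = λ F G → ⟦⊕⟧ F G x
      ; ~-homo  = λ F → ⟦~⟧ F x
      ; 0#-homo = ⟦term⟧ 0ₜ x
      }

    ⟦⟧-injective : ∀ {F G} → (∀ x → ⟦ F ⟧ x ≋ ⟦ G ⟧ x) → RawMVAlgebra._≈_ raw F G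
    ⟦⟧-injective F≋G = lift (fromWitness F≋G)

    private
      module JI = JointlyInjective raw 𝕀° (λ x F → ⟦ F ⟧ x) ⟦⟧-isHomomorphism ⟦⟧-injective

    mvAlgebra : MVAlgebra c ℓ
    mvAlgebra = JI.mvAlgebra

    open MVAlgebra mvAlgebra using (_≈_; _≤_; ~_; _⊕_; 0#)

    ≤-pointwise : ∀ {F G} → (∀ x → val (⟦ F ⟧ x) ⊑ val (⟦ G ⟧ x)) → F ≤ G
    ≤-pointwise F⊑G = JI.≤-reflect λ x → ⊑⇒𝕀°-≤ (F⊑G x)

    injection : ∀ i → A.Carrier i → Carrier
    injection i a = term (var (i , a))

    ⟦injection⟧ : ∀ i a x → ⟦ injection i a ⟧ x ≋ at x i a
    ⟦injection⟧ i a = ⟦term⟧ (var (i , a))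

    injection-isHomomorphism : ∀ i → IsMVHomomorphism (A.raw i) raw (injection i)
    injection-isHomomorphism i = record
      { ⟦⟧-cong = λ {a} {b} a≈b → ⟦⟧-injective λ x → 𝕀°.trans (⟦injection⟧ i a x)
          (𝕀°.trans (at.⟦⟧-cong x a≈b) (𝕀°.sym (⟦injection⟧ i b x)))
      ; ⊕-homo  = λ a b → ⟦⟧-injective λ x → 𝕀°.trans (⟦injection⟧ i (a A⊕ b) x)
          (𝕀°.trans (at.⊕-homo x a b) (𝕀°.sym (𝕀°.trans (⟦⊕⟧ (injection i a) (injection i b) x)
            (𝕀°.⊕-cong (⟦injection⟧ i a x) (⟦injection⟧ i b x)))))
      ; ~-homo  = λ a → ⟦⟧-injective λ x → 𝕀°.trans (⟦injection⟧ i (A~ a) x)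
          (𝕀°.trans (at.~-homo x a) (𝕀°.sym (𝕀°.trans (⟦~⟧ (injection i a) x)
            (𝕀°.~-cong (⟦injection⟧ i a x)))))
      ; 0#-homo = ⟦⟧-injective λ x → 𝕀°.trans (⟦injection⟧ i (A.0# i) x)
          (𝕀°.trans (at.0#-homo x) (𝕀°.sym (⟦term⟧ 0ₜ x)))
      }
      where
      open MVAlgebra (A i) using () renaming (_⊕_ to _A⊕_; ~_ to A~_)
      module at x = IsMVHomomorphism (at-isHomomorphism x i)

    termValue-cong : ∀ x y → (∀ i a → at x i a ≋ at y i a) → ∀ t → termValue x t ≋ termValue y t
    termValue-cong x y x≋y = eval-cong 𝕀° λ (i , a) → x≋y i a

    -- An element is a bare function on codes of points, with no congruence built in. It inherits
    -- one from the term functions of which it is a join.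
    ⟦⟧-resp : ∀ F x y → (∀ i a → at x i a ≋ at y i a) → ⟦ F ⟧ x ≋ ⟦ F ⟧ y
    ⟦⟧-resp F x y x≋y = val≃ (both (le x y x≋y) (le y x λ i a → 𝕀°.sym (x≋y i a)))
      where
      le : ∀ x y → (∀ i a → at x i a ≋ at y i a) → val (⟦ F ⟧ x) ⊑ val (⟦ F ⟧ y)
      le x y x≋y = incl λ {q} q∈ →
        let t , t⊑F , q∈t = proj₁ (⟦⟧-clopen F) x q q∈
        in ∈-⊑ (termValue x t) (⟦ F ⟧ y) (⊑.trans (≃⇒⊑ (≋⇒≃ (termValue-cong x y x≋y t))) (t⊑F y)) q∈t

    -- Homomorphisms to [0,1] as evaluations, and limit cut completeness

    module Evaluation {ψ : Carrier → 𝕀} (ψ-hom : IsMVHomomorphism raw 𝕀°-raw ψ) where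
      private
        module ψ = HomProperties mvAlgebra 𝕀° ψ-hom

      ψ∘injection-isHomomorphism : ∀ i → IsMVHomomorphism (A.raw i) 𝕀°-raw (ψ ∘ injection i)
      ψ∘injection-isHomomorphism i = record
        { ⟦⟧-cong = λ a≈b → ψ.⟦⟧-cong (inj.⟦⟧-cong i a≈b)
        ; ⊕-homo  = λ a b → 𝕀°.trans (ψ.⟦⟧-cong (inj.⊕-homo i a b)) (ψ.⊕-homo _ _)
        ; ~-homo  = λ a → 𝕀°.trans (ψ.⟦⟧-cong (inj.~-homo i a)) (ψ.~-homo _)
        ; 0#-homo = 𝕀°.trans (ψ.⟦⟧-cong (inj.0#-homo i)) ψ.0#-homo
        }
        where module inj i = IsMVHomomorphism (injection-isHomomorphism i)

      restriction : Point
      restriction = point (λ i → ψ ∘ injection i) ψ∘injection-isHomomorphism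

      private
        term-eval : ∀ t → term t ≈ eval raw (λ (i , a) → injection i a) t
        term-eval t = ⟦⟧-injective λ x → 𝕀°.trans (⟦term⟧ t x) (𝕀°.sym
          (eval-hom raw 𝕀° (⟦⟧-isHomomorphism x) (λ (i , a) → ⟦term⟧ (var (i , a)) x) t))

        ψ-term : ∀ t → ψ (term t) ≋ termValue restriction t
        ψ-term t = 𝕀°.trans (ψ.⟦⟧-cong (term-eval t))
          (eval-hom raw 𝕀° ψ-hom (λ (i , a) → 𝕀°.sym
            (at-point (λ i → ψ ∘ injection i) ψ∘injection-isHomomorphism i a)) t)

        below : ∀ F → val (⟦ F ⟧ restriction) ⊑ val (ψ F)
        below F = incl λ {q} q∈ →
          let t , t⊑F , q∈t = proj₁ (⟦⟧-clopen F) restriction q q∈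
              t≤F = ≤-pointwise λ x → ⊑.trans (≃⇒⊑ (≋⇒≃ (⟦term⟧ t x))) (t⊑F x)
          in ∈-⊑ (termValue restriction t) (ψ F) (⊑.trans (≃⇒⊒ (≋⇒≃ (ψ-term t))) (𝕀°-≤⇒⊑ (ψ.homo-mono t≤F))) q∈t

      ψ-evaluation : ∀ F → ψ F ≋ ⟦ F ⟧ restriction
      ψ-evaluation F = val≃ (both
        -- The upper bound is the lower bound for `~ F`, complemented.
        (⊑.trans (≃⇒⊒ (∼-involutive (ψ F))) (∼⊑-sym (⟦ F ⟧ restriction) (∼ ψ F) (⊑.trans
          (≃⇒⊒ (≋⇒≃ (IsMVHomomorphism.~-homo (⟦⟧-isHomomorphism restriction) F)))
          (⊑.trans (below (~ F)) (≃⇒⊑ (≋⇒≃ (ψ.~-homo F)))))))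
        (below F))

    -- The kernels of the evaluations at points suffice: an element of all of them vanishes
    -- everywhere.
    isSemisimple : IsSemisimple mvAlgebra
    isSemisimple F F∈ = ⟦⟧-injective λ x →
      𝕀°.trans (Level.lower (F∈ (Kernel.kernel mvAlgebra (⟦⟧-isHomomorphism x))))
        (𝕀°.sym (IsMVHomomorphism.0#-homo (⟦⟧-isHomomorphism x)))

    cutComplete : ∀ (f : 𝕀^Max mvAlgebra) (X Y : Pred (𝕀^Max mvAlgebra) (c ⊔ lsuc ℓ)) →
                  X ⊆ Â mvAlgebra → Y ⊆ Â mvAlgebra →
                  IsJoin mvAlgebra f X → IsMeet mvAlgebra f Y → f ∈ Â mvAlgebra
    cutComplete f X Y X⊆Â Y⊆Â f-join f-meet = F , isHat
      where
      max : Point → MaxIdeal mvAlgebra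
      max x = Kernel.kernel mvAlgebra (⟦⟧-isHomomorphism x)

      f₀ : Point → 𝕀
      f₀ x = Func.to f (max x)

      hat-max : ∀ {F g} → IsHat mvAlgebra F g → ∀ x → Func.to g (max x) ≋ ⟦ F ⟧ x
      hat-max {F} {g} F-hat x = 𝕀°.trans (IsHat⇒≋ mvAlgebra F g F-hat (max x))
        (Kernel.hat-kernel mvAlgebra (⟦⟧-isHomomorphism x) F)

      f₀-open : Open f₀
      f₀-open = Open-join {K = Σ (𝕀^Max mvAlgebra) X} (λ (g , g∈X) → ⟦ proj₁ (X⊆Â {g} g∈X) ⟧) f₀
        (λ (g , g∈X) → proj₁ (⟦⟧-clopen (proj₁ (X⊆Â {g} g∈X))))
        (λ (g , g∈X) x → ⊑.trans (≃⇒⊒ (≋⇒≃ (hat-max {proj₁ (X⊆Â {g} g∈X)} {g} (proj₂ (X⊆Â {g} g∈X)) x)))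
          (≤ᴵ⇒⊑ (Func.to g (max x)) (f₀ x) (proj₁ (f-join (max x)) g g∈X)))
        (λ x u bound → ≤ᴵ⇒⊑ (f₀ x) u (proj₂ (f-join (max x)) u λ g g∈X →
          ⊑⇒≤ᴿ (⊑.trans (≃⇒⊑ (≋⇒≃ (hat-max {proj₁ (X⊆Â {g} g∈X)} {g} (proj₂ (X⊆Â {g} g∈X)) x)))
            (bound (g , g∈X)))))

      -- Complementing turns the meet over Y into a join.
      ∼f₀-open : Open (∼_ ∘ f₀)
      ∼f₀-open = Open-join {K = Σ (𝕀^Max mvAlgebra) Y} (λ (g , g∈Y) x → ∼ ⟦ proj₁ (Y⊆Â {g} g∈Y) ⟧ x) (∼_ ∘ f₀)
        (λ (g , g∈Y) → proj₂ (⟦⟧-clopen (proj₁ (Y⊆Â {g} g∈Y))))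
        (λ (g , g∈Y) x → ∼-anti (f₀ x) (⟦ proj₁ (Y⊆Â {g} g∈Y) ⟧ x)
          (⊑.trans (≤ᴵ⇒⊑ (f₀ x) (Func.to g (max x)) (proj₁ (f-meet (max x)) g g∈Y))
            (≃⇒⊑ (≋⇒≃ (hat-max {proj₁ (Y⊆Â {g} g∈Y)} {g} (proj₂ (Y⊆Â {g} g∈Y)) x)))))
        (λ x u bound → ∼⊑-sym u (f₀ x) (≤ᴵ⇒⊑ (∼ u) (f₀ x) (proj₂ (f-meet (max x)) (∼ u) λ g g∈Y →
          ⊑⇒≤ᴿ (⊑.trans (∼⊑-sym (⟦ proj₁ (Y⊆Â {g} g∈Y) ⟧ x) u (bound (g , g∈Y)))
            (≃⇒⊒ (≋⇒≃ (hat-max {proj₁ (Y⊆Â {g} g∈Y)} {g} (proj₂ (Y⊆Â {g} g∈Y)) x)))))))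

      F : Carrier
      F = clopen f₀ (f₀-open , ∼f₀-open)

      isHat : IsHat mvAlgebra F f
      isHat M = embedding mvAlgebra M , ≃⇒≈ᴵ (Func.to f M) (hat mvAlgebra M F) (≋⇒≃ (𝕀°.sym (begin
          hat mvAlgebra M F        ≈⟨ ψ-evaluation F ⟩
          ⟦ F ⟧ x                  ≈⟨ ⟦clopen⟧ f₀ (f₀-open , ∼f₀-open) x ⟩
          f₀ x                     ≈⟨ val≃ (≈ᴵ⇒≃ (f₀ x) (Func.to f M) (Func.cong f {max x} {M} (⊆M , M⊆))) ⟩
          Func.to f M              ∎)))
        where
        open 𝕀°-Reasoning
        open Evaluation (hat-isHomomorphism mvAlgebra M)
        x : Point
        x = restriction
        -- M is the kernel of its hat, which is evaluation at x. So M and `max x` are the same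
        -- ideal, and f takes the same value at both.
        ⊆M : MaxIdeal.ideal (max x) ⊆ MaxIdeal.ideal M
        ⊆M {G} (lift G≈0) = hat-≈0⁻ mvAlgebra M (𝕀°.trans (ψ-evaluation G) G≈0)
        M⊆ : MaxIdeal.ideal M ⊆ MaxIdeal.ideal (max x)
        M⊆ {G} G∈M = lift (𝕀°.trans (𝕀°.sym (ψ-evaluation G)) (hat-≈0⁺ mvAlgebra M G∈M))

    isLCC : IsLCC mvAlgebra
    isLCC = record { isSemisimple = isSemisimple ; cutComplete = cutComplete }

    -- The universal property

    module Copairing (B : MVAlgebra c ℓ) (B-lcc : IsLCC B) (f : ∀ i → MVHom (A i) B) where
      private
        module B = MVAlgebra B
        module f i = MVHom (f i)
      open IsLCC B-lcc renaming (isSemisimple to B-semisimple; cutComplete to B-cutComplete)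

      hat∘f-isHomomorphism : ∀ M i → IsMVHomomorphism (A.raw i) 𝕀°-raw (hat B M ∘ f.fun i)
      hat∘f-isHomomorphism M i = record
        { ⟦⟧-cong = λ a≈b → ⟦⟧-cong (f.⟦⟧-cong i a≈b)
        ; ⊕-homo  = λ a b → 𝕀°.trans (⟦⟧-cong (f.⊕-homo i a b)) (⊕-homo _ _)
        ; ~-homo  = λ a → 𝕀°.trans (⟦⟧-cong (f.~-homo i a)) (~-homo _)
        ; 0#-homo = 𝕀°.trans (⟦⟧-cong (f.0#-homo i)) 0#-homo
        }
        where open IsMVHomomorphism (hat-isHomomorphism B M)

      dual : MaxIdeal B → Point
      dual M = point (λ i → hat B M ∘ f.fun i) (hat∘f-isHomomorphism M)

      at-dual : ∀ M i a → at (dual M) i a ≋ hat B M (f.fun i a)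
      at-dual M = at-point (λ i → hat B M ∘ f.fun i) (hat∘f-isHomomorphism M)

      termIn : Term Generator → B.Carrier
      termIn = eval B.raw λ (i , a) → f.fun i a

      hat-termIn : ∀ M t → hat B M (termIn t) ≋ termValue (dual M) t
      hat-termIn M = eval-hom B.raw 𝕀° (hat-isHomomorphism B M) λ (i , a) → 𝕀°.sym (at-dual M i a)

      hatFun : B.Carrier → 𝕀^Max B
      hatFun b = record
        { to   = λ M → hat B M b
        ; cong = λ {M} {N} M≐N → ≃⇒≈ᴵ (hat B M b) (hat B N b) (≋⇒≃ (hat-cong B M N M≐N b))
        }

      isHat-hatFun : ∀ b → IsHat B b (hatFun b)
      isHat-hatFun b M = embedding B M , ≃⇒≈ᴵ (hat B M b) (hat B M b) ℝ+.refl

      pullback : Carrier → 𝕀^Max B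
      pullback F = record
        { to   = λ M → ⟦ F ⟧ (dual M)
        ; cong = λ {M} {N} M≐N → ≃⇒≈ᴵ (⟦ F ⟧ (dual M)) (⟦ F ⟧ (dual N)) (≋⇒≃ (⟦⟧-resp F (dual M) (dual N)
            λ i a → 𝕀°.trans (at-dual M i a) (𝕀°.trans (hat-cong B M N M≐N (f.fun i a)) (𝕀°.sym (at-dual N i a)))))
        }

      -- Membership asks for `IsHat` rather than for equality with `hatFun`, which makes the
      -- inclusions in `Â` immediate.
      Below Above : Carrier → Pred (𝕀^Max B) (c ⊔ lsuc ℓ)
      Below F h = Σ (Term Generator) λ t → (∀ y → val (termValue y t) ⊑ val (⟦ F ⟧ y)) × IsHat B (termIn t) h
      Above F h = Σ (Term Generator) λ t → (∀ y → val (⟦ F ⟧ y) ⊑ val (termValue y t)) × IsHat B (termIn t) h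

      hat-term : ∀ t {h} → IsHat B (termIn t) h → ∀ M → Func.to h M ≋ termValue (dual M) t
      hat-term t {h} isHat M = 𝕀°.trans (IsHat⇒≋ B (termIn t) h isHat M) (hat-termIn M t)

      pullback-join : ∀ F → IsJoin B (pullback F) (Below F)
      pullback-join F M =
        (λ h (t , t⊑F , isHat) → ⊑⇒≤ᴿ (⊑.trans (≃⇒⊑ (≋⇒≃ (hat-term t {h} isHat M))) (t⊑F (dual M)))) ,
        (λ u bound {q} q∈ →
          let t , t⊑F , q∈t = proj₁ (⟦⟧-clopen F) (dual M) q q∈
          in bound (hatFun (termIn t)) (t , t⊑F , isHat-hatFun (termIn t))
               (∈-⊑ (termValue (dual M) t) (hat B M (termIn t)) (≃⇒⊒ (≋⇒≃ (hat-termIn M t))) q∈t))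

      pullback-meet : ∀ F → IsMeet B (pullback F) (Above F)
      pullback-meet F M =
        (λ h (t , F⊑t , isHat) → ⊑⇒≤ᴿ (⊑.trans (F⊑t (dual M)) (≃⇒⊒ (≋⇒≃ (hat-term t {h} isHat M))))) ,
        -- By complementation ∼ F ≤ ∼ l is to be shown, and a term t below ∼ F gives the term ~ t
        -- above F to which the bound applies.
        (λ l bound → ⊑⇒≤ᴿ (⊑.trans (⊑∼-sym (∼ ⟦ F ⟧ (dual M)) l (incl λ {q} q∈ →
          let t , t⊑∼F , q∈t = proj₂ (⟦⟧-clopen F) (dual M) q q∈
              l≤ = bound (hatFun (termIn (~ₜ t))) ((~ₜ t) ,
                     (λ y → ⊑∼-sym (termValue y t) (⟦ F ⟧ y) (t⊑∼F y)) , isHat-hatFun (termIn (~ₜ t)))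
          in ∈-⊑ (termValue (dual M) t) (∼ l) (⊑∼-sym l (termValue (dual M) t)
               (⊑.trans (≤ᴵ⇒⊑ l (hat B M (termIn (~ₜ t))) l≤) (≃⇒⊑ (≋⇒≃ (hat-termIn M (~ₜ t)))))) q∈t))
          (≃⇒⊑ (∼-involutive (⟦ F ⟧ (dual M))))))

      opaque
        extension : ∀ F → pullback F ∈ Â B
        extension F = B-cutComplete (pullback F) (Below F) (Above F)
          (λ (t , _ , isHat) → termIn t , isHat) (λ (t , _ , isHat) → termIn t , isHat)
          (pullback-join F) (pullback-meet F)

        copairing : Carrier → B.Carrier
        copairing F = proj₁ (extension F)

        hat-copairing : ∀ M F → hat B M (copairing F) ≋ ⟦ F ⟧ (dual M)
        hat-copairing M F = 𝕀°.sym (IsHat⇒≋ B (copairing F) (pullback F) (proj₂ (extension F)) M)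

      private
        separated : ∀ {a b} → (∀ M → hat B M a ≋ hat B M b) → a B.≈ b
        separated = semisimple-separated B B-semisimple

      -- B is semisimple, so the equations can be checked under each hat, where the copairing
      -- becomes evaluation at the point `dual M`.
      copairing-isHomomorphism : IsMVHomomorphism raw B.raw copairing
      copairing-isHomomorphism = record
        { ⟦⟧-cong = λ {F} {G} F≈G → separated λ M → 𝕀°.trans (hat-copairing M F)
            (𝕀°.trans (ev.⟦⟧-cong M F≈G) (𝕀°.sym (hat-copairing M G)))
        ; ⊕-homo  = λ F G → separated λ M → 𝕀°.trans (hat-copairing M (F ⊕ G)) (𝕀°.trans (ev.⊕-homo M F G)
            (𝕀°.sym (𝕀°.trans (hat.⊕-homo M _ _) (𝕀°.⊕-cong (hat-copairing M F) (hat-copairing M G)))))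
        ; ~-homo  = λ F → separated λ M → 𝕀°.trans (hat-copairing M (~ F)) (𝕀°.trans (ev.~-homo M F)
            (𝕀°.sym (𝕀°.trans (hat.~-homo M _) (𝕀°.~-cong (hat-copairing M F)))))
        ; 0#-homo = separated λ M → 𝕀°.trans (hat-copairing M 0#)
            (𝕀°.trans (ev.0#-homo M) (𝕀°.sym (hat.0#-homo M)))
        }
        where
        module ev M = IsMVHomomorphism (⟦⟧-isHomomorphism (dual M))
        module hat M = IsMVHomomorphism (hat-isHomomorphism B M)

      copairing-injection : ∀ i a → copairing (injection i a) B.≈ f.fun i a
      copairing-injection i a = separated λ M → 𝕀°.trans (hat-copairing M (injection i a))
        (𝕀°.trans (⟦injection⟧ i a (dual M)) (at-dual M i a))

      -- Each hat after k is a homomorphism to [0,1], hence evaluation at its restriction to the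
      -- summands, and there k agrees with f. This replaces an argument by generation: elements need
      -- not be terms in the images of the summands.
      copairing-unique : ∀ (k : MVHom mvAlgebra B) → (∀ i a → MVHom.fun k (injection i a) B.≈ f.fun i a) →
                         ∀ F → MVHom.fun k F B.≈ copairing F
      copairing-unique k k-injection F = separated λ M →
        let open Evaluation (hat∘k-isHomomorphism M)
            restriction≋dual : ∀ i a → at restriction i a ≋ at (dual M) i a
            restriction≋dual i a = 𝕀°.trans
              (at-point (λ i → hat B M ∘ k.fun ∘ injection i) ψ∘injection-isHomomorphism i a)
              (𝕀°.trans (IsMVHomomorphism.⟦⟧-cong (hat-isHomomorphism B M) (k-injection i a))
                (𝕀°.sym (at-dual M i a)))
        in begin
          hat B M (k.fun F)            ≈⟨ ψ-evaluation F ⟩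
          ⟦ F ⟧ restriction            ≈⟨ ⟦⟧-resp F restriction (dual M) restriction≋dual ⟩
          ⟦ F ⟧ (dual M)               ≈⟨ hat-copairing M F ⟨
          hat B M (copairing F)        ∎
        where
        open 𝕀°-Reasoning
        module k = MVHom k
        hat∘k-isHomomorphism : ∀ M → IsMVHomomorphism raw 𝕀°-raw (hat B M ∘ k.fun)
        hat∘k-isHomomorphism M = record
          { ⟦⟧-cong = λ F≈G → ⟦⟧-cong (k.⟦⟧-cong F≈G)
          ; ⊕-homo  = λ F G → 𝕀°.trans (⟦⟧-cong (k.⊕-homo F G)) (⊕-homo _ _)
          ; ~-homo  = λ F → 𝕀°.trans (⟦⟧-cong (k.~-homo F)) (~-homo _)
          ; 0#-homo = 𝕀°.trans (⟦⟧-cong k.0#-homo) 0#-homo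
          }
          where open IsMVHomomorphism (hat-isHomomorphism B M)

corollary6p4 : ∀ {c ℓ} → (∀ {a} → ExcludedMiddle a) → HasCoproducts c (LCC c ℓ)
corollary6p4 em A = record
  { ∐       = mvAlgebra , isLCC
  ; inj     = λ i → record { fun = injection i ; isMVHomomorphism = injection-isHomomorphism i }
  ; copair  = λ {(B , B-lcc)} f → let open Copairing B B-lcc f in
      record { fun = copairing ; isMVHomomorphism = copairing-isHomomorphism }
  ; commute = λ {(B , B-lcc)} f → Copairing.copairing-injection B B-lcc f
  ; unique  = λ {(B , B-lcc)} f k → Copairing.copairing-unique B B-lcc f k
  }
  where open Clopens em (λ i → proj₁ (A i))
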